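{- The Min-Cut under the Nodal SRLG-like correlated model (MC-NSRLG) problem is solvable in polynomial time when (1) only the nodal links in the form of $(u,v)$ and $(v,y)$ follow the SRLG-like correlated model and/or (2) for any node $u\in\mathcal{N}$, at most two nodal links $(u,v)$ and $(u,x)$ follow the SRLG-like correlated model.
   Context: A network $G(\mathcal{N},\mathcal{L})$ has a set $\mathcal{N}$ of nodes and a set $\mathcal{L}$ of $L$ directed links, each link $l$ with a nonnegative cost $w(l)$. A cut separating a source $s$ from a target $t$ is given by a partition of $\mathcal{N}$ into $X\ni s$ and $\mathcal{N}\setminus X\ni t$; its links are the links going from $X$ to $\mathcal{N}\setminus X$, and its cost is the joint total cost of these links. Joint costs: for $m>1$ distinct links, $w(l_1)\oplus\cdots\oplus w(l_m)=\rho_{1,\dots,m}(w(l_1)+\cdots+w(l_m))$ with correlation coefficient $\rho_{1,\dots,m}\in(0,\infty)$; links are uncorrelated when the coefficient is $1$. A Correlated Group (CG) is a set of links in which every link is correlated with some other link of the set. SRLG-like correlated model: if $l_1,\dots,l_m$ ($1<m\le L$) form a Correlated Group, then, for $1<j\le m$, $w(l_1)\oplus w(l_2)\oplus\cdots\oplus w(l_j)$ is greater than the sum of at most $j-1$ of these $j$ link costs, but smaller than $w(l_1)+w(l_2)+\cdots+w(l_j)$. Nodal SRLG-like correlated model: only the links that share the same node (nodal links) follow the SRLG-like correlated model; all other links are uncorrelated. MC-NSRLG problem: given a network following the nodal SRLG-like correlated model, a source $s$ and a target $t$, find a cut separating $s$ and $t$ of minimum cost.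
   Formalization: The link costs w(l) and the correlation coefficients ρ are taken to be rational numbers (given as numerator and denominator) rather than arbitrary real numbers. -}

module Defs where

open import Data.Bool.Base using (if_then_else_; _∧_; not)
open import Data.Fin.Base using (Fin; toℕ)
open import Data.Fin.Subset using (Subset; inside; outside; _∈_; _∉_; _⊆_; _⊂_; _∪_; ⁅_⁆; ∣_∣)
open import Data.Integer.Base using () renaming (∣_∣ to abs)
open import Data.List.Base as List using (List; []; _∷_; _++_; allFin; concatMap; filter; length)
open import Data.List.Membership.Propositional using () renaming (_∈_ to _∈ₗ_)
open import Data.Nat.Base using (ℕ; zero; suc; _+_; _∸_; _*_; _^_; _≤_; _<_)
open import Data.Nat.ListAction using () renaming (sum to sumℕ)
open import Data.Nat.Logarithm using (⌊log₂_⌋)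
open import Data.Nat.Properties using (_≟_; _<?_)
open import Data.Product.Base using (Σ; ∃; _×_; _,_)
open import Data.Rational.Base as ℚ using (ℚ; 0ℚ; 1ℚ; ↥_; ↧ₙ_)
open import Data.Rational.Properties using (+-0-commutativeMonoid)
open import Algebra.Properties.CommutativeMonoid.Sum +-0-commutativeMonoid using (sum)
open import Data.Sum.Base using (_⊎_)
open import Data.Vec.Base as Vec using ([]; _∷_; lookup; tabulate)
open import Relation.Binary.PropositionalEquality using (_≡_; _≢_)
open import Relation.Nullary.Decidable.Core using (does)
open import Relation.Nullary.Negation.Core using (¬_)

------------------------------------------------------------------------
-- Polynomial time
--
-- The machine is a random access machine on natural numbers under the
-- logarithmic cost criterion, so running times agree with Turing machine
-- running times up to a polynomial.  Its programs are structured, and its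
-- memory is divided into arrays: a program names finitely many of them, so
-- they could be interleaved in one linear memory.

bits : ℕ → ℕ
bits k = suc ⌊log₂ k ⌋

Memory : Set
Memory = ℕ → ℕ → ℕ      -- array, index

infixl 6 _⊕_ _⊖_
infixl 7 _⊗_

data Expr : Set where
  lit         : ℕ → Expr
  arr         : ℕ → Expr → Expr
  _⊕_ _⊖_ _⊗_ : Expr → Expr → Expr

⟦_⟧ : Expr → Memory → ℕ
⟦ lit k   ⟧ σ = k
⟦ arr a e ⟧ σ = σ a (⟦ e ⟧ σ)
⟦ e ⊕ f   ⟧ σ = ⟦ e ⟧ σ + ⟦ f ⟧ σ
⟦ e ⊖ f   ⟧ σ = ⟦ e ⟧ σ ∸ ⟦ f ⟧ σ
⟦ e ⊗ f   ⟧ σ = ⟦ e ⟧ σ * ⟦ f ⟧ σ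

cost : Expr → Memory → ℕ
binaryCost : Expr → Expr → Memory → ℕ

cost (lit k)   σ = bits k
cost (arr a e) σ = cost e σ + bits (⟦ e ⟧ σ) + bits (⟦ arr a e ⟧ σ)
cost (e ⊕ f)   σ = binaryCost e f σ
cost (e ⊖ f)   σ = binaryCost e f σ
cost (e ⊗ f)   σ = binaryCost e f σ

binaryCost e f σ = cost e σ + cost f σ + bits (⟦ e ⟧ σ) + bits (⟦ f ⟧ σ)

infix  4 _[_]≔_
infixr 3 _⨾_

data Program : Set where
  skip            : Program
  _[_]≔_          : ℕ → Expr → Expr → Program
  _⨾_             : Program → Program → Program
  test_then_else_ : Expr → Program → Program → Program
  while_loop_     : Expr → Program → Program

update : Memory → ℕ → ℕ → ℕ → Memory
update σ a i v b j = if does (b ≟ a) ∧ does (j ≟ i) then v else σ b j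

-- ⟨ p , σ ⟩⇓[ t ] σ′ : started in σ, p halts in σ′ after time t.
-- A test succeeds when its value is nonzero.
data ⟨_,_⟩⇓[_]_ : Program → Memory → ℕ → Memory → Set where
  skip : ∀ {σ} → ⟨ skip , σ ⟩⇓[ 1 ] σ
  assign : ∀ {σ a e f} →
    ⟨ a [ e ]≔ f , σ ⟩⇓[ binaryCost e f σ ] update σ a (⟦ e ⟧ σ) (⟦ f ⟧ σ)
  seq : ∀ {p q σ₁ σ₂ σ₃ t u} →
    ⟨ p , σ₁ ⟩⇓[ t ] σ₂ → ⟨ q , σ₂ ⟩⇓[ u ] σ₃ → ⟨ p ⨾ q , σ₁ ⟩⇓[ t + u ] σ₃
  test-true : ∀ {e p q σ σ′ t} → ⟦ e ⟧ σ ≢ 0 →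
    ⟨ p , σ ⟩⇓[ t ] σ′ → ⟨ test e then p else q , σ ⟩⇓[ suc (cost e σ + t) ] σ′
  test-false : ∀ {e p q σ σ′ t} → ⟦ e ⟧ σ ≡ 0 →
    ⟨ q , σ ⟩⇓[ t ] σ′ → ⟨ test e then p else q , σ ⟩⇓[ suc (cost e σ + t) ] σ′
  while-true : ∀ {e p σ₁ σ₂ σ₃ t u} → ⟦ e ⟧ σ₁ ≢ 0 →
    ⟨ p , σ₁ ⟩⇓[ t ] σ₂ → ⟨ while e loop p , σ₂ ⟩⇓[ u ] σ₃ →
    ⟨ while e loop p , σ₁ ⟩⇓[ suc (cost e σ₁ + t + u) ] σ₃
  while-false : ∀ {e p σ} → ⟦ e ⟧ σ ≡ 0 →
    ⟨ while e loop p , σ ⟩⇓[ suc (cost e σ) ] σ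

-- An input is a finite sequence of finite arrays, of size its bit length.
Input : Set
Input = List (List ℕ)

size : Input → ℕ
size x = sumℕ (List.map (λ xs → sumℕ (List.map bits xs)) x)

entry : ∀ {A : Set} → A → List A → ℕ → A
entry d []       i       = d
entry d (x ∷ xs) zero    = x
entry d (x ∷ xs) (suc i) = entry d xs i

-- The i-th array of the input is loaded in array 1 + i.  The output is read
-- from array 0; everything outside the input is initially 0.
load : Input → Memory
load x zero    i = 0
load x (suc a) i = entry 0 (entry [] x a) i

record Problem : Set₁ where
  field
    Instance   : Set
    encode     : Instance → Input
    IsSolution : Instance → (ℕ → ℕ) → Set

-- Solvable in polynomial time on the instances satisfying P.
SolvableInPolyTime : (Π : Problem) → (Problem.Instance Π → Set) → Set
SolvableInPolyTime Π P =
  Σ Program λ p → Σ ℕ λ c → Σ ℕ λ k →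
  (I : Instance) → P I →
  Σ ℕ λ t → Σ Memory λ σ →
    ⟨ p , load (encode I) ⟩⇓[ t ] σ ×
    t ≤ c * size (encode I) ^ k ×
    IsSolution I (σ 0)
  where open Problem Π

------------------------------------------------------------------------
-- Correlated networks

-- Costs and coefficients are rational, as they are part of a finite input.
-- The values of ρ on sets of at most one link play no role.
record Network : Set where
  field
    nodes links : ℕ
    tail head   : Fin links → Fin nodes
    w           : Fin links → ℚ
    w-nonneg    : ∀ l → 0ℚ ℚ.≤ w l
    ρ           : Subset links → ℚ
    ρ-pos       : ∀ S → 1 < ∣ S ∣ → 0ℚ ℚ.< ρ S

  Node Link : Set
  Node = Fin nodes
  Link = Fin links

  total : Subset links → ℚ
  total S = sum λ l → if lookup S l then w l else 0ℚ

  joint : Subset links → ℚ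
  joint S = if does (1 <? ∣ S ∣) then ρ S ℚ.* total S else total S

  Correlated : Link → Link → Set
  Correlated e f = e ≢ f × ρ (⁅ e ⁆ ∪ ⁅ f ⁆) ≢ 1ℚ

  IsCG : Subset links → Set
  IsCG G = 1 < ∣ G ∣ × (∀ {e} → e ∈ G → ∃ λ f → f ∈ G × Correlated e f)

  -- T ranges over the choices of at most j - 1 among the j links of S.
  SRLGLike : Subset links → Set
  SRLGLike G = ∀ S → S ⊆ G → 1 < ∣ S ∣ →
    (∀ T → T ⊂ S → total T ℚ.< joint S) × joint S ℚ.< total S

  Incident : Link → Node → Set
  Incident e u = tail e ≡ u ⊎ head e ≡ u

  cutLinks : Subset nodes → Subset links
  cutLinks X = tabulate λ l → lookup X (tail l) ∧ not (lookup X (head l))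

  Separates : Node → Node → Subset nodes → Set
  Separates s t X = s ∈ X × t ∉ X

  IsMinCut : Node → Node → Subset nodes → Set
  IsMinCut s t X = Separates s t X ×
    (∀ Y → Separates s t Y → joint (cutLinks X) ℚ.≤ joint (cutLinks Y))

-- Which sets of links are the Correlated Groups is part of the model: the
-- union of two groups need not be one.  Groups may overlap, since a link
-- (u , v) may be grouped with links at u and with links at v.
record NodalSRLGNetwork : Set where
  field
    network : Network
  open Network network public
  field
    CGs : List (Subset links)

  FollowSRLG : Link → Link → Set
  FollowSRLG e f = e ≢ f × ∃ λ G → G ∈ₗ CGs × e ∈ G × f ∈ G

  field
    isCG     : ∀ {G} → G ∈ₗ CGs → IsCG G
    nodal    : ∀ {G} → G ∈ₗ CGs → ∃ λ u → ∀ {e} → e ∈ G → Incident e u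
    srlgLike : ∀ {G} → G ∈ₗ CGs → SRLGLike G
    -- Sets of links that are uncorrelated with each other have the sum of
    -- their joint costs as joint cost.  In particular joint S ≡ total S when
    -- no two links of S are in a common group.
    uncorrelated : ∀ S T →
      (∀ {e f} → e ∈ S → f ∈ T → e ≢ f × ¬ FollowSRLG e f) →
      joint (S ∪ T) ≡ joint S ℚ.+ joint T

  -- The links are (u , v) and (v , y).
  Consecutive : Link → Link → Set
  Consecutive e f = head e ≡ tail f ⊎ head f ≡ tail e

  -- The links are (u , v) and (u , x).
  SameTail : Link → Link → Set
  SameTail e f = tail e ≡ tail f

  OnlyFollow : (Link → Link → Set) → Set
  OnlyFollow R = ∀ e f → FollowSRLG e f → R e f

  AtMostTwoPerTail : Set
  AtMostTwoPerTail = ∀ (u : Node) (e f g : Link) → Fan u e → Fan u f → Fan u g →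
    e ≡ f ⊎ e ≡ g ⊎ f ≡ g
    where
    Fan : Node → Link → Set
    Fan u e = tail e ≡ u × ∃ λ e′ → SameTail e e′ × FollowSRLG e e′

  Condition₁ Condition₂ Condition₁and₂ : Set
  Condition₁     = OnlyFollow Consecutive
  Condition₂     = OnlyFollow SameTail × AtMostTwoPerTail
  -- Links of both forms may follow the SRLG-like model.
  Condition₁and₂ =
    OnlyFollow (λ e f → Consecutive e f ⊎ SameTail e f) × AtMostTwoPerTail

------------------------------------------------------------------------
-- The MC-NSRLG problem

record MC-NSRLG-Instance : Set where
  field
    net : NodalSRLGNetwork
  open NodalSRLGNetwork net public
  field
    s t : Node
    s≢t : s ≢ t

subsetsOf : ∀ {m} → Subset m → List (Subset m)
subsetsOf []            = [] ∷ []
subsetsOf (outside ∷ G) = List.map (outside ∷_) (subsetsOf G)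
subsetsOf (inside  ∷ G) =
  List.map (outside ∷_) (subsetsOf G) ++ List.map (inside ∷_) (subsetsOf G)

-- The input lists the nodes, the links, their costs, the groups, and the
-- coefficient of every set of at least two links contained in a group.  Sets
-- of links are listed by their indicator vectors, concatenated.  The nodes
-- are listed so that the input size is at least their number.  Coefficients
-- of sets spanning several overlapping groups, which the model leaves open,
-- are not part of the input.
module Encoding (I : MC-NSRLG-Instance) where
  open MC-NSRLG-Instance I

  indicator : ∀ {m} → Subset m → List ℕ
  indicator S = List.map (λ b → if b then 1 else 0) (Vec.toList S)

  groupedSets : List (Subset links)
  groupedSets = concatMap (λ G → filter (λ S → 1 <? ∣ S ∣) (subsetsOf G)) CGs

  encodeInstance : Input
  encodeInstance =
    (nodes ∷ links ∷ length CGs ∷ length groupedSets ∷ toℕ s ∷ toℕ t ∷ []) ∷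
    List.map toℕ (allFin nodes) ∷
    List.map (λ l → toℕ (tail l)) (allFin links) ∷
    List.map (λ l → toℕ (head l)) (allFin links) ∷
    List.map (λ l → abs (↥ w l)) (allFin links) ∷
    List.map (λ l → ↧ₙ w l) (allFin links) ∷
    concatMap indicator CGs ∷
    concatMap indicator groupedSets ∷
    List.map (λ S → abs (↥ ρ S)) groupedSets ∷
    List.map (λ S → ↧ₙ ρ S) groupedSets ∷
    []

-- The output is the source side of a cut, as an indicator function.
decodeCut : (n : ℕ) → (ℕ → ℕ) → Subset n
decodeCut n out = tabulate λ v → not (does (out (toℕ v) ≟ 0))

MC-NSRLG : Problem
MC-NSRLG = record
  { Instance   = MC-NSRLG-Instance
  ; encode     = Encoding.encodeInstance
  ; IsSolution = λ I out → let open MC-NSRLG-Instance I in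
                   IsMinCut s t (decodeCut nodes out)
  }

{-# OPTIONS --safe #-}
-- A cut contains no two consecutive links, and no loop.  Hence under each of
-- the conditions the correlated links of a cut fall into pairs {e, f} of links
-- with a common tail, and every link has at most one possible partner.  Cutting
-- both e = (u, v) and f = (u, x) saves c = w(e) + w(f) - ρ(w(e) + w(f)), where
-- 0 < c < w(e), w(f).  Twice the cost of a cut is the sum over all links
-- e = (u, v), with partner (u, x), of 2 (w(e) - c) if e is cut and c if e or its
-- partner is cut; the second term is the least cost, over both sides for a new
-- node a, of a cut through arcs u → a, a → v and a → x of capacity c.  So the
-- problem reduces to an ordinary minimum cut, after multiplying all costs with
-- the product of all denominators.
--
-- Minimum cuts are found by capacity scaling: for Δ a decreasing power of two,
-- push Δ along paths from s to t in the residual graph while there are any.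
-- Pushing lowers all cuts that separate s and t by the same amount, and when no
-- path is left the set of nodes reached from s is a cut of at most A Δ, for A
-- arcs.  So there are at most 2 A pushes for each Δ, and the last cut is minimum.
--
-- Running times are bounded by counting steps: apart from products with input
-- numbers the programs only add and subtract, so numbers gain a bounded number
-- of bits in each step.
module Submission where

open import Data.Bool.Base using (Bool; true; false; if_then_else_; _∧_; _∨_; not; T)
open import Data.Empty using (⊥)
open import Data.Fin.Base as Fin using (Fin; zero; suc; toℕ; fromℕ<)
import Data.Fin.Properties as Finₚ
open import Data.Fin.Subset using (Subset; inside; outside; _∈_; _∉_; _⊆_; _⊂_; _∪_; ⁅_⁆; ∣_∣)
open import Data.Fin.Subset.Properties using
  (_∈?_; nonempty?; x∈⁅x⁆; x∈⁅y⁆⇒x≡y; ∣⁅x⁆∣≡1; p⊆q⇒∣p∣≤∣q∣; p⊂q⇒∣p∣<∣q∣; x∈p∪q⁻; x∈p∪q⁺;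
   ∪-comm; drop-∷-⊆; out⊆; in⊆in)
open import Data.Integer.Base as ℤ using () renaming (+_ to pos; ∣_∣ to abs)
import Data.Integer.Properties as ℤₚ
open import Data.List.Base as List using (List; []; _∷_; _++_; length; allFin; concatMap)
open import Data.List.Membership.Propositional using (find; lose) renaming (_∈_ to _∈ₗ_)
open import Data.List.Membership.Propositional.Properties using
  (∈-lookup; ∈-map⁺; ∈-map⁻; ∈-++⁺ˡ; ∈-++⁺ʳ; ∈-++⁻; ∈-filter⁺; ∈-filter⁻; ∈-concatMap⁺; ∈-concatMap⁻)
import Data.List.Properties as Listₚ
open import Data.List.Relation.Unary.Any as Any using (any?; here)
open import Data.List.Relation.Unary.Any.Properties using (lookup-index)
open import Data.Nat.Base
open import Data.Nat.ListAction using () renaming (sum to sumℕ)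
open import Data.Nat.Logarithm using (⌊log₂_⌋; ⌊log₂⌋-mono-≤; ⌊log₂[2^n]⌋≡n)
open import Data.Nat.Properties
open import Data.Nat.Tactic.RingSolver using (solve-∀)
open import Data.Product.Base using (Σ; ∃; _×_; _,_; proj₁; proj₂)
open import Data.Rational.Base as ℚ using (ℚ; mkℚ; 0ℚ; 1ℚ; ↥_; ↧ₙ_; toℚᵘ)
import Data.Rational.Properties as ℚₚ
open import Data.Rational.Solver using (module +-*-Solver)
import Data.Rational.Unnormalised.Base as ℚᵘ
import Data.Rational.Unnormalised.Properties as ℚᵘₚ
open import Data.Sum.Base using (_⊎_; inj₁; inj₂)
open import Data.Unit.Base using (⊤; tt)
open import Data.Vec.Base as Vec using (lookup; tabulate)
open import Data.Vec.Properties using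
  ([]=⇒lookup; lookup⇒[]=; lookup∘tabulate; tabulate∘lookup; tabulate-cong; lookup-zipWith)
open import Function.Base using (_∘_; case_of_)
open import Relation.Binary.PropositionalEquality
open import Relation.Nullary.Decidable using (Dec; yes; no; does; _×-dec_; ¬?; map′)
open import Relation.Nullary.Negation.Core using (¬_; contradiction)
open import Algebra.Properties.CommutativeMonoid.Sum ℚₚ.+-0-commutativeMonoid using
  (sum; sum-cong-≗; ∑-distrib-+)
open import Defs

-- The coefficients of sets that span several groups are not part of the input, so the cost of a cut
-- cannot be read off directly: `uncorrelated` has to split the cut into blocks whose coefficients
-- are listed. Costs are doubled because each link gets its own gadget. The saving of a pair is then
-- counted once from each of its links, all links are treated alike, and no representative of a pair
-- has to be chosen. Augmenting along arbitrary paths may take as many pushes as the capacities are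
-- large, which is exponential in the input size; this is what scaling avoids. No flow on arcs and
-- no conservation law occurs. A push is known only by its effect on separating cuts, and that is
-- enough: when some cut has residual capacity 0, its cost is the total amount pushed, and no
-- separating cut costs less. Under the logarithmic cost criterion the danger lies in products:
-- repeated squaring doubles bit lengths in each step. Scaling a cost by all denominators needs only
-- factors that are input numbers, and their bit lengths add up to at most the input size.

-- Commands with bounded loops, their semantics and their compilation

infixr 3 _▸_

-- Loops run a counter, kept in cell 0 of an array, up to the content of a cell
-- that the body may not change.
data Cmd : Set where
  nop  : Cmd
  set  : ℕ → Expr → Expr → Cmd
  _▸_  : Cmd → Cmd → Cmd
  cond : Expr → Cmd → Cmd → Cmd
  for  : (counter array index : ℕ) → Cmd → Cmd

var : ℕ → Expr
var x = arr x (lit 0)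

infix 5 _≔_
_≔_ : ℕ → Expr → Cmd
x ≔ e = set x (lit 0) e

compile : Cmd → Program
compile nop           = skip
compile (set a e f)   = a [ e ]≔ f
compile (p ▸ q)       = compile p ⨾ compile q
compile (cond e p q)  = test e then compile p else compile q
compile (for x a i p) =
  x [ lit 0 ]≔ lit 0 ⨾
  while arr a (lit i) ⊖ var x loop (compile p ⨾ x [ lit 0 ]≔ var x ⊕ lit 1)

iter : {A : Set} → ℕ → (A → A) → A → A
iter zero    f x = x
iter (suc n) f x = f (iter n f x)

branch : {A : Set} → ℕ → A → A → A
branch zero    x y = y
branch (suc _) x y = x

tick : ℕ → Memory → Memory
tick x σ = update σ x 0 (σ x 0 + 1)

-- The number of rounds of a loop is read once, on entry, which makes the semantics total. The
-- compiled loop reads the cell again before each round; the two agree because admissible commands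
-- take loop bounds from read-only arrays.
exec : Cmd → Memory → Memory
exec nop           σ = σ
exec (set a e f)   σ = update σ a (⟦ e ⟧ σ) (⟦ f ⟧ σ)
exec (p ▸ q)       σ = exec q (exec p σ)
exec (cond e p q)  σ = branch (⟦ e ⟧ σ) (exec p σ) (exec q σ)
exec (for x a i p) σ = iter (σ a i) (λ τ → tick x (exec p τ)) (update σ x 0 0)

-- Being Boolean, it evaluates on concrete commands, so that uses of `frame` are discharged by
-- `refl`.
writes : Cmd → ℕ → Bool
writes nop           b = false
writes (set a _ _)   b = b ≡ᵇ a
writes (p ▸ q)       b = writes p b ∨ writes q b
writes (cond _ p q)  b = writes p b ∨ writes q b
writes (for x _ _ p) b = (b ≡ᵇ x) ∨ writes p b

branch-case : {A : Set} (P : A → Set) (n : ℕ) {x y : A} →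
  (n ≢ 0 → P x) → (n ≡ 0 → P y) → P (branch n x y)
branch-case P zero    f g = g refl
branch-case P (suc n) f g = f λ ()

∨-false : ∀ {x y} → x ∨ y ≡ false → x ≡ false × y ≡ false
∨-false {false} {false} _ = refl , refl

update-array : ∀ σ a i v {b} → (b ≡ᵇ a) ≡ false → ∀ j → update σ a i v b j ≡ σ b j
update-array σ a i v eq j rewrite eq = refl

iter-inv : {A : Set} (P : ℕ → A → Set) {f : A → A} {x : A} (n : ℕ) → P 0 x →
  (∀ m y → m < n → P m y → P (suc m) (f y)) → P n (iter n f x)
iter-inv P zero    p₀ ps = p₀
iter-inv P (suc n) p₀ ps =
  ps n _ ≤-refl (iter-inv P n p₀ λ m y m<n → ps m y (m<n⇒m<1+n m<n))

frame : ∀ p b → writes p b ≡ false → ∀ σ j → exec p σ b j ≡ σ b j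
frame nop           b w σ j = refl
frame (set a e f)   b w σ j = update-array σ a (⟦ e ⟧ σ) (⟦ f ⟧ σ) w j
frame (p ▸ q)       b w σ j with ∨-false {writes p b} w
... | wp , wq = trans (frame q b wq (exec p σ) j) (frame p b wp σ j)
frame (cond e p q)  b w σ j with ∨-false {writes p b} w
... | wp , wq = branch-case (λ τ → τ b j ≡ σ b j) (⟦ e ⟧ σ) {exec p σ} {exec q σ}
  (λ _ → frame p b wp σ j) (λ _ → frame q b wq σ j)
frame (for x a i p) b w σ j with ∨-false {b ≡ᵇ x} w
... | wx , wp = iter-inv (λ _ τ → τ b j ≡ σ b j) (σ a i)
  (update-array σ x 0 0 wx j)
  λ m τ _ h → trans (update-array (exec p τ) x 0 _ wx j) (trans (frame p b wp τ j) h)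

≡ᵇ-yes : ∀ {i j} → j ≡ i → (j ≡ᵇ i) ≡ true
≡ᵇ-yes {zero}  refl = refl
≡ᵇ-yes {suc i} refl = ≡ᵇ-yes {i} refl

≡ᵇ-no : ∀ {i j} → j ≢ i → (j ≡ᵇ i) ≡ false
≡ᵇ-no {i} {j} j≢i with j ≡ᵇ i in eq
... | false = refl
... | true  = contradiction (≡ᵇ⇒≡ j i (subst T (sym eq) tt)) j≢i

update-same : ∀ σ a i v → update σ a i v a i ≡ v
update-same σ a i v rewrite ≡ᵇ-yes {a} refl | ≡ᵇ-yes {i} refl = refl

if-≡ᵇ-yes : ∀ {i j} {A : Set} {v w : A} → j ≡ i → (if j ≡ᵇ i then v else w) ≡ v
if-≡ᵇ-yes {i} {j} j≡i rewrite ≡ᵇ-yes j≡i = refl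

if-≡ᵇ-no : ∀ {i j} {A : Set} {v w : A} → j ≢ i → (if j ≡ᵇ i then v else w) ≡ w
if-≡ᵇ-no {i} {j} j≢i rewrite ≡ᵇ-no j≢i = refl

-- Running times

bits-< : ∀ {v m} → v < 2 ^ m → bits v ≤ suc m
bits-< {v} {m} v<2^m =
  s≤s (subst (⌊log₂ v ⌋ ≤_) (⌊log₂[2^n]⌋≡n m) (⌊log₂⌋-mono-≤ (<⇒≤ v<2^m)))

<-2^bits : ∀ v → v < 2 ^ bits v
<-2^bits v with v <? 2 ^ bits v
... | yes v<  = v<
... | no ¬v< = contradiction
  (subst (_≤ ⌊log₂ v ⌋) (⌊log₂[2^n]⌋≡n (bits v)) (⌊log₂⌋-mono-≤ (≮⇒≥ ¬v<)))
  (<⇒≱ ≤-refl)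

k<2^k : ∀ k → k < 2 ^ k
k<2^k zero    = s≤s z≤n
k<2^k (suc k) = ≤-trans (+-mono-≤ (≤-trans (s≤s z≤n) (k<2^k k)) (k<2^k k))
  (≤-reflexive (cong (2 ^ k +_) (sym (+-identityʳ (2 ^ k)))))

2^-mono : ∀ {m n} → m ≤ n → 2 ^ m ≤ 2 ^ n
2^-mono = ^-monoʳ-≤ 2

+-<-2^ : ∀ {x y m n} → x < 2 ^ m → y < 2 ^ m → suc m ≤ n → x + y < 2 ^ n
+-<-2^ {x} {y} {m} x< y< m<n = <-≤-trans (+-mono-< x< y<)
  (≤-trans (≤-reflexive (cong (2 ^ m +_) (sym (+-identityʳ (2 ^ m))))) (2^-mono m<n))

*-<-2^ : ∀ {x y m n} → x < 2 ^ m → y < 2 ^ n → x * y < 2 ^ (m + n)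
*-<-2^ {x} {y} {m} {n} x< y< =
  subst (x * y <_) (sym (^-distribˡ-+-* 2 m n)) (*-mono-< x< y<)

-- A literal `k` has size `suc k` and not 1, so that one measure bounds both the running time of an
-- expression and the bit length of its value.
esize : Expr → ℕ
esize (lit k)   = suc k
esize (arr _ e) = suc (esize e)
esize (e ⊕ f)   = suc (esize e + esize f)
esize (e ⊖ f)   = suc (esize e + esize f)
esize (e ⊗ f)   = suc (esize e + esize f)

csize : Cmd → ℕ
csize nop           = 1
csize (set _ e f)   = suc (esize e + esize f)
csize (p ▸ q)       = csize p + csize q
csize (cond e p q)  = suc (esize e + csize p + csize q)
-- The compiled loop adds a reset, a guard of size depending on `i`, and an increment; `10 + i`
-- exceeds the size of each.
csize (for x a i p) = 10 + i + csize p

-- Z bounds the number of rounds of every loop.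
steps : ℕ → Cmd → ℕ
steps Z nop           = 1
steps Z (set _ _ _)   = 1
steps Z (p ▸ q)       = steps Z p + steps Z q
steps Z (cond _ p q)  = suc (steps Z p + steps Z q)
steps Z (for _ _ _ p) = 2 + Z * (steps Z p + 2)

Runs : Program → Memory → Memory → ℕ → ℕ → Set
Runs P σ τ k u = Σ ℕ λ t → ⟨ P , σ ⟩⇓[ t ] τ × t ≤ k * u

-- One factor of every product is a read-only cell, so each assignment adds
-- only boundedly many bits to the largest number in memory.
module Admissible (ro : ℕ → Bool) (bound : ℕ → ℕ → Bool) where

  okE : Expr → Set
  okE (lit k)         = ⊤
  okE (arr a e)       = okE e
  okE (e ⊕ f)         = okE e × okE f
  okE (e ⊖ f)         = okE e × okE f
  okE (e ⊗ arr a f)   = T (ro a) × okE e × okE f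
  okE (e ⊗ _)         = ⊥

  ok : Cmd → Set
  ok nop           = ⊤
  ok (set a e f)   = T (not (ro a)) × okE e × okE f
  ok (p ▸ q)       = ok p × ok q
  ok (cond e p q)  = okE e × ok p × ok q
  ok (for x a i p) = T (not (ro x)) × T (ro a) × T (bound a i) × T (not (writes p x)) × ok p

  T-not : ∀ {b} → T (not b) → b ≡ false
  T-not {false} _ = refl

  ro-≢ : ∀ {a x} → T (ro a) → T (not (ro x)) → (a ≡ᵇ x) ≡ false
  ro-≢ {a} {x} ra rx with a ≡ᵇ x in eq
  ... | false = refl
  ... | true with ≡ᵇ⇒≡ a x (subst T (sym eq) tt)
  ... | refl = contradiction ra (subst (¬_ ∘ T) (sym (T-not rx)) λ ())

  ok-writes : ∀ p {a} → ok p → T (ro a) → writes p a ≡ false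
  ok-writes nop           o ra = refl
  ok-writes (set b e f)   (rb , _) ra = ro-≢ ra rb
  ok-writes (p ▸ q)       (op , oq) ra = cong₂ _∨_ (ok-writes p op ra) (ok-writes q oq ra)
  ok-writes (cond e p q)  (_ , op , oq) ra =
    cong₂ _∨_ (ok-writes p op ra) (ok-writes q oq ra)
  ok-writes (for x b i p) (rx , _ , _ , _ , op) ra =
    cong₂ _∨_ (ro-≢ ra rx) (ok-writes p op ra)

  -- `B` bounds the bit lengths of read-only cells, `Z` the loop bounds, `S` the sizes of commands,
  -- and `b∞` the bit lengths of all cells throughout the run. Each node of an expression
  -- contributes at most two bit lengths to its cost, so `u` covers any single assignment or test;
  -- `g` covers the bits that an assignment adds.
  module Time (B Z S b∞ : ℕ) where

    g u : ℕ
    g = S * B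
    u = 3 * S * suc (b∞ + g)

    record State (b : ℕ) (σ : Memory) : Set where
      constructor state
      field
        small : ∀ a i → σ a i < 2 ^ b
        fixed : ∀ a → T (ro a) → ∀ i → σ a i < 2 ^ B
        loops : ∀ a i → T (bound a i) → σ a i ≤ Z
        1≤B   : 1 ≤ B

    weaken : ∀ {b b′ σ} → b ≤ b′ → State b σ → State b′ σ
    weaken b≤ (state s f l p) = state (λ a i → <-≤-trans (s a i) (2^-mono b≤)) f l p

    -- Each operation adds at most `B` bits: a sum one bit, a difference none, and a product at most
    -- the bits of its read-only factor.
    value : ∀ {b σ} → State b σ → ∀ e → okE e → ⟦ e ⟧ σ < 2 ^ (b + esize e * B)
    value {b} st (lit k) o = <-≤-trans (k<2^k k)
      (2^-mono (≤-trans (≤-trans (n≤1+n k)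
        (≤-trans (≤-reflexive (sym (*-identityʳ (suc k)))) (*-monoʳ-≤ (suc k) (State.1≤B st))))
        (m≤n+m _ b)))
    value {b} st (arr a e) o = <-≤-trans (State.small st a _) (2^-mono (m≤m+n b (esize (arr a e) * B)))
    value {b} st (e ⊕ f) (oe , of) = +-<-2^
      (<-≤-trans (value st e oe) (2^-mono (+-monoʳ-≤ b (m≤m+n _ (esize f * B)))))
      (<-≤-trans (value st f of) (2^-mono (+-monoʳ-≤ b (m≤n+m _ (esize e * B)))))
      (≤-trans (+-mono-≤ (State.1≤B st) (≤-reflexive refl))
        (≤-reflexive (lemma b B (esize e) (esize f))))
      where
      lemma : ∀ b B x y → B + (b + (x * B + y * B)) ≡ b + suc (x + y) * B
      lemma = solve-∀
    value {b} st (e ⊖ f) (oe , of) = ≤-<-trans (m∸n≤m _ (⟦ f ⟧ _))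
      (<-≤-trans (value st e oe)
        (2^-mono (+-monoʳ-≤ b (*-monoˡ-≤ B (≤-trans (m≤m+n (esize e) (esize f)) (n≤1+n _))))))
    value {b} {σ} st (e ⊗ arr a f) (ra , oe , of) = <-≤-trans
      (*-<-2^ {m = b + esize e * B} {B} (value st e oe) (State.fixed st a ra (⟦ f ⟧ σ)))
      (2^-mono (≤-trans (m≤m+n (b + esize e * B + B) (B + esize f * B)) (≤-reflexive (lemma b B (esize e) (esize f)))))
      where
      lemma : ∀ b B x y → b + x * B + B + (B + y * B) ≡ b + suc (x + suc y) * B
      lemma = solve-∀

    module _ {b : ℕ} (b+g≤ : b + g ≤ b∞) where

      q : ℕ
      q = suc (b∞ + g)

      value-bits : ∀ {σ} → State b σ → ∀ e → okE e → esize e ≤ S → bits (⟦ e ⟧ σ) ≤ q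
      value-bits st e o s = ≤-trans (bits-< (value st e o))
        (s≤s (≤-trans (+-monoʳ-≤ b (*-monoˡ-≤ B s)) (≤-trans b+g≤ (m≤m+n _ g))))

      binary-≤ : ∀ {x y v w} s t → x ≤ 3 * s * q → y ≤ 3 * t * q → v ≤ q → w ≤ q →
        x + y + v + w ≤ 3 * suc (s + t) * q
      binary-≤ s t x≤ y≤ v≤ w≤ =
        ≤-trans (+-mono-≤ (+-mono-≤ (+-mono-≤ x≤ y≤) v≤) (≤-trans w≤ (m≤m+n q q)))
          (≤-reflexive (lemma s t q))
        where
        lemma : ∀ s t q → 3 * s * q + 3 * t * q + q + (q + q) ≡ 3 * suc (s + t) * q
        lemma = solve-∀

      cost-≤ : ∀ {σ} → State b σ → ∀ e → okE e → esize e ≤ S → cost e σ ≤ 3 * esize e * q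
      binaryCost-≤ : ∀ {σ} → State b σ → ∀ e f → okE e → okE f → suc (esize e + esize f) ≤ S →
        binaryCost e f σ ≤ 3 * suc (esize e + esize f) * q
      cost-≤ st (lit k) o s =
        ≤-trans (value-bits st (lit k) o s)
          (≤-trans (m≤m+n q (2 * q)) (*-monoˡ-≤ q (*-monoʳ-≤ 3 {1} {suc k} (s≤s z≤n))))
      cost-≤ {σ} st (arr a e) o s =
        ≤-trans (+-mono-≤ (+-mono-≤ (cost-≤ st e o (<⇒≤ s)) (value-bits st e o (<⇒≤ s)))
          (≤-trans (value-bits st (arr a e) o s) (m≤m+n q q)))
          (≤-reflexive (lemma (esize e) q))
        where
        lemma : ∀ s q → 3 * s * q + q + (q + q) ≡ 3 * suc s * q
        lemma = solve-∀
      cost-≤ st (e ⊕ f) (oe , of) s = binaryCost-≤ st e f oe of s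
      cost-≤ st (e ⊖ f) (oe , of) s = binaryCost-≤ st e f oe of s
      cost-≤ st (e ⊗ arr a f) (ra , oe , of) s = binaryCost-≤ st e (arr a f) oe of s
      binaryCost-≤ st e f oe of s =
        binary-≤ (esize e) (esize f) (cost-≤ st e oe se) (cost-≤ st f of sf)
          (value-bits st e oe se) (value-bits st f of sf)
        where
        se = ≤-trans (≤-trans (m≤m+n _ (esize f)) (n≤1+n _)) s
        sf = ≤-trans (≤-trans (m≤n+m _ (esize e)) (n≤1+n _)) s

      assign-≤ : ∀ {σ} → State b σ → ∀ e f → okE e → okE f → suc (esize e + esize f) ≤ S →
        binaryCost e f σ ≤ 1 * u
      assign-≤ st e f oe of s = ≤-trans (binaryCost-≤ st e f oe of s)
        (≤-trans (*-monoˡ-≤ q (*-monoʳ-≤ 3 s)) (≤-reflexive (sym (+-identityʳ u))))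

      test-≤ : ∀ {σ} → State b σ → ∀ e → okE e → suc (esize e) ≤ S → suc (cost e σ) ≤ u
      test-≤ st e o s = ≤-trans
        (+-mono-≤ {1} {3 * 1 * q} (s≤s z≤n) (cost-≤ st e o (<⇒≤ s)))
        (≤-trans (≤-reflexive (lemma (esize e) q)) (*-monoˡ-≤ q (*-monoʳ-≤ 3 s)))
        where
        lemma : ∀ s q → 3 * 1 * q + 3 * s * q ≡ 3 * suc s * q
        lemma = solve-∀

      update-State : ∀ {σ v} a i → T (not (ro a)) → State b σ → v < 2 ^ (b + g) →
        (∀ j → T (bound a j) → ⊥) → State (b + g) (update σ a i v)
      update-State {σ} {v} a i ra st v< nb = state sm fx lp (State.1≤B st)
        where
        sm : ∀ c j → update σ a i v c j < 2 ^ (b + g)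
        sm c j with does (c ≟ a) ∧ does (j ≟ i)
        ... | true  = v<
        ... | false = <-≤-trans (State.small st c j) (2^-mono (m≤m+n b g))
        fx : ∀ c → T (ro c) → ∀ j → update σ a i v c j < 2 ^ B
        fx c rc j rewrite ro-≢ {c} {a} rc ra = State.fixed st c rc j
        lp : ∀ c j → T (bound c j) → update σ a i v c j ≤ Z
        lp c j bc with c ≡ᵇ a in eq
        ... | true with ≡ᵇ⇒≡ c a (subst T (sym eq) tt)
        ...   | refl = contradiction bc (nb j)
        lp c j bc | false = State.loops st c j bc

    -- The same count `k` measures time, in units of `u`, and growth, in units of `g` bits. Both are
    -- additive under composition. The premise keeps all numbers within `b∞`, on which the unit `u`
    -- depends.
    Step : Program → (Memory → Memory) → ℕ → Set
    Step P f k = ∀ {b σ} → State b σ → b + k * g ≤ b∞ →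
      Runs P σ (f σ) k u × State (b + k * g) (f σ)

    while-runs : ∀ e P f k → okE e → suc (esize e) ≤ S → Step P f k →
      ∀ n σ {b} → State b σ → b + (1 + n * suc k) * g ≤ b∞ →
      (∀ m → m < n → ⟦ e ⟧ (iter m f σ) ≢ 0) → ⟦ e ⟧ (iter n f σ) ≡ 0 →
      Runs (while e loop P) σ (iter n f σ) (1 + n * suc k) u ×
      State (b + (1 + n * suc k) * g) (iter n f σ)
    while-runs e P f k oe se step n σ {b} st b≤ nonzero stop =
      from n 0 (+-identityʳ n) st≤ , weaken (≤-trans (+-monoʳ-≤ b
        (*-monoˡ-≤ g (≤-trans (*-monoʳ-≤ n (n≤1+n k)) (n≤1+n _)))) ≤-refl) (states n ≤-refl)
      where
      room : ∀ m → m < n → b + m * k * g + k * g ≤ b∞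
      room m m<n = ≤-trans (≤-reflexive (lemma b m k g)) (≤-trans (+-monoʳ-≤ b
        (*-monoˡ-≤ g (≤-trans (*-monoˡ-≤ k m<n) (≤-trans (*-monoʳ-≤ n (n≤1+n k)) (n≤1+n _))))) b≤)
        where
        lemma : ∀ b m k g → b + m * k * g + k * g ≡ b + suc m * k * g
        lemma = solve-∀
      states : ∀ m → m ≤ n → State (b + m * k * g) (iter m f σ)
      states zero    _   = weaken (≤-reflexive (sym (+-identityʳ b))) st
      states (suc m) m<n = weaken (≤-reflexive (lemma b m k g))
        (proj₂ (step (states m (<⇒≤ m<n)) (room m m<n)))
        where
        lemma : ∀ b m k g → b + m * k * g + k * g ≡ b + suc m * k * g
        lemma = solve-∀
      st≤ : b + n * k * g + g ≤ b∞
      st≤ = ≤-trans (≤-trans (+-monoˡ-≤ g (+-monoʳ-≤ b (*-monoˡ-≤ g (*-monoʳ-≤ n (n≤1+n k)))))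
        (≤-reflexive (lemma b n k g))) b≤
        where
        lemma : ∀ b n k g → b + n * suc k * g + g ≡ b + (1 + n * suc k) * g
        lemma = solve-∀
      testing : ∀ m → m ≤ n → suc (cost e (iter m f σ)) ≤ u
      testing m m≤n = test-≤ (≤-trans (+-monoˡ-≤ g (+-monoʳ-≤ b (*-monoˡ-≤ g (*-monoˡ-≤ k m≤n)))) st≤)
        (states m m≤n) e oe se
      -- A derivation for a loop is built from its last test backwards, so the induction is on the
      -- number `d` of rounds still to come after `m` of them.
      from : ∀ d m → d + m ≡ n → b + n * k * g + g ≤ b∞ →
        Runs (while e loop P) (iter m f σ) (iter n f σ) (1 + d * suc k) u
      from zero m refl r =
        _ , while-false stop , ≤-trans (testing m ≤-refl) (≤-reflexive (sym (+-identityʳ u)))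
      from (suc d) m eq r with proj₁ (step (states m (<⇒≤ m<n)) (room m m<n))
                             | from d (suc m) (trans (+-suc d m) eq) r
        where
        m<n : m < n
        m<n = ≤-trans (s≤s (m≤n+m m d)) (≤-reflexive eq)
      ... | t₁ , ⇓₁ , t₁≤ | t₂ , ⇓₂ , t₂≤ = _ , while-true (nonzero m m<n) ⇓₁ ⇓₂ ,
        ≤-trans (+-mono-≤ (+-mono-≤ (testing m (<⇒≤ m<n)) t₁≤) t₂≤)
          (≤-reflexive (lemma u k d))
        where
        m<n : m < n
        m<n = ≤-trans (s≤s (m≤n+m m d)) (≤-reflexive eq)
        lemma : ∀ u k d → u + k * u + (1 + d * suc k) * u ≡ (1 + suc d * suc k) * u
        lemma = solve-∀

    T-not-⊥ : ∀ {b} → T (not b) → T b → ⊥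
    T-not-⊥ {true} () _

    times-≤ : ∀ {b k l} → k ≤ l → b + l * g ≤ b∞ → b + k * g ≤ b∞
    times-≤ {b} k≤l = ≤-trans (+-monoʳ-≤ b (*-monoˡ-≤ g k≤l))

    weaken-times : ∀ {b k l σ} → k ≤ l → State (b + k * g) σ → State (b + l * g) σ
    weaken-times {b} k≤l = weaken (+-monoʳ-≤ b (*-monoˡ-≤ g k≤l))

    regroup : ∀ b x y g → b + x * g + y * g ≡ b + (x + y) * g
    regroup = solve-∀

    set-step : (∀ a i → T (bound a i) → T (ro a)) → ∀ a e f → T (not (ro a)) → okE e → okE f →
      suc (esize e + esize f) ≤ S → Step (a [ e ]≔ f) (exec (set a e f)) 1
    set-step br a e f ra oe of s {b} {σ} st b≤ =
      (_ , assign , assign-≤ r st e f oe of s) ,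
      weaken (≤-reflexive (cong (b +_) (sym (+-identityʳ g))))
        (update-State r a _ ra st (<-≤-trans (value st f of)
          (2^-mono (+-monoʳ-≤ b (*-monoˡ-≤ B (≤-trans (≤-trans (m≤n+m _ (esize e)) (n≤1+n _)) s)))))
          λ j bj → T-not-⊥ ra (br a j bj))
      where
      r : b + g ≤ b∞
      r = ≤-trans (≤-reflexive (cong (b +_) (sym (+-identityʳ g)))) b≤

    seq-step : ∀ {P Q f h k l} → Step P f k → Step Q h l → Step (P ⨾ Q) (λ σ → h (f σ)) (k + l)
    seq-step {P} {Q} {f} {h} {k} {l} sp sq {b} {σ} st b≤ = combine (sp st (times-≤ {b} (m≤m+n k l) b≤))
      where
      combine : Runs P σ (f σ) k u × State (b + k * g) (f σ) →
        Runs (P ⨾ Q) σ (h (f σ)) (k + l) u × State (b + (k + l) * g) (h (f σ))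
      combine ((t₁ , ⇓₁ , t₁≤) , st₁) =
        finish (sq st₁ (≤-trans (≤-reflexive (regroup b k l g)) b≤))
        where
        finish : Runs Q (f σ) (h (f σ)) l u × State (b + k * g + l * g) (h (f σ)) →
          Runs (P ⨾ Q) σ (h (f σ)) (k + l) u × State (b + (k + l) * g) (h (f σ))
        finish ((t₂ , ⇓₂ , t₂≤) , st₂) =
          (_ , seq ⇓₁ ⇓₂ , ≤-trans (+-mono-≤ t₁≤ t₂≤) (≤-reflexive (sym (*-distribʳ-+ u k l)))) ,
          weaken (≤-reflexive (regroup b k l g)) st₂

    cond-step : ∀ {P Q f h k l} e → okE e → suc (esize e) ≤ S → Step P f k → Step Q h l →
      Step (test e then P else Q) (λ σ → branch (⟦ e ⟧ σ) (f σ) (h σ)) (suc (k + l))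
    cond-step {P} {Q} {f} {h} {k} {l} e oe se sp sq {b} {σ} st b≤ =
      branch-case (λ τ → Runs (test e then P else Q) σ τ (suc (k + l)) u × State (b + suc (k + l) * g) τ)
        (⟦ e ⟧ σ) (λ ≢0 → true-case ≢0 (sp st (times-≤ {b} k≤ b≤))) (λ ≡0 → false-case ≡0 (sq st (times-≤ {b} l≤ b≤)))
      where
      k≤ : k ≤ suc (k + l)
      k≤ = ≤-trans (m≤m+n k l) (n≤1+n _)
      l≤ : l ≤ suc (k + l)
      l≤ = ≤-trans (m≤n+m l k) (n≤1+n _)
      testing : suc (cost e σ) ≤ u
      testing = test-≤ (≤-trans (+-monoʳ-≤ b (m≤m+n g _)) b≤) st e oe se
      true-case : ⟦ e ⟧ σ ≢ 0 → Runs P σ (f σ) k u × State (b + k * g) (f σ) →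
        Runs (test e then P else Q) σ (f σ) (suc (k + l)) u × State (b + suc (k + l) * g) (f σ)
      true-case ≢0 ((t , ⇓ , t≤) , st′) =
        (_ , test-true ≢0 ⇓ ,
          ≤-trans (+-mono-≤ testing t≤) (*-monoˡ-≤ u (s≤s (m≤m+n k l)))) ,
        weaken-times {b} k≤ st′
      false-case : ⟦ e ⟧ σ ≡ 0 → Runs Q σ (h σ) l u × State (b + l * g) (h σ) →
        Runs (test e then P else Q) σ (h σ) (suc (k + l)) u × State (b + suc (k + l) * g) (h σ)
      false-case ≡0 ((t , ⇓ , t≤) , st′) =
        (_ , test-false ≡0 ⇓ ,
          ≤-trans (+-mono-≤ testing t≤) (*-monoˡ-≤ u (s≤s (m≤n+m l k)))) ,
        weaken-times {b} l≤ st′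

    -- The body changes neither the counter nor the read-only bound, so after `m` rounds the guard
    -- has the value `n ∸ m`: it is nonzero before each of the `n` rounds and 0 after them.
    for-step : (∀ a i → T (bound a i) → T (ro a)) → ∀ x a i p →
      T (not (ro x)) → T (ro a) → T (bound a i) → T (not (writes p x)) → ok p → 10 + i ≤ S →
      Step (compile p) (exec p) (steps Z p) →
      Step (compile (for x a i p)) (exec (for x a i p)) (steps Z (for x a i p))
    for-step br x a i p rx ra bx nx op s sp {b} {σ} st b≤ =
      finish (set-step br x (lit 0) (lit 0) rx tt tt (≤-trans (m≤m+n 3 (7 + i)) s) st
        (times-≤ {b} {1} {2 + Z * (steps Z p + 2)} (≤-trans (s≤s z≤n) total-≤) b≤))
      where
      n k : ℕ
      n = σ a i
      k = steps Z p + 1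
      f : Memory → Memory
      f τ = tick x (exec p τ)
      σ₀ : Memory
      σ₀ = update σ x 0 0
      total-≤ : 1 + (1 + n * suc k) ≤ 2 + Z * (steps Z p + 2)
      total-≤ = s≤s (s≤s (≤-trans (*-monoˡ-≤ (suc k) (State.loops st a i bx))
        (*-monoʳ-≤ Z (≤-reflexive (sym (+-suc (steps Z p) 1))))))
      body-step : Step (compile p ⨾ x [ lit 0 ]≔ var x ⊕ lit 1) f k
      body-step = seq-step {f = exec p} {tick x} {steps Z p} {1} sp
        (set-step br x (lit 0) (var x ⊕ lit 1) rx tt (tt , tt) (≤-trans (m≤m+n 7 (3 + i)) s))
      x≠a : (a ≡ᵇ x) ≡ false
      x≠a = ro-≢ ra rx
      values : ∀ m → iter m f σ₀ x 0 ≡ m × iter m f σ₀ a i ≡ n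
      values zero    = update-same σ x 0 0 , update-array σ x 0 0 x≠a i
      values (suc m) with values m
      ... | hx , ha =
        trans (update-same (exec p τ) x 0 _)
          (trans (cong (_+ 1) (trans (frame p x (T-not nx) τ 0) hx)) (+-comm m 1)) ,
        trans (update-array (exec p τ) x 0 _ x≠a i)
          (trans (frame p a (ok-writes p op ra) τ i) ha)
        where τ = iter m f σ₀
      guard : Expr
      guard = arr a (lit i) ⊖ var x
      guard-value : ∀ m → ⟦ guard ⟧ (iter m f σ₀) ≡ n ∸ m
      guard-value m = cong₂ _∸_ (proj₂ (values m)) (proj₁ (values m))
      size-≤ : suc (esize guard) ≤ S
      size-≤ = ≤-trans (≤-trans (≤-reflexive (lemma i)) (+-monoˡ-≤ i (m≤m+n 6 4))) s
        where
        lemma : ∀ i → suc (suc (suc (suc i) + 2)) ≡ 6 + i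
        lemma = solve-∀
      room : b + 1 * g + (1 + n * suc k) * g ≤ b∞
      room = ≤-trans (≤-reflexive (regroup b 1 (1 + n * suc k) g))
        (times-≤ {b} total-≤ b≤)
      Result : Set
      Result = Runs (compile (for x a i p)) σ (iter n f σ₀) (2 + Z * (steps Z p + 2)) u ×
        State (b + (2 + Z * (steps Z p + 2)) * g) (iter n f σ₀)
      finish : Runs (x [ lit 0 ]≔ lit 0) σ σ₀ 1 u × State (b + 1 * g) σ₀ → Result
      finish ((t₁ , ⇓₁ , t₁≤) , st₁) = finish′
        (while-runs guard _ f k (tt , tt) size-≤ body-step n σ₀ st₁ room
          (λ m m<n eq → m<n⇒n≢0 (m<n⇒0<n∸m m<n) (trans (sym (guard-value m)) eq))
          (trans (guard-value n) (n∸n≡0 n)))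
        where
        finish′ : Runs (while guard loop (compile p ⨾ x [ lit 0 ]≔ var x ⊕ lit 1)) σ₀ (iter n f σ₀) (1 + n * suc k) u ×
          State (b + 1 * g + (1 + n * suc k) * g) (iter n f σ₀) → Result
        finish′ ((t₂ , ⇓₂ , t₂≤) , st₂) =
          (_ , seq ⇓₁ ⇓₂ , ≤-trans (+-mono-≤ t₁≤ t₂≤)
            (≤-trans (≤-reflexive (sym (*-distribʳ-+ u 1 (1 + n * suc k)))) (*-monoˡ-≤ u total-≤))) ,
          weaken-times {b} {1 + (1 + n * suc k)} total-≤
            (weaken (≤-reflexive (regroup b 1 (1 + n * suc k) g)) st₂)

    run : (∀ a i → T (bound a i) → T (ro a)) → ∀ p → ok p → csize p ≤ S →
      Step (compile p) (exec p) (steps Z p)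
    run br nop o s {b} st b≤ =
      (1 , skip , ≤-trans u≥1 (≤-reflexive (sym (+-identityʳ u)))) , weaken (m≤m+n b _) st
      where
      u≥1 : 1 ≤ u
      u≥1 = *-mono-≤ {1} {3 * S} {1} (≤-trans s (m≤m+n S _)) (s≤s z≤n)
    run br (set a e f) (ra , oe , of) s = set-step br a e f ra oe of s
    run br (p ▸ q) (op , oq) s = seq-step {f = exec p} {exec q} {steps Z p} {steps Z q}
      (run br p op (≤-trans (m≤m+n _ (csize q)) s)) (run br q oq (≤-trans (m≤n+m _ (csize p)) s))
    run br (cond e p q) (oe , op , oq) s = cond-step {f = exec p} {exec q} {steps Z p} {steps Z q} e oe
      (≤-trans (s≤s (≤-trans (m≤m+n (esize e) (csize p)) (m≤m+n _ (csize q)))) s)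
      (run br p op (≤-trans (≤-trans (≤-trans (m≤n+m _ (esize e)) (m≤m+n _ (csize q))) (n≤1+n _)) s))
      (run br q oq (≤-trans (≤-trans (m≤n+m _ (esize e + csize p)) (n≤1+n _)) s))
    run br (for x a i p) (rx , ra , bx , nx , op) s =
      for-step br x a i p rx ra bx nx op (≤-trans (m≤m+n (10 + i) (csize p)) s)
        (run br p op (≤-trans (m≤n+m (csize p) (10 + i)) s))

-- Polynomial bounds

-- The argument 0 is left out so that exponents can be raised freely, as in `poly-+`; encoded
-- instances have positive size.
PolyBounded : (ℕ → ℕ) → Set
PolyBounded f = Σ ℕ λ c → Σ ℕ λ k → ∀ n → 1 ≤ n → f n ≤ c * n ^ k

poly-const : ∀ c → PolyBounded (λ _ → c)
poly-const c = c , 0 , λ n _ → ≤-reflexive (sym (*-identityʳ c))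

poly-id : PolyBounded (λ n → n)
poly-id = 1 , 1 , λ n _ → ≤-reflexive (sym (trans (+-identityʳ (n * 1)) (*-identityʳ n)))

poly-+ : ∀ {f h} → PolyBounded f → PolyBounded h → PolyBounded (λ n → f n + h n)
poly-+ {f} {h} (c , k , f≤) (d , l , h≤) = c + d , k + l , λ n 1≤n →
  ≤-trans (+-mono-≤
    (≤-trans (f≤ n 1≤n) (*-monoʳ-≤ c (^-monoʳ-≤ n {{>-nonZero 1≤n}} (m≤m+n k l))))
    (≤-trans (h≤ n 1≤n) (*-monoʳ-≤ d (^-monoʳ-≤ n {{>-nonZero 1≤n}} (m≤n+m l k)))))
    (≤-reflexive (sym (*-distribʳ-+ (n ^ (k + l)) c d)))

poly-* : ∀ {f h} → PolyBounded f → PolyBounded h → PolyBounded (λ n → f n * h n)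
poly-* {f} {h} (c , k , f≤) (d , l , h≤) = c * d , k + l , λ n 1≤n →
  ≤-trans (*-mono-≤ (f≤ n 1≤n) (h≤ n 1≤n))
    (≤-reflexive (trans (lemma c (n ^ k) d (n ^ l)) (cong (c * d *_) (sym (^-distribˡ-+-* n k l)))))
  where
  lemma : ∀ a b c d → a * b * (c * d) ≡ a * c * (b * d)
  lemma = solve-∀

poly-steps : ∀ {Z} p → PolyBounded Z → PolyBounded (λ n → steps (Z n) p)
poly-steps nop           z = poly-const 1
poly-steps (set _ _ _)   z = poly-const 1
poly-steps (p ▸ q)       z = poly-+ (poly-steps p z) (poly-steps q z)
poly-steps (cond _ p q)  z = poly-+ (poly-const 1) (poly-+ (poly-steps p z) (poly-steps q z))
poly-steps (for _ _ _ p) z =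
  poly-+ (poly-const 2) (poly-* z (poly-+ (poly-steps p z) (poly-const 2)))

-- Finite sums of natural numbers

sumTo : ℕ → (ℕ → ℕ) → ℕ
sumTo zero    f = 0
sumTo (suc n) f = sumTo n f + f n

sumTo-cong : ∀ n {f h} → (∀ i → i < n → f i ≡ h i) → sumTo n f ≡ sumTo n h
sumTo-cong zero    eq = refl
sumTo-cong (suc n) eq =
  cong₂ _+_ (sumTo-cong n λ i i<n → eq i (m<n⇒m<1+n i<n)) (eq n ≤-refl)

sumTo-mono : ∀ n {f h} → (∀ i → i < n → f i ≤ h i) → sumTo n f ≤ sumTo n h
sumTo-mono zero    le = z≤n
sumTo-mono (suc n) le =
  +-mono-≤ (sumTo-mono n λ i i<n → le i (m<n⇒m<1+n i<n)) (le n ≤-refl)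

sumTo-const : ∀ n c → sumTo n (λ _ → c) ≡ n * c
sumTo-const zero    c = refl
sumTo-const (suc n) c = trans (cong (_+ c) (sumTo-const n c)) (+-comm (n * c) c)

sumTo-zero : ∀ n {f} → (∀ i → i < n → f i ≡ 0) → sumTo n f ≡ 0
sumTo-zero n eq = trans (sumTo-cong n eq) (trans (sumTo-const n 0) (*-zeroʳ n))

-- Carrying a summand on both sides avoids truncated subtraction and covers an increase and a
-- decrease at `k` at once.
sumTo-change : ∀ n {f h} k {a b} → k < n → f k + a ≡ h k + b → (∀ i → i ≢ k → f i ≡ h i) →
  sumTo n f + a ≡ sumTo n h + b
sumTo-change (suc n) {f} {h} k {a} {b} k<1+n at off with k ≟ n
... | yes refl = trans (+-assoc (sumTo n f) (f n) a)
  (trans (cong₂ _+_ (sumTo-cong n λ i i<n → off i (<⇒≢ i<n)) at) (sym (+-assoc (sumTo n h) (h n) b)))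
... | no k≢n = begin
  sumTo n f + f n + a ≡⟨ lemma (sumTo n f) (f n) a ⟩
  sumTo n f + a + f n ≡⟨ cong₂ _+_ (sumTo-change n k (≤∧≢⇒< (s≤s⁻¹ k<1+n) k≢n) at off)
                          (off n (k≢n ∘ sym)) ⟩
  sumTo n h + b + h n ≡⟨ lemma (sumTo n h) b (h n) ⟩
  sumTo n h + h n + b ∎
  where
  open ≡-Reasoning
  lemma : ∀ x y z → x + y + z ≡ x + z + y
  lemma = solve-∀

-- Capacity scaling

-- Array 0 is the output.  Arrays 22 to 26 are loop counters: 24 runs over the
-- arcs and 26 over the powers of two.
MARK SRC DST RES REV PAR PW CONST DELTA CNT CUR ARC : ℕ
MARK  = 0
SRC   = 11
DST   = 12
RES   = 13
REV   = 14
PAR   = 15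
PW    = 16
CONST = 17
DELTA = 18
CNT   = 19
CUR   = 20
ARC   = 21

source target : Expr
source = arr 1 (lit 4)
target = arr 1 (lit 5)

-- Cells 0 to 3 of `CONST` hold the numbers of phases, of arcs, of rounds per phase and of nodes.
-- `reach` sweeps over all arcs once per node, and `trace` follows parent arcs from the target for
-- as many rounds as there are nodes, idling once it stands at the source.
relax clear reach back trace augment round phase scaling : Cmd
relax =
  cond (arr MARK (arr SRC (var 24)))
    -- The truncated difference is nonzero exactly when the residual capacity is less than Δ, and
    -- then the arc is unusable.
    (cond (var DELTA ⊖ arr RES (var 24)) nop
      (cond (arr MARK (arr DST (var 24))) nop
        (CNT ≔ var CNT ⊕ lit 1 ▸
         set MARK (arr DST (var 24)) (var CNT) ▸
         set PAR (arr DST (var 24)) (var 24))))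
    nop
clear = for 22 CONST 3 (set MARK (var 22) (lit 0))
reach =
  clear ▸ set MARK source (lit 1) ▸ CNT ≔ lit 1 ▸
  for 23 CONST 3 (for 24 CONST 1 relax)
back =
  cond ((var CUR ⊖ source) ⊕ (source ⊖ var CUR))
    (ARC ≔ arr PAR (var CUR) ▸
     set RES (var ARC) (arr RES (var ARC) ⊖ var DELTA) ▸
     set RES (arr REV (var ARC)) (arr RES (arr REV (var ARC)) ⊕ var DELTA) ▸
     CUR ≔ arr SRC (var ARC))
    nop
trace = CUR ≔ target ▸ for 23 CONST 3 back
augment = cond (arr MARK target) trace nop
round = cond (arr MARK target) (reach ▸ augment) nop
phase =
  DELTA ≔ arr PW (arr CONST (lit 0) ⊖ (var 26 ⊕ lit 1)) ▸
  -- A phase ends with the target unmarked, and `round` idles in that case. Marking the target makes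
  -- the first round of the new phase search again.
  set MARK target (lit 1) ▸ for 25 CONST 2 round
scaling = for 26 CONST 0 phase

-- Loop invariants and crossing arcs

-- The counter is advanced between rounds, so the invariant has to survive arbitrary writes to it; a
-- round is told its value separately.
for-inv : (P : ℕ → Memory → Set) → ∀ x a i p σ → writes p x ≡ false → P 0 (update σ x 0 0) →
  (∀ m τ → m < σ a i → τ x 0 ≡ m → P m τ → P (suc m) (exec p τ)) →
  (∀ m τ v → P m τ → P m (update τ x 0 v)) →
  P (σ a i) (exec (for x a i p) σ)
for-inv P x a i p σ wx p₀ step stable = proj₂ (iter-inv (λ m τ → τ x 0 ≡ m × P m τ) (σ a i)
  (update-same σ x 0 0 , p₀)
  λ m τ m< (hx , pm) →
    trans (update-same (exec p τ) x 0 _) (trans (cong (_+ 1) (trans (frame p x wx τ 0) hx)) (+-comm m 1)) ,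
    stable (suc m) (exec p τ) _ (step m τ m< hx pm))

ind : Bool → ℕ
ind b = if b then 1 else 0

nz : ℕ → ℕ
nz zero    = 0
nz (suc _) = 1

nz≤1 : ∀ n → nz n ≤ 1
nz≤1 zero    = z≤n
nz≤1 (suc _) = ≤-refl

crossing : (ℕ → Bool) → ℕ → ℕ → ℕ
crossing X u v = ind (X u ∧ not (X v))

crossing-≤1 : ∀ X u v → crossing X u v ≤ 1
crossing-≤1 X u v with X u ∧ not (X v)
... | true  = ≤-refl
... | false = z≤n

-- The crossings of an arc and of its reverse differ by `X u` minus `X v`. Along a path these
-- differences telescope, which is why a push from s to t lowers all separating cuts equally.
crossing-swap : ∀ X u v → crossing X u v + ind (X v) ≡ crossing X v u + ind (X u)
crossing-swap X u v with X u | X v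
... | true  | true  = refl
... | true  | false = refl
... | false | true  = refl
... | false | false = refl

positive : ℕ → Bool
positive zero    = false
positive (suc _) = true

positive-≢0 : ∀ {n} → n ≢ 0 → positive n ≡ true
positive-≢0 {zero}  n≢0 = contradiction refl n≢0
positive-≢0 {suc n} _   = refl

distance-0 : ∀ {m n} → (m ∸ n) + (n ∸ m) ≡ 0 → m ≡ n
distance-0 {m} {n} eq = ≤-antisym (m∸n≡0⇒m≤n (m+n≡0⇒m≡0 (m ∸ n) eq))
  (m∸n≡0⇒m≤n (m+n≡0⇒n≡0 (m ∸ n) eq))

distance-refl : ∀ {m n} → m ≡ n → (m ∸ n) + (n ∸ m) ≡ 0
distance-refl {m} refl = cong₂ _+_ (n∸n≡0 m) (n∸n≡0 m)

-- Correctness of search, pushes and phases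

record Graph : Set where
  field
    N A         : ℕ
    src dst rev : ℕ → ℕ
    s t         : ℕ
    src<N       : ∀ k → k < A → src k < N
    dst<N       : ∀ k → k < A → dst k < N
    rev<A       : ∀ k → k < A → rev k < A
    src-rev     : ∀ k → k < A → src (rev k) ≡ dst k
    dst-rev     : ∀ k → k < A → dst (rev k) ≡ src k
    s<N         : s < N
    t<N         : t < N
    s≢t         : s ≢ t

module Scaling (G : Graph) (K : ℕ) where
  open Graph G

  cut : (ℕ → Bool) → (ℕ → ℕ) → ℕ
  cut X r = sumTo A λ k → r k * crossing X (src k) (dst k)

  Sep : (ℕ → Bool) → Set
  Sep X = X s ≡ true × X t ≡ false

  record Fixed (τ : Memory) : Set where
    constructor mkFixed
    field
      fsrc : ∀ k → τ SRC k ≡ src k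
      fdst : ∀ k → τ DST k ≡ dst k
      frev : ∀ k → τ REV k ≡ rev k
      fs   : τ 1 4 ≡ s
      ft   : τ 1 5 ≡ t
      fK   : τ CONST 0 ≡ suc K
      fA   : τ CONST 1 ≡ A
      fR   : τ CONST 2 ≡ suc (A + A)
      fN   : τ CONST 3 ≡ N
      fpw  : ∀ i → i ≤ K → τ PW i ≡ 2 ^ i

  keeps : Cmd → Bool
  keeps p = writes p SRC ∨ (writes p DST ∨ (writes p REV ∨ (writes p 1 ∨ (writes p CONST ∨ writes p PW))))

  fixed-exec : ∀ p {τ} → keeps p ≡ false → Fixed τ → Fixed (exec p τ)
  fixed-exec p {τ} w (mkFixed a b c d e f g h i j)
    with ∨-false {writes p SRC} w
  ... | w₁ , w′ with ∨-false {writes p DST} w′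
  ... | w₂ , w″ with ∨-false {writes p REV} w″
  ... | w₃ , w‴ with ∨-false {writes p 1} w‴
  ... | w₄ , w⁗ with ∨-false {writes p CONST} w⁗
  ... | w₅ , w₆ = mkFixed
    (λ k → trans (frame p SRC w₁ τ k) (a k)) (λ k → trans (frame p DST w₂ τ k) (b k))
    (λ k → trans (frame p REV w₃ τ k) (c k))
    (trans (frame p 1 w₄ τ 4) d) (trans (frame p 1 w₄ τ 5) e)
    (trans (frame p CONST w₅ τ 0) f) (trans (frame p CONST w₅ τ 1) g)
    (trans (frame p CONST w₅ τ 2) h) (trans (frame p CONST w₅ τ 3) i)
    (λ k k≤ → trans (frame p PW w₆ τ k) (j k k≤))

  module Residual (r : ℕ → ℕ) (Δ : ℕ) where

    record FixedR (τ : Memory) : Set where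
      constructor mkFixedR
      field
        fres : ∀ k → τ RES k ≡ r k
        fΔ   : τ DELTA 0 ≡ Δ

    fixedR-exec : ∀ p {τ} → writes p RES ∨ writes p DELTA ≡ false → FixedR τ → FixedR (exec p τ)
    fixedR-exec p {τ} w (mkFixedR a b) with ∨-false {writes p RES} w
    ... | w₁ , w₂ = mkFixedR (λ k → trans (frame p RES w₁ τ k) (a k)) (trans (frame p DELTA w₂ τ 0) b)

    Closed : (ℕ → ℕ) → ℕ → Set
    Closed mark k = mark (src k) ≢ 0 → Δ ≤ r k → mark (dst k) ≢ 0

    AllClosed : (ℕ → ℕ) → Set
    AllClosed mark = ∀ k → k < A → Closed mark k

    -- Marks decrease along parent arcs, so the walk back from t never repeats a node and arrives at
    -- s in fewer than `N` steps.
    record Branch (mark par : ℕ → ℕ) (v : ℕ) : Set where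
      constructor mkBranch
      field
        arc<A  : par v < A
        dst≡   : dst (par v) ≡ v
        marked : mark (src (par v)) ≢ 0
        closer : mark (src (par v)) < mark v
        room   : Δ ≤ r (par v)

    -- Marks number the nodes reached so far in the order of discovery.
    record Search (mark par : ℕ → ℕ) (cnt : ℕ) : Set where
      constructor mkSearch
      field
        count : cnt ≡ sumTo N (λ v → nz (mark v))
        root  : mark s ≡ 1
        bound : ∀ v → v < N → mark v ≤ cnt
        tree  : ∀ v → v < N → mark v ≢ 0 → v ≢ s → Branch mark par v

    cnt≤N : ∀ {mark par cnt} → Search mark par cnt → cnt ≤ N
    cnt≤N sr = ≤-trans (≤-reflexive (Search.count sr))
      (≤-trans (sumTo-mono N λ v _ → nz≤1 _) (≤-reflexive (trans (sumTo-const N 1) (*-identityʳ N))))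

    discover : ∀ {mark par cnt mark′ par′} k → k < A → Search mark par cnt →
      mark (src k) ≢ 0 → Δ ≤ r k → mark (dst k) ≡ 0 →
      mark′ (dst k) ≡ cnt + 1 → (∀ j → j ≢ dst k → mark′ j ≡ mark j) →
      par′ (dst k) ≡ k → (∀ j → j ≢ dst k → par′ j ≡ par j) →
      Search mark′ par′ (cnt + 1)
    discover {mark} {par} {cnt} {mark′} {par′} k k<A (mkSearch c rt b tr) ms room md m≡ m≢ p≡ p≢ = record
      { count = trans (cong (_+ 1) c) (sym (trans (sym (+-identityʳ _))
          (sumTo-change N {λ v → nz (mark′ v)} {λ v → nz (mark v)} d {0} {1} (dst<N k k<A) at-d
          λ j j≢d → cong nz (m≢ j j≢d))))
      ; root  = trans (m≢ s s≢d) rt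
      ; bound = λ v v<N → case v ≟ d of λ where
          (yes v≡d) → ≤-reflexive (trans (cong mark′ v≡d) m≡)
          (no v≢d)  → ≤-trans (≤-reflexive (m≢ v v≢d)) (≤-trans (b v v<N) (m≤m+n cnt 1))
      ; tree  = branches
      }
      where
      d = dst k
      s≢d : s ≢ d
      s≢d s≡d = contradiction (trans (sym rt) (trans (cong mark s≡d) md)) λ ()
      src≢d : src k ≢ d
      src≢d eq = ms (trans (cong mark eq) md)
      at-d : nz (mark′ d) + 0 ≡ nz (mark d) + 1
      at-d = trans (cong (λ x → nz x + 0) (trans m≡ (+-comm cnt 1)))
        (sym (cong (λ x → nz x + 1) md))
      branches : ∀ v → v < N → mark′ v ≢ 0 → v ≢ s → Branch mark′ par′ v
      branches v v<N mv v≢s with v ≟ d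
      ... | yes refl = mkBranch
        (subst (_< A) (sym p≡) k<A) (cong dst p≡)
        (subst (λ z → mark′ (src z) ≢ 0) (sym p≡) (subst (_≢ 0) (sym (m≢ _ src≢d)) ms))
        (subst₂ _<_ (sym (trans (cong (mark′ ∘ src) p≡) (m≢ _ src≢d))) (sym m≡)
          (≤-trans (s≤s (b (src k) (src<N k k<A))) (≤-reflexive (+-comm 1 cnt))))
        (subst (λ z → Δ ≤ r z) (sym p≡) room)
      ... | no v≢d with tr v v<N (subst (_≢ 0) (m≢ v v≢d) mv) v≢s
      ... | mkBranch arc dst≡ mk cl rm = mkBranch
        (subst (_< A) (sym (p≢ v v≢d)) arc) (trans (cong dst (p≢ v v≢d)) dst≡)
        (subst (_≢ 0) (sym mark-eq) mk)
        (subst₂ _<_ (sym mark-eq) (sym (m≢ v v≢d)) cl)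
        (subst (λ z → Δ ≤ r z) (sym (p≢ v v≢d)) rm)
        where
        mark-eq : mark′ (src (par′ v)) ≡ mark (src (par v))
        mark-eq = trans (cong (mark′ ∘ src) (p≢ v v≢d)) (m≢ _ λ eq → mk (trans (cong mark eq) md))

    -- The state of sweep `j` after `m` arcs. While a sweep marks no node, the arcs it has examined
    -- stay closed; once it marks one, the count exceeds `suc j`. So a sweep completes the search or
    -- raises the count, and after `N` sweeps without completion the count would exceed the number
    -- of nodes.
    Progress : ℕ → ℕ → (ℕ → ℕ) → ℕ → Set
    Progress j m mark cnt =
      AllClosed mark ⊎ ((∀ k → k < m → Closed mark k) × j < cnt) ⊎ suc j < cnt

    record Sweep (j m : ℕ) (τ : Memory) : Set where
      constructor mkSweep
      field
        fixed    : Fixed τ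
        fixedR   : FixedR τ
        search   : Search (τ MARK) (τ PAR) (τ CNT 0)
        progress : Progress j m (τ MARK) (τ CNT 0)

    sweep-closed : ∀ {j m τ} → Sweep j m τ → Closed (τ MARK) m → Sweep j (suc m) τ
    sweep-closed {j} {m} {τ} (mkSweep f fr sr p) cl = mkSweep f fr sr (go p)
      where
      go : Progress j m (τ MARK) (τ CNT 0) → Progress j (suc m) (τ MARK) (τ CNT 0)
      go (inj₁ all)               = inj₁ all
      go (inj₂ (inj₂ more))       = inj₂ (inj₂ more)
      go (inj₂ (inj₁ (cls , j<))) = inj₂ (inj₁ (extend , j<))
        where
        extend : ∀ k → k < suc m → Closed (τ MARK) k
        extend k k< with k ≟ m
        ... | yes refl = cl
        ... | no k≢m   = cls k (≤∧≢⇒< (s≤s⁻¹ k<) k≢m)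

    relax-sweep : ∀ j m τ → m < A → τ 24 0 ≡ m → Sweep j m τ → Sweep j (suc m) (exec relax τ)
    relax-sweep j m τ m<A refl sw@(mkSweep f fr sr pr) =
      branch-case (Sweep j (suc m)) (τ MARK (τ SRC m))
        (λ ms → branch-case (Sweep j (suc m)) (τ DELTA 0 ∸ τ RES m)
          (λ no-room → sweep-closed sw λ _ Δ≤ _ → no-room (m≤n⇒m∸n≡0 (subst₂ _≤_ (sym fΔ) (sym (fres m)) Δ≤)))
          (λ room → branch-case (Sweep j (suc m)) (τ MARK (τ DST m))
            (λ md → sweep-closed sw λ _ _ → subst (λ z → τ MARK z ≢ 0) (fdst m) md)
            (λ md → found (subst (λ z → τ MARK z ≢ 0) (fsrc m) ms)
              (subst₂ _≤_ fΔ (fres m) (m∸n≡0⇒m≤n room))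
              (subst (λ z → τ MARK z ≡ 0) (fdst m) md))))
        (λ ms → sweep-closed sw λ ms′ → contradiction (subst (λ z → τ MARK z ≡ 0) (fsrc m) ms) ms′)
      where
      open Fixed f
      open FixedR fr
      act : Cmd
      act = CNT ≔ var CNT ⊕ lit 1 ▸
         set MARK (arr DST (var 24)) (var CNT) ▸
         set PAR (arr DST (var 24)) (var 24)
      found : τ MARK (src m) ≢ 0 → Δ ≤ r m → τ MARK (dst m) ≡ 0 → Sweep j (suc m) (exec act τ)
      found ms room md = mkSweep (fixed-exec act refl f) (fixedR-exec act refl fr)
        (discover m m<A sr ms room md
          (if-≡ᵇ-yes (sym (fdst m))) (λ i i≢ → if-≡ᵇ-no λ eq → i≢ (trans eq (fdst m)))
          (if-≡ᵇ-yes (sym (fdst m))) (λ i i≢ → if-≡ᵇ-no λ eq → i≢ (trans eq (fdst m))))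
        (go pr)
        where
        go : Progress j m (τ MARK) (τ CNT 0) → Progress j (suc m) (exec act τ MARK) (τ CNT 0 + 1)
        go (inj₁ all)              = contradiction md (all m m<A ms room)
        go (inj₂ (inj₁ (_ , j<)))  = inj₂ (inj₂ (≤-trans (s≤s j<) (≤-reflexive (+-comm 1 _))))
        go (inj₂ (inj₂ j<))        = inj₂ (inj₂ (≤-trans j< (m≤m+n _ 1)))

    record Reached (τ : Memory) : Set where
      constructor mkReached
      field
        fixed  : Fixed τ
        fixedR : FixedR τ
        search : Search (τ MARK) (τ PAR) (τ CNT 0)
        closed : AllClosed (τ MARK)

    record Searching (j : ℕ) (τ : Memory) : Set where
      constructor mkSearching
      field
        fixed    : Fixed τ
        fixedR   : FixedR τ
        search   : Search (τ MARK) (τ PAR) (τ CNT 0)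
        progress : AllClosed (τ MARK) ⊎ j < τ CNT 0

    sweep : ∀ j τ → Searching j τ → Searching (suc j) (exec (for 24 CONST 1 relax) τ)
    sweep j τ (mkSearching f fr sr pr) = finish
      (for-inv (Sweep j) 24 CONST 1 relax τ refl
        (mkSweep (fixed-exec (24 ≔ lit 0) refl f) (fixedR-exec (24 ≔ lit 0) refl fr) sr (start pr))
        (λ m τ′ m< → relax-sweep j m τ′ (subst (m <_) (Fixed.fA f) m<))
        λ m τ′ v (mkSweep f fr sr pr) →
          mkSweep (fixed-exec (24 ≔ lit v) refl f) (fixedR-exec (24 ≔ lit v) refl fr) sr pr)
      where
      start : AllClosed (τ MARK) ⊎ j < τ CNT 0 →
        Progress j 0 (τ MARK) (τ CNT 0)
      start (inj₁ all) = inj₁ all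
      start (inj₂ j<)  = inj₂ (inj₁ ((λ _ ()) , j<))
      finish : ∀ {τ′} → Sweep j (τ CONST 1) τ′ → Searching (suc j) τ′
      finish {τ′} (mkSweep f′ fr sr pr) = mkSearching f′ fr sr (go pr)
        where
        go : Progress j (τ CONST 1) (τ′ MARK) (τ′ CNT 0) → AllClosed (τ′ MARK) ⊎ suc j < τ′ CNT 0
        go (inj₁ all)              = inj₁ all
        go (inj₂ (inj₁ (cls , _))) = inj₁ λ k k<A → cls k (subst (k <_) (sym (Fixed.fA f)) k<A)
        go (inj₂ (inj₂ more))      = inj₂ more

    reached : ∀ τ → Fixed τ → FixedR τ → Reached (exec reach τ)
    reached τ f fr = finish
      (for-inv Searching 23 CONST 3 (for 24 CONST 1 relax) τ₃ refl
        (mkSearching (fixed-exec (23 ≔ lit 0) refl f₃) (fixedR-exec (23 ≔ lit 0) refl fr₃)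
          search₀ (inj₂ ≤-refl))
        (λ j τ′ _ _ → sweep j τ′)
        λ m τ′ v (mkSearching f fr sr pr) →
          mkSearching (fixed-exec (23 ≔ lit v) refl f) (fixedR-exec (23 ≔ lit v) refl fr) sr pr)
      where
      prepare : Cmd
      prepare = set MARK source (lit 1) ▸ CNT ≔ lit 1
      τ₁ τ₃ : Memory
      τ₁ = exec clear τ
      τ₃ = exec prepare τ₁
      f₃ : Fixed τ₃
      f₃ = fixed-exec prepare refl (fixed-exec clear refl f)
      fr₃ : FixedR τ₃
      fr₃ = fixedR-exec prepare refl (fixedR-exec clear refl fr)
      cleared : ∀ v → v < N → τ₁ MARK v ≡ 0
      cleared v v<N = for-inv (λ m τ′ → ∀ v → v < m → τ′ MARK v ≡ 0) 22 CONST 3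
        (set MARK (var 22) (lit 0)) τ refl (λ _ ())
        (λ m τ′ _ eq ih v v<1+m → case v ≟ m of λ where
          (yes v≡m) → if-≡ᵇ-yes (trans v≡m (sym eq))
          (no v≢m)  → trans (if-≡ᵇ-no λ v≡ → v≢m (trans v≡ eq)) (ih v (≤∧≢⇒< (s≤s⁻¹ v<1+m) v≢m)))
        (λ m τ′ x ih → ih) v (subst (v <_) (sym (Fixed.fN f)) v<N)
      s≡ : τ₁ 1 4 ≡ s
      s≡ = Fixed.fs (fixed-exec clear refl f)
      at-s : τ₃ MARK s ≡ 1
      at-s = if-≡ᵇ-yes (sym s≡)
      off-s : ∀ v → v ≢ s → τ₃ MARK v ≡ τ₁ MARK v
      off-s v v≢s = if-≡ᵇ-no λ eq → v≢s (trans eq s≡)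
      search₀ : Search (τ₃ MARK) (τ₃ PAR) 1
      search₀ = mkSearch
        (sym (trans (sym (+-identityʳ _)) (trans (sumTo-change N {λ v → nz (τ₃ MARK v)} {λ v → nz (τ₁ MARK v)} s {0} {1} s<N
          (trans (cong (λ z → nz z + 0) at-s) (cong (λ z → nz z + 1) (sym (cleared s s<N))))
          λ v v≢s → cong nz (off-s v v≢s))
          (cong (_+ 1) (sumTo-zero N λ v v<N → cong nz (cleared v v<N))))))
        at-s
        (λ v v<N → case v ≟ s of λ where
          (yes v≡s) → ≤-reflexive (trans (cong (τ₃ MARK) v≡s) at-s)
          (no v≢s)  → ≤-trans (≤-reflexive (trans (off-s v v≢s) (cleared v v<N))) z≤n)
        λ v v<N mv v≢s → contradiction (trans (off-s v v≢s) (cleared v v<N)) mv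
      finish : ∀ {τ′} → Searching (τ₃ CONST 3) τ′ → Reached τ′
      finish (mkSearching f′ fr′ sr (inj₁ all)) = mkReached f′ fr′ sr all
      finish (mkSearching f′ fr′ sr (inj₂ N<cnt)) =
        contradiction (≤-trans (subst (_< _) (Fixed.fN f₃) N<cnt) (cnt≤N sr)) (<-irrefl refl)

    -- Pushing Δ along the part of the path that leads from the current
    -- node to t changes a cut by Δ times the difference of its values at the two ends.
    record Tracing (mark par : ℕ → ℕ) (m : ℕ) (τ : Memory) : Set where
      constructor mkTracing
      field
        fixed  : Fixed τ
        fΔ     : τ DELTA 0 ≡ Δ
        fmark  : ∀ v → τ MARK v ≡ mark v
        fpar   : ∀ v → τ PAR v ≡ par v
        cur<N  : τ CUR 0 < N
        marked : mark (τ CUR 0) ≢ 0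
        near   : τ CUR 0 ≡ s ⊎ mark (τ CUR 0) + m ≤ N
        room   : ∀ u → u < N → mark u ≢ 0 → u ≢ s → mark u ≤ mark (τ CUR 0) → Δ ≤ τ RES (par u)
        shift  : ∀ X → cut X (τ RES) + Δ * ind (X (τ CUR 0)) ≡ cut X r + Δ * ind (X t)

    push : Cmd
    push = ARC ≔ arr PAR (var CUR) ▸
     set RES (var ARC) (arr RES (var ARC) ⊖ var DELTA) ▸
     set RES (arr REV (var ARC)) (arr RES (arr REV (var ARC)) ⊕ var DELTA) ▸
     CUR ≔ arr SRC (var ARC)

    push-tracing : ∀ {mark par cnt} → Search mark par cnt → ∀ m τ → τ CUR 0 ≢ s →
      Tracing mark par m τ → Tracing mark par (suc m) (exec push τ)
    push-tracing {mark} {par} sr m τ cur≢s (mkTracing f fΔ fm fp cur< mk nr rm sh) =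
      mkTracing (fixed-exec push refl f) fΔ fm fp
        (subst (_< N) (sym src≡) (src<N k k<A))
        (subst (λ z → mark z ≢ 0) (sym src≡) marked)
        (inj₂ (near-step nr))
        room-step
        shift-step
      where
      v k k′ : ℕ
      v  = τ CUR 0
      k  = τ PAR v
      k′ = τ REV k
      open Fixed f
      parent : Branch mark (τ PAR) v
      parent with Search.tree sr v cur< mk cur≢s
      ... | mkBranch a b c d e = mkBranch (subst (_< A) (sym (fp v)) a) (trans (cong dst (fp v)) b)
        (subst (λ z → mark (src z) ≢ 0) (sym (fp v)) c)
        (subst (λ z → mark (src z) < mark v) (sym (fp v)) d)
        (subst (λ z → Δ ≤ r z) (sym (fp v)) e)
      open Branch parent using (marked; closer; dst≡) renaming (arc<A to k<A)
      src≡ : τ SRC k ≡ src k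
      src≡ = fsrc k
      k′≡ : k′ ≡ rev k
      k′≡ = frev k
      k′<A : k′ < A
      k′<A = subst (_< A) (sym k′≡) (rev<A k k<A)
      r₁ r₂ : ℕ → ℕ
      r₁ j = if j ≡ᵇ k then τ RES k ∸ τ DELTA 0 else τ RES j
      r₂ j = if j ≡ᵇ k′ then r₁ k′ + τ DELTA 0 else r₁ j
      Δ≤ : Δ ≤ τ RES k
      Δ≤ = subst (λ z → Δ ≤ τ RES z) (sym (fp v)) (rm v cur< mk cur≢s ≤-refl)
      at-k : r₁ k + Δ ≡ τ RES k
      at-k = trans (cong (_+ Δ) (trans (if-≡ᵇ-yes {k} refl) (cong (τ RES k ∸_) fΔ))) (m∸n+n≡m Δ≤)
      at-k′ : r₂ k′ ≡ r₁ k′ + Δ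
      at-k′ = trans (if-≡ᵇ-yes {k′} refl) (cong (r₁ k′ +_) fΔ)
      r₁≤r₂ : ∀ j → r₁ j ≤ r₂ j
      r₁≤r₂ j with j ≟ k′
      ... | yes refl = ≤-trans (m≤m+n _ Δ) (≤-reflexive (sym at-k′))
      ... | no j≢    = ≤-reflexive (sym (if-≡ᵇ-no j≢))
      near-step : v ≡ s ⊎ mark v + m ≤ N → mark (τ SRC k) + suc m ≤ N
      near-step (inj₁ v≡s) = contradiction v≡s cur≢s
      near-step (inj₂ le)  = ≤-trans (≤-reflexive (+-suc _ m)) (≤-trans
        (+-monoˡ-≤ m (subst (λ z → mark z < mark v) (sym src≡) closer)) le)
      -- The parent arcs still to be used end in nodes other than `v`, so the decrease at `k` spares
      -- them, and the reverse arc only gains capacity.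
      room-step : ∀ u → u < N → mark u ≢ 0 → u ≢ s → mark u ≤ mark (τ SRC k) → Δ ≤ r₂ (par u)
      room-step u u< mu u≢s le = ≤-trans (rm u u< mu u≢s (≤-trans (n≤1+n _) lt))
        (≤-trans (≤-reflexive (sym (if-≡ᵇ-no par≢))) (r₁≤r₂ (par u)))
        where
        lt : mark u < mark v
        lt = ≤-<-trans (subst (λ z → mark u ≤ mark z) src≡ le) closer
        par≢ : par u ≢ k
        par≢ eq = <-irrefl (cong mark (trans (sym (Branch.dst≡ (Search.tree sr u u< mu u≢s)))
          (trans (cong dst eq) dst≡))) lt
      shift-step : ∀ X → cut X r₂ + Δ * ind (X (τ SRC k)) ≡ cut X r + Δ * ind (X t)
      -- The push changes the cut by Δ times `bwd` minus `fwd`; adding `Δ * fwd` to both sides keeps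
      -- the computation free of subtraction.
      shift-step X = trans (+-cancelʳ-≡ (Δ * fwd) _ _ both) (sh X)
        where
        fwd bwd : ℕ
        fwd = crossing X (src k) (dst k)
        bwd = crossing X (src k′) (dst k′)
        bwd≡ : bwd ≡ crossing X v (src k)
        bwd≡ = cong₂ (crossing X) (trans (cong src k′≡) (trans (src-rev k k<A) dst≡))
          (trans (cong dst k′≡) (dst-rev k k<A))
        first : cut X r₁ + Δ * fwd ≡ cut X (τ RES)
        first = trans (sumTo-change A k k<A
          (trans (sym (*-distribʳ-+ fwd (r₁ k) Δ)) (trans (cong (_* fwd) at-k) (sym (+-identityʳ _))))
          λ j j≢k → cong (_* _) (if-≡ᵇ-no j≢k)) (+-identityʳ _)
        second : cut X r₂ ≡ cut X r₁ + Δ * bwd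
        second = trans (sym (+-identityʳ _)) (sumTo-change A k′ k′<A
          (trans (+-identityʳ _) (trans (cong (_* bwd) at-k′) (*-distribʳ-+ bwd (r₁ k′) Δ)))
          λ j j≢k → cong (_* _) (if-≡ᵇ-no j≢k))
        a = ind (X (src k))
        swap : bwd + a ≡ fwd + ind (X v)
        swap = trans (cong (_+ a) bwd≡) (trans (sym (crossing-swap X (src k) v))
          (cong (λ z → crossing X (src k) z + ind (X v)) (sym dst≡)))
        both : cut X r₂ + Δ * ind (X (τ SRC k)) + Δ * fwd ≡ cut X (τ RES) + Δ * ind (X v) + Δ * fwd
        both = begin
          cut X r₂ + Δ * ind (X (τ SRC k)) + Δ * fwd
            ≡⟨ cong₂ (λ x y → x + Δ * ind (X y) + Δ * fwd) second src≡ ⟩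
          cut X r₁ + Δ * bwd + Δ * a + Δ * fwd
            ≡⟨ lemma (cut X r₁) Δ bwd a fwd ⟩
          cut X r₁ + Δ * fwd + Δ * (bwd + a)
            ≡⟨ cong₂ (λ x y → x + Δ * y) first swap ⟩
          cut X (τ RES) + Δ * (fwd + ind (X v))
            ≡⟨ lemma′ (cut X (τ RES)) Δ fwd (ind (X v)) ⟩
          cut X (τ RES) + Δ * ind (X v) + Δ * fwd ∎
          where
          open ≡-Reasoning
          lemma : ∀ c d x y z → c + d * x + d * y + d * z ≡ c + d * z + d * (x + y)
          lemma = solve-∀
          lemma′ : ∀ c d x y → c + d * (x + y) ≡ c + d * y + d * x
          lemma′ = solve-∀

    back-tracing : ∀ {mark par cnt} → Search mark par cnt → ∀ m τ →
      Tracing mark par m τ → Tracing mark par (suc m) (exec back τ)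
    back-tracing {mark} {par} sr m τ tr@(mkTracing f fΔ fm fp cur< mk nr rm sh) =
      branch-case (Tracing mark par (suc m)) ((τ CUR 0 ∸ τ 1 4) + (τ 1 4 ∸ τ CUR 0))
        (λ ≢0 → push-tracing sr m τ (λ eq → ≢0 (distance-refl (trans eq (sym (Fixed.fs f))))) tr)
        (λ ≡0 → mkTracing f fΔ fm fp cur< mk (inj₁ (trans (distance-0 ≡0) (Fixed.fs f))) rm sh)

    trace-shift : ∀ τ → Reached τ → τ MARK t ≢ 0 →
      Fixed (exec trace τ) × (∀ X → Sep X → cut X (exec trace τ RES) + Δ ≡ cut X r)
    trace-shift τ (mkReached f fr sr cl) mt = finish
      (for-inv (Tracing (τ MARK) (τ PAR)) 23 CONST 3 back τ₁ refl
        (mkTracing (fixed-exec (CUR ≔ target ▸ 23 ≔ lit 0) refl f) (FixedR.fΔ fr) (λ _ → refl) (λ _ → refl)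
          (subst (_< N) (sym t≡) t<N) (subst (λ z → τ MARK z ≢ 0) (sym t≡) mt)
          (inj₂ (≤-trans (≤-reflexive (+-identityʳ _)) (≤-trans (Search.bound sr _ (subst (_< N) (sym t≡) t<N)) (cnt≤N sr))))
          (λ u u<N mu u≢s _ → subst (Δ ≤_) (sym (FixedR.fres fr _)) (Branch.room (Search.tree sr u u<N mu u≢s)))
          λ X → cong₂ (λ x y → x + Δ * ind (X y)) (sumTo-cong A λ k _ → cong (_* crossing X (src k) (dst k)) (FixedR.fres fr k)) t≡)
        (λ m τ′ _ _ → back-tracing sr m τ′)
        λ m τ′ v (mkTracing f a b c d e g h i) → mkTracing (fixed-exec (23 ≔ lit v) refl f) a b c d e g h i)
      where
      t≡ : τ 1 5 ≡ t
      t≡ = Fixed.ft f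
      τ₁ : Memory
      τ₁ = update τ CUR 0 (τ 1 5)
      finish : ∀ {τ′} → Tracing (τ MARK) (τ PAR) (τ CONST 3) τ′ →
        Fixed τ′ × (∀ X → Sep X → cut X (τ′ RES) + Δ ≡ cut X r)
      finish {τ′} (mkTracing f′ _ _ _ _ mk nr _ sh) = f′ , λ X (Xs , Xt) →
        trans (cong (cut X (τ′ RES) +_) (trans (sym (*-identityʳ Δ))
            (cong (λ b → Δ * ind b) (sym (trans (cong X (at-s nr)) Xs)))))
          (trans (sh X) (trans (cong (λ b → cut X r + Δ * ind b) Xt)
            (trans (cong (cut X r +_) (*-zeroʳ Δ)) (+-identityʳ _))))
        where
        -- After `N` rounds the second alternative would require the mark of the current node to be
        -- 0, but the walk visits only marked nodes.
        at-s : τ′ CUR 0 ≡ s ⊎ τ MARK (τ′ CUR 0) + τ CONST 3 ≤ N → τ′ CUR 0 ≡ s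
        at-s (inj₁ eq) = eq
        at-s (inj₂ le) = contradiction
          (≤-trans (≤-trans (+-mono-≤ (n≢0⇒n>0 mk) ≤-refl) (subst (λ z → τ MARK (τ′ CUR 0) + z ≤ N) (Fixed.fN f) le)) ≤-refl)
          (<-irrefl refl)

  open Residual using (mkFixedR; Reached; mkReached; Search; AllClosed; reached; trace-shift; FixedR)

  record Stop (Δ : ℕ) (mark r : ℕ → ℕ) : Set where
    constructor mkStop
    field
      s-marked   : mark s ≢ 0
      t-unmarked : mark t ≡ 0
      closed     : AllClosed r Δ mark

  -- `F` is the value of the flow pushed so far, recorded only through the amount by which it has
  -- lowered each separating cut.
  Flow : (ℕ → ℕ) → (ℕ → ℕ) → Set
  Flow c r = Σ ℕ λ F → ∀ X → Sep X → cut X r + F ≡ cut X c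

  -- The cut `X` is a witness kept fixed during a phase. It starts at no more than `A` times 2 Δ,
  -- the bound left by the preceding phase, and every push takes Δ from it. Hence 2 A + 1 rounds
  -- cannot all push, which is where the number of rounds per phase comes from.
  record Rounds (c : ℕ → ℕ) (Δ m : ℕ) (τ : Memory) : Set where
    constructor mkRounds
    field
      fixed    : Fixed τ
      fΔ       : τ DELTA 0 ≡ Δ
      flow     : Flow c (τ RES)
      progress : Stop Δ (τ MARK) (τ RES) ⊎
        (τ MARK t ≢ 0 × Σ (ℕ → Bool) λ X → Sep X × cut X (τ RES) + m * Δ ≤ (A + A) * Δ)

  cut-cong : ∀ X {r r′} → (∀ k → r k ≡ r′ k) → cut X r ≡ cut X r′
  cut-cong X eq = sumTo-cong A λ k _ → cong (_* crossing X (src k) (dst k)) (eq k)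

  Low : ℕ → ℕ → (ℕ → ℕ) → Set
  Low Δ m r = Σ (ℕ → Bool) λ X → Sep X × cut X r + m * Δ ≤ (A + A) * Δ

  augment-rounds : ∀ c Δ m r τ → Reached r Δ τ → Flow c r → Low Δ m r →
    Rounds c Δ (suc m) (exec augment τ)
  augment-rounds c Δ m r τ rd@(mkReached f (mkFixedR fres fΔ) sr cl) (F , fl) (X , sep , le) =
    branch-case (Rounds c Δ (suc m)) (τ MARK (τ 1 5)) {exec trace τ} {τ}
      (λ mt → traced (subst (λ z → τ MARK z ≢ 0) (Fixed.ft f) mt))
      (λ mt → mkRounds f fΔ (F , λ Y sy → trans (cong (_+ F) (cut-cong Y fres)) (fl Y sy))
        (inj₁ (mkStop (subst (_≢ 0) (sym (Search.root sr)) λ ())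
          (subst (λ z → τ MARK z ≡ 0) (Fixed.ft f) mt)
          λ k k<A ms Δ≤ → cl k k<A ms (subst (Δ ≤_) (fres k) Δ≤))))
    where
    traced : τ MARK t ≢ 0 → Rounds c Δ (suc m) (exec trace τ)
    traced mt = mkRounds (proj₁ (trace-shift r Δ τ rd mt)) (trans (frame trace DELTA refl τ 0) fΔ)
      (Δ + F , λ Y sy → trans (sym (+-assoc (cut Y (exec trace τ RES)) Δ F)) (trans (cong (_+ F) (sh Y sy)) (fl Y sy)))
      (inj₂ (subst (_≢ 0) (sym (frame trace MARK refl τ t)) mt , X , sep ,
        ≤-trans (≤-reflexive (trans (sym (+-assoc (cut X (exec trace τ RES)) Δ (m * Δ))) (cong (_+ m * Δ) (sh X sep)))) le))
      where
      sh : ∀ Y → Sep Y → cut Y (exec trace τ RES) + Δ ≡ cut Y r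
      sh = proj₂ (trace-shift r Δ τ rd mt)

  round-rounds : ∀ c Δ m τ → Rounds c Δ m τ → Rounds c Δ (suc m) (exec round τ)
  round-rounds c Δ m τ (mkRounds f fΔ fl pr) =
    branch-case (Rounds c Δ (suc m)) (τ MARK (τ 1 5)) {exec (reach ▸ augment) τ} {τ}
      (λ mt → continue (subst (λ z → τ MARK z ≢ 0) (Fixed.ft f) mt) pr)
      (λ mt → mkRounds f fΔ fl (inj₁ (stopped (subst (λ z → τ MARK z ≡ 0) (Fixed.ft f) mt) pr)))
    where
    stopped : τ MARK t ≡ 0 → Stop Δ (τ MARK) (τ RES) ⊎ (τ MARK t ≢ 0 × Low Δ m (τ RES)) →
      Stop Δ (τ MARK) (τ RES)
    stopped mt (inj₁ st)       = st
    stopped mt (inj₂ (mt≢ , _)) = contradiction mt mt≢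
    continue : τ MARK t ≢ 0 → Stop Δ (τ MARK) (τ RES) ⊎ (τ MARK t ≢ 0 × Low Δ m (τ RES)) →
      Rounds c Δ (suc m) (exec augment (exec reach τ))
    continue mt (inj₁ st) = contradiction (Stop.t-unmarked st) mt
    continue mt (inj₂ (_ , low)) = augment-rounds c Δ m (τ RES) (exec reach τ)
      (reached (τ RES) Δ τ f (mkFixedR (λ _ → refl) fΔ)) fl low

  -- An arc that leaves the marked set is closed although its end is unmarked, so its residual
  -- capacity is below Δ. The sharp bound `pred Δ` matters for Δ = 1, where it makes the residual
  -- cut 0.
  Stop-cut : ∀ {Δ mark r} → Stop Δ mark r →
    Sep (positive ∘ mark) × (∀ k → k < A → r k * crossing (positive ∘ mark) (src k) (dst k) ≤ pred Δ)
  Stop-cut {Δ} {mark} {r} (mkStop ms mt cl) = (positive-≢0 ms , cong positive mt) , bounded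
    where
    bounded : ∀ k → k < A → r k * crossing (positive ∘ mark) (src k) (dst k) ≤ pred Δ
    bounded k k<A with mark (src k) in eqs | mark (dst k) in eqd
    ... | zero  | _     = ≤-trans (≤-reflexive (*-zeroʳ (r k))) z≤n
    ... | suc _ | suc _ = ≤-trans (≤-reflexive (*-zeroʳ (r k))) z≤n
    ... | suc _ | zero with r k <? Δ
    ... | yes r< = ≤-trans (≤-reflexive (*-identityʳ (r k))) (<⇒≤pred r<)
    ... | no r≮  = contradiction eqd (cl k k<A (subst (_≢ 0) (sym eqs) λ ()) (≮⇒≥ r≮))

  record Phases (c : ℕ → ℕ) (m : ℕ) (τ : Memory) : Set where
    constructor mkPhases
    field
      fixed : Fixed τ
      flow  : Flow c (τ RES)
      low   : Σ (ℕ → Bool) λ X → Sep X × cut X (τ RES) ≤ A * 2 ^ (suc K ∸ m)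
      stop  : m ≡ 0 ⊎ Stop (2 ^ (suc K ∸ m)) (τ MARK) (τ RES)

  phase-phases : ∀ c m τ → m < suc K → τ 26 0 ≡ m → Phases c m τ → Phases c (suc m) (exec phase τ)
  phase-phases c m τ m≤K refl (mkPhases f fl (X , sep , le) _) = finish
    (for-inv (Rounds c Δ) 25 CONST 2 round τ₁ refl
      (mkRounds (fixed-exec (25 ≔ lit 0) refl f₁) Δ≡ fl
        (inj₂ (subst (_≢ 0) (sym mark-t) (λ ()) , X , sep ,
          ≤-trans (≤-reflexive (+-identityʳ _)) (≤-trans le (≤-reflexive double)))))
      (λ i τ′ _ _ → round-rounds c Δ i τ′)
      λ i τ′ v (mkRounds f a b c) → mkRounds (fixed-exec (25 ≔ lit v) refl f) a b c)
    where
    κ Δ : ℕ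
    κ = K ∸ m
    Δ = 2 ^ κ
    init : Cmd
    init = DELTA ≔ arr PW (arr CONST (lit 0) ⊖ (var 26 ⊕ lit 1)) ▸ set MARK target (lit 1)
    τ₁ : Memory
    τ₁ = exec init τ
    f₁ : Fixed τ₁
    f₁ = fixed-exec init refl f
    index≡ : τ CONST 0 ∸ (m + 1) ≡ κ
    index≡ = cong₂ _∸_ (Fixed.fK f) (+-comm m 1)
    Δ≡ : τ₁ DELTA 0 ≡ Δ
    Δ≡ = trans (cong (τ PW) index≡) (Fixed.fpw f κ (m∸n≤m K m))
    mark-t : τ₁ MARK t ≡ 1
    mark-t = if-≡ᵇ-yes (sym (Fixed.ft f))
    double : A * 2 ^ (suc K ∸ m) ≡ (A + A) * Δ
    double = trans (cong (λ z → A * 2 ^ z) (+-∸-assoc 1 (s≤s⁻¹ m≤K))) (lemma A Δ)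
      where
      lemma : ∀ a d → a * (d + (d + 0)) ≡ (a + a) * d
      lemma = solve-∀
    finish : ∀ {τ′} → Rounds c Δ (τ₁ CONST 2) τ′ → Phases c (suc m) τ′
    finish {τ′} (mkRounds f′ _ fl′ (inj₁ st)) = mkPhases f′ fl′
      (positive ∘ τ′ MARK , proj₁ (Stop-cut st) , ≤-trans (sumTo-mono A (proj₂ (Stop-cut st)))
        (≤-trans (≤-reflexive (sumTo-const A (pred Δ))) (*-monoʳ-≤ A pred[n]≤n)))
      (inj₂ st)
    finish {τ′} (mkRounds f′ _ fl′ (inj₂ (_ , Y , _ , le′))) = contradiction
      (≤-trans (m≤n+m (suc (A + A) * Δ) (cut Y (τ′ RES))) (subst (λ z → cut Y (τ′ RES) + z * Δ ≤ (A + A) * Δ) (Fixed.fR f) le′))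
      (<⇒≱ (+-mono-≤ {1} {Δ} (m^n>0 2 κ) ≤-refl))

  -- Weak duality: the last phase has Δ = 1 and leaves a cut of residual capacity 0, whose original
  -- capacity is therefore exactly `F`, while the original capacity of any separating cut is `F`
  -- plus something nonnegative.
  scaling-correct : ∀ τ → Fixed τ → (Σ (ℕ → Bool) λ X → Sep X × cut X (τ RES) ≤ A * 2 ^ suc K) →
    Sep (positive ∘ exec scaling τ MARK) ×
    (∀ Y → Sep Y → cut (positive ∘ exec scaling τ MARK) (τ RES) ≤ cut Y (τ RES))
  scaling-correct τ f low = finish (subst (λ z → Phases (τ RES) z (exec scaling τ)) (Fixed.fK f)
    (for-inv (Phases (τ RES)) 26 CONST 0 phase τ refl
      (mkPhases (fixed-exec (26 ≔ lit 0) refl f) (0 , λ X _ → +-identityʳ _) low (inj₁ refl))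
      (λ m τ′ m< → phase-phases (τ RES) m τ′ (subst (m <_) (Fixed.fK f) m<))
      λ m τ′ v (mkPhases f a b c) → mkPhases (fixed-exec (26 ≔ lit v) refl f) a b c))
    where
    finish : ∀ {τ′} → Phases (τ RES) (suc K) τ′ → Sep (positive ∘ τ′ MARK) ×
      (∀ Y → Sep Y → cut (positive ∘ τ′ MARK) (τ RES) ≤ cut Y (τ RES))
    finish {τ′} (mkPhases _ (F , fl) _ (inj₂ st)) = sep , λ Y sy → begin
      cut X* (τ RES)        ≡⟨ fl X* sep ⟨
      cut X* (τ′ RES) + F   ≡⟨ cong (_+ F) (sumTo-zero A λ k k<A → n≤0⇒n≡0 (≤-trans (bounded k k<A)
                                  (≤-reflexive (cong (λ z → pred (2 ^ z)) (n∸n≡0 K))))) ⟩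
      F                     ≤⟨ m≤n+m F _ ⟩
      cut Y (τ′ RES) + F    ≡⟨ fl Y sy ⟩
      cut Y (τ RES)         ∎
      where
      open ≤-Reasoning
      X* = positive ∘ τ′ MARK
      sep = proj₁ (Stop-cut st)
      bounded = proj₂ (Stop-cut st)

-- Construction of the graph

-- Loop counters: 43 runs over the links, 44 over the grouped sets, 46 over the
-- possible partners of link 43.  PT and PS are the partner of link 43, which is
-- the link itself if there is none, and one plus the number of the grouped set
-- of both; WT, VT, JT and CP are the scaled costs of the two links, their scaled
-- joint cost, and what they save when they are cut together.
PT PS CT WT VT JT CP EU EV EC NA TT : ℕ
PT = 30
PS = 31
CT = 32
WT = 33
VT = 34
JT = 35
CP = 36
EU = 37
EV = 38
EC = 39
NA = 40
TT = 41

infix 6 _⊝_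
_⊝_ : Expr → Expr → Expr
e ⊝ f = (e ⊖ f) ⊕ (f ⊖ e)

apart : ℕ → ℕ → ℕ
apart m n = (m ∸ n) + (n ∸ m)

nodesE linksE member₁ member₂ unpaired : Expr
nodesE  = arr 1 (lit 0)
linksE  = arr 1 (lit 1)
member₁ = arr 8 (var 44 ⊗ linksE ⊕ var 43)
member₂ = arr 8 (var 44 ⊗ linksE ⊕ var 46)
-- Vanishes when set number 44 consists of links 43 and 46, these have the
-- same tail, and neither is a loop.
unpaired =
  (var CT ⊝ lit 2) ⊕ (lit 1 ⊖ (var 43 ⊝ var 46)) ⊕ (lit 1 ⊖ member₁) ⊕ (lit 1 ⊖ member₂) ⊕
  (arr 3 (var 43) ⊝ arr 3 (var 46)) ⊕ (lit 1 ⊖ (arr 4 (var 43) ⊝ arr 3 (var 43))) ⊕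
  (lit 1 ⊖ (arr 4 (var 46) ⊝ arr 3 (var 46)))

count try findPartner weigh pushEdge link finishBuild build : Cmd
count = CT ≔ lit 0 ▸ for 45 1 1 (CT ≔ var CT ⊕ arr 8 (var 44 ⊗ linksE ⊕ var 45))
try = cond unpaired nop (PT ≔ var 46 ▸ PS ≔ var 44 ⊕ lit 1)
findPartner = PT ≔ var 43 ▸ PS ≔ lit 0 ▸ for 44 1 3 (count ▸ for 46 1 1 try)

scaleStep : ℕ → Expr → Cmd
scaleStep x i =
  cond (var 45 ⊝ i) (x ≔ var x ⊗ arr 6 (var 45)) (x ≔ var x ⊗ arr 5 (var 45))

scale : ℕ → Expr → Cmd
scale x i = x ≔ lit 1 ▸ for 45 1 1 (scaleStep x i)

scaleρ : Cmd
scaleρ =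
  WT ≔ var WT ⊗ arr 10 (var 45) ▸
  VT ≔ var VT ⊗ arr 10 (var 45) ▸
  -- `PS` is 0 for a link without a partner and then matches no set: the joint cost is scaled like
  -- the two single costs, and the saving comes out as 0.
  cond ((var 45 ⊕ lit 1) ⊝ var PS) (JT ≔ var JT ⊗ arr 10 (var 45)) (JT ≔ var JT ⊗ arr 9 (var 45))

weigh =
  scale WT (var 43) ▸ scale VT (var PT) ▸ JT ≔ var WT ⊕ var VT ▸
  for 45 1 3 scaleρ ▸ CP ≔ (var WT ⊕ var VT) ⊖ var JT

pushEdge =
  set SRC (var NA) (var EU) ▸ set DST (var NA) (var EV) ▸
  set RES (var NA) (var EC) ▸ set REV (var NA) (lit 1 ⊕ var NA) ▸
  set SRC (lit 1 ⊕ var NA) (var EV) ▸ set DST (lit 1 ⊕ var NA) (var EU) ▸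
  set RES (lit 1 ⊕ var NA) (lit 0) ▸ set REV (lit 1 ⊕ var NA) (var NA) ▸
  -- The total capacity bounds every cut and thereby determines with which power of two the scaling
  -- may start.
  NA ≔ lit 2 ⊕ var NA ▸ TT ≔ var TT ⊕ var EC

append : Expr → Expr → Expr → Cmd
append u v c = (EU ≔ u ▸ EV ≔ v ▸ EC ≔ c) ▸ pushEdge

edges : Cmd
edges =
  append (arr 3 (var 43)) (arr 4 (var 43)) ((var WT ⊖ var CP) ⊕ (var WT ⊖ var CP)) ▸
  append (arr 3 (var 43)) (nodesE ⊕ var 43) (var CP) ▸
  append (nodesE ⊕ var 43) (arr 4 (var 43)) (var CP) ▸
  append (nodesE ⊕ var 43) (arr 4 (var PT)) (var CP)

link = findPartner ▸ weigh ▸ edges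

finishBuild =
  set CONST (lit 3) (nodesE ⊕ linksE) ▸ set CONST (lit 1) (var NA) ▸
  -- Cell 0 of `CONST` counts the entries of the table `PW` of powers of two, which at this point
  -- contains only the power with exponent 0.
  set CONST (lit 2) (lit 1 ⊕ (var NA ⊕ var NA)) ▸ set CONST (lit 0) (lit 1) ▸
  set PW (lit 0) (lit 1)

build = for 43 1 1 link ▸ finishBuild

inputArray : ℕ → Bool
inputArray a = (0 <ᵇ a) ∧ (a <ᵇ 11)

inputBound : ℕ → ℕ → Bool
inputBound a i = (a ≡ᵇ 1) ∧ ((i ≡ᵇ 1) ∨ (i ≡ᵇ 3))

prodTo : ℕ → (ℕ → ℕ) → ℕ
prodTo zero    f = 1
prodTo (suc n) f = prodTo n f * f n

branch-≢0 : ∀ {A : Set} {n} {x y : A} → n ≢ 0 → branch n x y ≡ x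
branch-≢0 {n = zero}  n≢0 = contradiction refl n≢0
branch-≢0 {n = suc n} _   = refl

branch-≡0 : ∀ {A : Set} {n} {x y : A} → n ≡ 0 → branch n x y ≡ y
branch-≡0 refl = refl

-- Edge lists and the correctness of the construction

Edge : Set
Edge = ℕ × ℕ × ℕ

totalE : List Edge → ℕ
totalE []               = 0
totalE ((_ , _ , c) ∷ es) = totalE es + c

-- Edge number i from the end of the list becomes the arcs 2i and 2i + 1.
Arcs : (src dst res rev : ℕ → ℕ) → ℕ → List Edge → Set
Arcs src dst res rev n []               = n ≡ 0
Arcs src dst res rev n ((u , v , c) ∷ es) = Σ ℕ λ m → n ≡ suc (suc m) ×
  (src m ≡ u × dst m ≡ v × res m ≡ c × rev m ≡ suc m) ×
  (src (suc m) ≡ v × dst (suc m) ≡ u × res (suc m) ≡ 0 × rev (suc m) ≡ m) ×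
  Arcs src dst res rev m es

Arcs-ext : ∀ {src dst res rev src′ dst′ res′ rev′} n es →
  (∀ i → i < n → src′ i ≡ src i) → (∀ i → i < n → dst′ i ≡ dst i) →
  (∀ i → i < n → res′ i ≡ res i) → (∀ i → i < n → rev′ i ≡ rev i) →
  Arcs src dst res rev n es → Arcs src′ dst′ res′ rev′ n es
Arcs-ext n [] _ _ _ _ n≡0 = n≡0
Arcs-ext n (_ ∷ es) s d r v (m , refl , (a , b , c , e) , (f , g , h , i) , rest) =
  m , refl ,
  (trans (s m m<) a , trans (d m m<) b , trans (r m m<) c , trans (v m m<) e) ,
  (trans (s (suc m) ≤-refl) f , trans (d (suc m) ≤-refl) g , trans (r (suc m) ≤-refl) h ,
    trans (v (suc m) ≤-refl) i) ,
  Arcs-ext m es (λ i i< → s i (up i<)) (λ i i< → d i (up i<)) (λ i i< → r i (up i<))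
    (λ i i< → v i (up i<)) rest
  where
  m< : m < suc (suc m)
  m< = n≤1+n (suc m)
  up : ∀ {i} → i < m → i < suc (suc m)
  up i< = ≤-trans i< (≤-trans (n≤1+n m) (n≤1+n (suc m)))

module Build (σ₀ : Memory) where

  open Admissible inputArray inputBound

  nodes L GS : ℕ
  nodes = σ₀ 1 0
  L     = σ₀ 1 1
  GS    = σ₀ 1 3
  tl hd num den rnum rden : ℕ → ℕ
  tl   = σ₀ 3
  hd   = σ₀ 4
  num  = σ₀ 5
  den  = σ₀ 6
  rnum = σ₀ 9
  rden = σ₀ 10

  member : ℕ → ℕ → ℕ
  member j l = σ₀ 8 (j * L + l)

  card : ℕ → ℕ
  card j = sumTo L (member j)

  HasInput : Memory → Set
  HasInput τ = ∀ a → T (inputArray a) → ∀ i → τ a i ≡ σ₀ a i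

  input-exec : ∀ p {τ} → ok p → HasInput τ → HasInput (exec p τ)
  input-exec p {τ} o inp a ra i = trans (frame p a (ok-writes p o ra) τ i) (inp a ra i)

  unpairedValue : (ct e f me mf te tf he hf : ℕ) → ℕ
  unpairedValue ct e f me mf te tf he hf =
    apart ct 2 + (1 ∸ apart e f) + (1 ∸ me) + (1 ∸ mf) + apart te tf + (1 ∸ apart he te) + (1 ∸ apart hf tf)

  unpaired-cong : ∀ {a a′ b b′ c c′ d d′ e e′ f f′ g g′ h h′ i i′} →
    a ≡ a′ → b ≡ b′ → c ≡ c′ → d ≡ d′ → e ≡ e′ → f ≡ f′ → g ≡ g′ → h ≡ h′ → i ≡ i′ →
    unpairedValue a b c d e f g h i ≡ unpairedValue a′ b′ c′ d′ e′ f′ g′ h′ i′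
  unpaired-cong refl refl refl refl refl refl refl refl refl = refl

  Unpaired : ℕ → ℕ → ℕ → ℕ
  Unpaired j e f = unpairedValue (card j) e f (member j e) (member j f) (tl e) (tl f) (hd e) (hd f)

  Sound : ℕ → ℕ → ℕ → Set
  Sound e pt ps = (ps ≡ 0 × pt ≡ e) ⊎
    Σ ℕ λ j → ps ≡ suc j × j < GS × pt < L × Unpaired j e pt ≡ 0

  count-correct : ∀ j τ → HasInput τ → τ 44 0 ≡ j → exec count τ CT 0 ≡ card j
  count-correct j τ inp refl = subst (λ n → exec count τ CT 0 ≡ sumTo n (member j)) (inp 1 tt 1)
    (proj₂ (proj₂ (for-inv (λ m τ′ → HasInput τ′ × τ′ 44 0 ≡ j × τ′ CT 0 ≡ sumTo m (member j))
      45 1 1 body (exec (CT ≔ lit 0) τ) refl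
      (input-exec (CT ≔ lit 0 ▸ 45 ≔ lit 0) _ inp , refl , refl)
      (λ m τ′ _ m≡ (inp′ , j≡ , eq) → input-exec body _ inp′ , j≡ ,
        cong₂ _+_ eq (trans (cong (τ′ 8) (cong₂ _+_ (cong₂ _*_ j≡ (inp′ 1 tt 1)) m≡)) (inp′ 8 tt _)))
      λ m τ′ v (inp′ , j≡ , eq) → input-exec (45 ≔ lit v) _ inp′ , j≡ , eq)))
    where
    body : Cmd
    body = CT ≔ var CT ⊕ arr 8 (var 44 ⊗ linksE ⊕ var 45)

  -- It only says that some partner was found if one exists. That it is the right one follows from
  -- `Sound` and the uniqueness of partners.
  Complete : ℕ → ℕ → ℕ → Set
  Complete e j ps = ∀ j′ f → j′ < j → f < L → Unpaired j′ e f ≡ 0 → ps ≢ 0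

  record Finding (e j : ℕ) (τ : Memory) : Set where
    constructor mkFinding
    field
      input    : HasInput τ
      e≡       : τ 43 0 ≡ e
      sound    : Sound e (τ PT 0) (τ PS 0)
      complete : Complete e j (τ PS 0)

  record Trying (e j m : ℕ) (τ : Memory) : Set where
    constructor mkTrying
    field
      input    : HasInput τ
      e≡       : τ 43 0 ≡ e
      j≡       : τ 44 0 ≡ j
      ct≡      : τ CT 0 ≡ card j
      sound    : Sound e (τ PT 0) (τ PS 0)
      complete : Complete e j (τ PS 0)
      tried    : ∀ f → f < m → Unpaired j e f ≡ 0 → τ PS 0 ≢ 0

  try-step : ∀ e j m τ → j < GS → m < L → τ 46 0 ≡ m → Trying e j m τ → Trying e j (suc m) (exec try τ)
  try-step e j m τ j< m< refl (mkTrying inp refl refl ct so co tr) =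
    branch-case (Trying e j (suc m)) (⟦ unpaired ⟧ τ) {τ} {exec (PT ≔ var 46 ▸ PS ≔ var 44 ⊕ lit 1) τ}
      (λ ≢0 → mkTrying inp refl refl ct so co λ f f< un → case f ≟ m of λ where
        (yes f≡m) → contradiction (trans value (trans (cong (Unpaired j e) (sym f≡m)) un)) ≢0
        (no f≢m)  → tr f (≤∧≢⇒< (s≤s⁻¹ f<) f≢m) un)
      (λ ≡0 → mkTrying (input-exec (PT ≔ var 46 ▸ PS ≔ var 44 ⊕ lit 1) _ inp) refl refl ct
        (inj₂ (j , +-comm j 1 , j< , m< , trans (sym value) ≡0))
        (λ _ _ _ _ _ → m+1+n≢0 j) (λ _ _ _ → m+1+n≢0 j))
    where
    index : ∀ l → τ 8 (j * τ 1 1 + l) ≡ member j l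
    index l = trans (cong (λ z → τ 8 (j * z + l)) (inp 1 tt 1)) (inp 8 tt _)
    value : ⟦ unpaired ⟧ τ ≡ Unpaired j e m
    value = unpaired-cong {b = e} {e} {m} {m} ct refl refl (index e) (index m) (inp 3 tt e) (inp 3 tt m) (inp 4 tt e) (inp 4 tt m)

  findPartner-step : ∀ e j τ → j < GS → τ 44 0 ≡ j → Finding e j τ →
    Finding e (suc j) (exec (for 46 1 1 try) (exec count τ))
  findPartner-step e j τ j< j≡ (mkFinding inp e≡ so co) = finish
    (for-inv (Trying e j) 46 1 1 try τ₁ refl
      (mkTrying (input-exec (46 ≔ lit 0) _ inp₁) (trans (frame count 43 refl τ 0) e≡)
        (trans (frame count 44 refl τ 0) j≡) (count-correct j τ inp j≡)
        (subst₂ (Sound e) (sym (frame count PT refl τ 0)) (sym (frame count PS refl τ 0)) so)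
        (subst (Complete e j) (sym (frame count PS refl τ 0)) co)
        (λ _ ()))
      (λ m τ′ m< → try-step e j m τ′ j< (subst (m <_) (inp₁ 1 tt 1) m<))
      λ m τ′ v (mkTrying a b c d e f g) → mkTrying (input-exec (46 ≔ lit v) _ a) b c d e f g)
    where
    τ₁ : Memory
    τ₁ = exec count τ
    inp₁ : HasInput τ₁
    inp₁ = input-exec count _ inp
    finish : ∀ {τ′} → Trying e j (τ₁ 1 1) τ′ → Finding e (suc j) τ′
    finish (mkTrying inp′ e≡′ _ _ so′ co′ tr) = mkFinding inp′ e≡′ so′ λ j′ f j′< f< un →
      case j′ ≟ j of λ where
        (yes refl) → tr f (subst (f <_) (sym (inp₁ 1 tt 1)) f<) un
        (no j′≢j)  → co′ j′ f (≤∧≢⇒< (s≤s⁻¹ j′<) j′≢j) f< un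

  findPartner-correct : ∀ e τ → HasInput τ → τ 43 0 ≡ e → Finding e GS (exec findPartner τ)
  findPartner-correct e τ inp refl = subst (λ n → Finding e n (exec findPartner τ)) (inp 1 tt 3)
    (for-inv (Finding e) 44 1 3 (count ▸ for 46 1 1 try) (exec (PT ≔ var 43 ▸ PS ≔ lit 0) τ) refl
      (mkFinding (input-exec (PT ≔ var 43 ▸ PS ≔ lit 0 ▸ 44 ≔ lit 0) _ inp) refl (inj₁ (refl , refl)) (λ _ _ ()))
      (λ j τ′ j< → findPartner-step e j τ′ (subst (j <_) (inp 1 tt 3) j<))
      λ j τ′ v (mkFinding a b c d) → mkFinding (input-exec (44 ≔ lit v) _ a) b c d)

  selected : ℕ → ℕ → ℕ
  selected e l = branch (apart l e) (den l) (num l)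

  selectedρ : ℕ → ℕ → ℕ
  selectedρ ps j = branch (apart (j + 1) ps) (rden j) (rnum j)

  record Scaling₁ (x y e v : ℕ) (τ : Memory) : Set where
    constructor mkScaling₁
    field
      input : HasInput τ
      y≡    : τ y 0 ≡ e
      x≡    : τ x 0 ≡ v

  scale-W : ∀ e τ → HasInput τ → τ 43 0 ≡ e → exec (scale WT (var 43)) τ WT 0 ≡ prodTo L (selected e)
  scale-W e τ inp e≡ = subst (λ n → exec (scale WT (var 43)) τ WT 0 ≡ prodTo n (selected e)) (inp 1 tt 1)
    (Scaling₁.x≡ (for-inv (λ m → Scaling₁ WT 43 e (prodTo m (selected e))) 45 1 1 (scaleStep WT (var 43))
      (exec (WT ≔ lit 1) τ) refl
      (mkScaling₁ (input-exec (WT ≔ lit 1 ▸ 45 ≔ lit 0) _ inp) e≡ refl)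
      (λ { m τ′ _ refl (mkScaling₁ inp′ refl x≡) → branch-case (Scaling₁ WT 43 e (prodTo (suc m) (selected e)))
        (apart (τ′ 45 0) (τ′ 43 0)) {exec (WT ≔ var WT ⊗ arr 6 (var 45)) τ′} {exec (WT ≔ var WT ⊗ arr 5 (var 45)) τ′}
        (λ ≢0 → mkScaling₁ (input-exec (WT ≔ var WT ⊗ arr 6 (var 45)) _ inp′) refl
          (cong₂ _*_ x≡ (trans (inp′ 6 tt m) (sym (branch-≢0 ≢0)))))
        (λ ≡0 → mkScaling₁ (input-exec (WT ≔ var WT ⊗ arr 5 (var 45)) _ inp′) refl
          (cong₂ _*_ x≡ (trans (inp′ 5 tt m) (sym (branch-≡0 ≡0))))) })
      λ m τ′ v (mkScaling₁ a b c) → mkScaling₁ (input-exec (45 ≔ lit v) _ a) b c))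

  scale-V : ∀ e τ → HasInput τ → τ PT 0 ≡ e → exec (scale VT (var PT)) τ VT 0 ≡ prodTo L (selected e)
  scale-V e τ inp e≡ = subst (λ n → exec (scale VT (var PT)) τ VT 0 ≡ prodTo n (selected e)) (inp 1 tt 1)
    (Scaling₁.x≡ (for-inv (λ m → Scaling₁ VT PT e (prodTo m (selected e))) 45 1 1 (scaleStep VT (var PT))
      (exec (VT ≔ lit 1) τ) refl
      (mkScaling₁ (input-exec (VT ≔ lit 1 ▸ 45 ≔ lit 0) _ inp) e≡ refl)
      (λ { m τ′ _ refl (mkScaling₁ inp′ refl x≡) → branch-case (Scaling₁ VT PT e (prodTo (suc m) (selected e)))
        (apart (τ′ 45 0) (τ′ PT 0)) {exec (VT ≔ var VT ⊗ arr 6 (var 45)) τ′} {exec (VT ≔ var VT ⊗ arr 5 (var 45)) τ′}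
        (λ ≢0 → mkScaling₁ (input-exec (VT ≔ var VT ⊗ arr 6 (var 45)) _ inp′) refl
          (cong₂ _*_ x≡ (trans (inp′ 6 tt m) (sym (branch-≢0 ≢0)))))
        (λ ≡0 → mkScaling₁ (input-exec (VT ≔ var VT ⊗ arr 5 (var 45)) _ inp′) refl
          (cong₂ _*_ x≡ (trans (inp′ 5 tt m) (sym (branch-≡0 ≡0))))) })
      λ m τ′ v (mkScaling₁ a b c) → mkScaling₁ (input-exec (45 ≔ lit v) _ a) b c))

  -- The cost of a link multiplied by all denominators, those of the links and those of the listed
  -- coefficients.
  weight : ℕ → ℕ
  weight e = prodTo L (selected e) * prodTo GS rden

  pairWeight : ℕ → ℕ → ℕ → ℕ
  pairWeight e f ps = (prodTo L (selected e) + prodTo L (selected f)) * prodTo GS (selectedρ ps)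

  saving : ℕ → ℕ → ℕ → ℕ
  saving e f ps = (weight e + weight f) ∸ pairWeight e f ps

  record Scaling₂ (w v j ps m : ℕ) (τ : Memory) : Set where
    constructor mkScaling₂
    field
      input : HasInput τ
      ps≡   : τ PS 0 ≡ ps
      w≡    : τ WT 0 ≡ w * prodTo m rden
      v≡    : τ VT 0 ≡ v * prodTo m rden
      j≡    : τ JT 0 ≡ j * prodTo m (selectedρ ps)

  scaleρ-step : ∀ w v j ps m τ → τ 45 0 ≡ m → Scaling₂ w v j ps m τ → Scaling₂ w v j ps (suc m) (exec scaleρ τ)
  scaleρ-step w v j ps m τ refl (mkScaling₂ inp refl w≡ v≡ j≡) =
    branch-case (Scaling₂ w v j ps (suc m)) (apart (m + 1) (τ PS 0)) {exec p τ₁} {exec q τ₁}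
      (λ ≢0 → mkScaling₂ (input-exec p _ inp₁) refl w≡′ v≡′
        (extend j (prodTo m (selectedρ ps)) j≡ (trans (inp 10 tt m) (sym (branch-≢0 {x = rden m} {rnum m} ≢0)))))
      (λ ≡0 → mkScaling₂ (input-exec q _ inp₁) refl w≡′ v≡′
        (extend j (prodTo m (selectedρ ps)) j≡ (trans (inp 9 tt m) (sym (branch-≡0 {x = rden m} {rnum m} ≡0)))))
    where
    p q init : Cmd
    p = JT ≔ var JT ⊗ arr 10 (var 45)
    q = JT ≔ var JT ⊗ arr 9 (var 45)
    init = WT ≔ var WT ⊗ arr 10 (var 45) ▸ VT ≔ var VT ⊗ arr 10 (var 45)
    τ₁ : Memory
    τ₁ = exec init τ
    inp₁ : HasInput τ₁
    inp₁ = input-exec init _ inp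
    extend : ∀ {x y c} a b → x ≡ a * b → y ≡ c → x * y ≡ a * (b * c)
    extend {c = c} a b refl refl = *-assoc a b c
    w≡′ : τ WT 0 * τ 10 m ≡ w * prodTo (suc m) rden
    w≡′ = extend w (prodTo m rden) w≡ (inp 10 tt m)
    v≡′ : τ VT 0 * τ 10 m ≡ v * prodTo (suc m) rden
    v≡′ = extend v (prodTo m rden) v≡ (inp 10 tt m)

  record Weighed (e pt ps : ℕ) (τ : Memory) : Set where
    constructor mkWeighed
    field
      input : HasInput τ
      e≡    : τ 43 0 ≡ e
      pt≡   : τ PT 0 ≡ pt
      w≡    : τ WT 0 ≡ weight e
      c≡    : τ CP 0 ≡ saving e pt ps

  weigh-correct : ∀ e pt ps τ → HasInput τ → τ 43 0 ≡ e → τ PT 0 ≡ pt → τ PS 0 ≡ ps →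
    Weighed e pt ps (exec weigh τ)
  weigh-correct e pt ps τ inp e≡ pt≡ ps≡ = finish
    (for-inv (Scaling₂ w v (w + v) ps) 45 1 3 scaleρ τ₃ refl
      (mkScaling₂ (input-exec (45 ≔ lit 0) _ inp₃)
        (trans (frame (scale VT (var PT)) PS refl τ₁ 0) (trans (frame (scale WT (var 43)) PS refl τ 0) ps≡))
        (trans w-eq (sym (*-identityʳ w))) (trans v-eq (sym (*-identityʳ v)))
        (trans (cong₂ _+_ w-eq v-eq) (sym (*-identityʳ (w + v)))))
      (λ m τ′ _ → scaleρ-step w v (w + v) ps m τ′)
      λ m τ′ x (mkScaling₂ a b c d e) → mkScaling₂ (input-exec (45 ≔ lit x) _ a) b c d e)
    where
    w v : ℕ
    w = prodTo L (selected e)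
    v = prodTo L (selected pt)
    τ₁ τ₂ τ₃ : Memory
    τ₁ = exec (scale WT (var 43)) τ
    τ₂ = exec (scale VT (var PT)) τ₁
    τ₃ = exec (JT ≔ var WT ⊕ var VT) τ₂
    inp₁ : HasInput τ₁
    inp₁ = input-exec (scale WT (var 43)) _ inp
    inp₃ : HasInput τ₃
    inp₃ = input-exec (scale VT (var PT) ▸ JT ≔ var WT ⊕ var VT) _ inp₁
    w-eq : τ₂ WT 0 ≡ w
    w-eq = trans (frame (scale VT (var PT)) WT refl τ₁ 0) (scale-W e τ inp e≡)
    v-eq : τ₂ VT 0 ≡ v
    v-eq = scale-V pt τ₁ inp₁ (trans (frame (scale WT (var 43)) PT refl τ 0) pt≡)
    τ₄ : Memory
    τ₄ = exec (for 45 1 3 scaleρ) τ₃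
    finish : Scaling₂ w v (w + v) ps (τ₃ 1 3) τ₄ → Weighed e pt ps (exec (CP ≔ (var WT ⊕ var VT) ⊖ var JT) τ₄)
    finish (mkScaling₂ inp₄ _ w≡ v≡ j≡) = mkWeighed
      (input-exec (CP ≔ (var WT ⊕ var VT) ⊖ var JT) _ inp₄)
      (trans (frame weigh 43 refl τ 0) e≡) (trans (frame weigh PT refl τ 0) pt≡)
      (trans w≡ (bound {w} rden))
      (cong₂ _∸_ (cong₂ _+_ (trans w≡ (bound {w} rden)) (trans v≡ (bound {v} rden))) (trans j≡ (bound {w + v} (selectedρ ps))))
      where
      bound : ∀ {x} f → x * prodTo (τ₃ 1 3) f ≡ x * prodTo GS f
      bound {x} f = cong (λ n → x * prodTo n f) (inp₃ 1 tt 3)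

  record ArcsOf (τ : Memory) (es : List Edge) : Set where
    constructor mkArcsOf
    field
      arcs  : Arcs (τ SRC) (τ DST) (τ RES) (τ REV) (τ NA 0) es
      total : τ TT 0 ≡ totalE es

  pushEdge-correct : ∀ τ es → ArcsOf τ es →
    ArcsOf (exec pushEdge τ) ((τ EU 0 , τ EV 0 , τ EC 0) ∷ es)
  pushEdge-correct τ es (mkArcsOf arcs tot) = mkArcsOf
    (n , refl ,
      (lower , lower , lower , lower) , (upper , upper , upper , upper) ,
      Arcs-ext n es (λ i → below) (λ i → below) (λ i → below) (λ i → below) arcs)
    (cong (_+ τ EC 0) tot)
    where
    n : ℕ
    n = τ NA 0
    upper : ∀ {v w} → (if suc n ≡ᵇ suc n then v else w) ≡ v
    upper = if-≡ᵇ-yes {suc n} refl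
    lower : ∀ {u v w : ℕ} → (if n ≡ᵇ suc n then u else if n ≡ᵇ n then v else w) ≡ v
    lower {u} {v} {w} = trans (if-≡ᵇ-no {suc n} {n} {v = u} (1+n≢n ∘ sym)) (if-≡ᵇ-yes {n} {n} {v = v} {w} refl)
    below : ∀ {i} {u v w : ℕ} → i < n → (if i ≡ᵇ suc n then u else if i ≡ᵇ n then v else w) ≡ w
    below {i} {u} {v} {w} i<n = trans (if-≡ᵇ-no {suc n} {i} {v = u} (<⇒≢ (m<n⇒m<1+n i<n))) (if-≡ᵇ-no {n} {i} {v = v} {w} (<⇒≢ i<n))

  weighed-exec : ∀ p {e pt ps τ} → ok p →
    writes p 43 ∨ (writes p PT ∨ (writes p WT ∨ writes p CP)) ≡ false →
    Weighed e pt ps τ → Weighed e pt ps (exec p τ)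
  weighed-exec p {τ = τ} o w (mkWeighed inp e≡ pt≡ w≡ c≡) with ∨-false {writes p 43} w
  ... | w₁ , w′ with ∨-false {writes p PT} w′
  ... | w₂ , w″ with ∨-false {writes p WT} w″
  ... | w₃ , w₄ = mkWeighed (input-exec p o inp)
    (trans (frame p 43 w₁ τ 0) e≡) (trans (frame p PT w₂ τ 0) pt≡)
    (trans (frame p WT w₃ τ 0) w≡) (trans (frame p CP w₄ τ 0) c≡)

  -- A record over an arbitrary program can be composed without ever unfolding
  -- exec on a long one, which is costly.
  record Appends (m pt ps : ℕ) (p : Cmd) (f : List Edge → List Edge) : Set where
    constructor mkAppends
    field
      stays : ∀ τ → Weighed m pt ps τ → Weighed m pt ps (exec p τ)
      adds  : ∀ τ es → Weighed m pt ps τ → ArcsOf τ es → ArcsOf (exec p τ) (f es)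

  infixr 3 _appends-▸_
  _appends-▸_ : ∀ {m pt ps p q f g} → Appends m pt ps p f → Appends m pt ps q g →
    Appends m pt ps (p ▸ q) (λ es → g (f es))
  _appends-▸_ {p = p} {f = f} (mkAppends s a) (mkAppends s′ a′) = mkAppends
    (λ τ wd → s′ (exec p τ) (s τ wd))
    (λ τ es wd arcs → a′ (exec p τ) (f es) (s τ wd) (a τ es wd arcs))

  append-correct : ∀ {m pt ps} u v c {U V C} → ok (append u v c) →
    (∀ τ → Weighed m pt ps τ → ⟦ u ⟧ τ ≡ U) → (∀ τ → Weighed m pt ps τ → ⟦ v ⟧ τ ≡ V) →
    (∀ τ → Weighed m pt ps τ → ⟦ c ⟧ τ ≡ C) →
    Appends m pt ps (append u v c) ((U , V , C) ∷_)
  append-correct {m} {pt} {ps} u v c {U} {V} {C} o@((oku , okv , okc) , _) u≡ v≡ c≡ =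
    mkAppends (λ τ → weighed-exec (append u v c) o refl) added
    where
    added : ∀ τ es → Weighed m pt ps τ → ArcsOf τ es → ArcsOf (exec (append u v c) τ) ((U , V , C) ∷ es)
    added τ es wd (mkArcsOf arcs tot) =
      subst (λ e → ArcsOf (exec (append u v c) τ) (e ∷ es))
        (cong₂ _,_ (u≡ τ wd) (cong₂ _,_ (v≡ τ₁ wd₁) (c≡ τ₂ wd₂)))
        (pushEdge-correct (exec (EU ≔ u ▸ EV ≔ v ▸ EC ≔ c) τ) es (mkArcsOf arcs tot))
      where
      τ₁ τ₂ : Memory
      τ₁ = exec (EU ≔ u) τ
      τ₂ = exec (EV ≔ v) τ₁
      wd₁ : Weighed m pt ps τ₁
      wd₁ = weighed-exec (EU ≔ u) oku refl wd
      wd₂ : Weighed m pt ps τ₂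
      wd₂ = weighed-exec (EV ≔ v) okv refl wd₁

  record Good (m W C h : ℕ) : Set where
    constructor mkGood
    field
      pt ps    : ℕ
      sound    : Sound m pt ps
      complete : Complete m GS ps
      W≡       : W ≡ weight m
      C≡       : C ≡ saving m pt ps
      h≡       : h ≡ hd pt

  linkEdges : (m h W C : ℕ) → List Edge → List Edge
  linkEdges m h W C es = (nodes + m , h , C) ∷ (nodes + m , hd m , C) ∷ (tl m , nodes + m , C) ∷
    (tl m , hd m , (W ∸ C) + (W ∸ C)) ∷ es

  data Blocks : ℕ → List Edge → Set where
    none  : Blocks 0 []
    block : ∀ {m es W C h} → Good m W C h → Blocks m es →
      Blocks (suc m) (linkEdges m h W C es)

  record Built (m : ℕ) (τ : Memory) : Set where
    constructor mkBuilt
    field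
      input  : HasInput τ
      es     : List Edge
      arcs   : ArcsOf τ es
      blocks : Blocks m es

  edges-correct : ∀ m pt ps → Appends m pt ps edges (linkEdges m (hd pt) (weight m) (saving m pt ps))
  edges-correct m pt ps =
    append-correct tail₁ head₁ rest _ tail₁≡ head₁≡ rest≡ appends-▸
    append-correct tail₁ aux (var CP) _ tail₁≡ aux≡ saving≡ appends-▸
    append-correct aux head₁ (var CP) _ aux≡ head₁≡ saving≡ appends-▸
    append-correct aux head₂ (var CP) _ aux≡ head₂≡ saving≡
    where
    aux tail₁ head₁ head₂ rest : Expr
    aux   = nodesE ⊕ var 43
    tail₁ = arr 3 (var 43)
    head₁ = arr 4 (var 43)
    head₂ = arr 4 (var PT)
    rest  = (var WT ⊖ var CP) ⊕ (var WT ⊖ var CP)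
    aux≡ : ∀ τ → Weighed m pt ps τ → ⟦ aux ⟧ τ ≡ nodes + m
    aux≡ τ (mkWeighed inp e≡ _ _ _) = cong₂ _+_ (inp 1 tt 0) e≡
    tail₁≡ : ∀ τ → Weighed m pt ps τ → ⟦ tail₁ ⟧ τ ≡ tl m
    tail₁≡ τ (mkWeighed inp e≡ _ _ _) = trans (inp 3 tt _) (cong tl e≡)
    head₁≡ : ∀ τ → Weighed m pt ps τ → ⟦ head₁ ⟧ τ ≡ hd m
    head₁≡ τ (mkWeighed inp e≡ _ _ _) = trans (inp 4 tt _) (cong hd e≡)
    head₂≡ : ∀ τ → Weighed m pt ps τ → ⟦ head₂ ⟧ τ ≡ hd pt
    head₂≡ τ (mkWeighed inp _ pt≡ _ _) = trans (inp 4 tt _) (cong hd pt≡)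
    saving≡ : ∀ τ → Weighed m pt ps τ → ⟦ var CP ⟧ τ ≡ saving m pt ps
    saving≡ τ wd = Weighed.c≡ wd
    rest≡ : ∀ τ → Weighed m pt ps τ → ⟦ rest ⟧ τ ≡ (weight m ∸ saving m pt ps) + (weight m ∸ saving m pt ps)
    rest≡ τ (mkWeighed _ _ _ w≡ c≡) = cong₂ _+_ (cong₂ _∸_ w≡ c≡) (cong₂ _∸_ w≡ c≡)

  record Links (p : Cmd) : Set where
    constructor mkLinks
    field
      extends : ∀ m τ → τ 43 0 ≡ m → Built m τ → Built (suc m) (exec p τ)

  keepsArcs : Cmd → Bool
  keepsArcs p = writes p NA ∨ (writes p TT ∨ (writes p SRC ∨ (writes p DST ∨ (writes p RES ∨ writes p REV))))

  arcs-exec : ∀ p {τ es} → keepsArcs p ≡ false → ArcsOf τ es → ArcsOf (exec p τ) es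
  arcs-exec p {τ} {es} w (mkArcsOf arcs tot) with ∨-false {writes p NA} w
  ... | w₁ , w′ with ∨-false {writes p TT} w′
  ... | w₂ , w″ with ∨-false {writes p SRC} w″
  ... | w₃ , w‴ with ∨-false {writes p DST} w‴
  ... | w₄ , w⁗ with ∨-false {writes p RES} w⁗
  ... | w₅ , w₆ = mkArcsOf
    (subst (λ n → Arcs (exec p τ SRC) (exec p τ DST) (exec p τ RES) (exec p τ REV) n es)
      (sym (frame p NA w₁ τ 0))
      (Arcs-ext (τ NA 0) es (λ i _ → frame p SRC w₃ τ i) (λ i _ → frame p DST w₄ τ i)
        (λ i _ → frame p RES w₅ τ i) (λ i _ → frame p REV w₆ τ i) arcs))
    (trans (frame p TT w₂ τ 0) tot)

  links : ∀ p q r → keepsArcs p ≡ false → keepsArcs q ≡ false → ok r →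
    (∀ m τ → HasInput τ → τ 43 0 ≡ m → Finding m GS (exec p τ)) →
    (∀ m pt ps τ → HasInput τ → τ 43 0 ≡ m → τ PT 0 ≡ pt → τ PS 0 ≡ ps → Weighed m pt ps (exec q τ)) →
    (∀ m pt ps → Appends m pt ps r (linkEdges m (hd pt) (weight m) (saving m pt ps))) →
    Links (p ▸ q ▸ r)
  links p q r kp kq okr fp wq ar = mkLinks extend
    where
    extend : ∀ m τ → τ 43 0 ≡ m → Built m τ → Built (suc m) (exec (p ▸ q ▸ r) τ)
    extend m τ m≡ (mkBuilt inp es arcs bl) = finish (fp m τ inp m≡)
      where
      τ₁ τ₂ : Memory
      τ₁ = exec p τ
      τ₂ = exec q τ₁
      finish : Finding m GS τ₁ → Built (suc m) (exec r τ₂)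
      finish (mkFinding inp₁ m≡₁ so co) = mkBuilt
        (input-exec r okr (Weighed.input wd)) _
        (Appends.adds (ar m (τ₁ PT 0) (τ₁ PS 0)) τ₂ es wd (arcs-exec q kq (arcs-exec p kp arcs)))
        (block (mkGood (τ₁ PT 0) (τ₁ PS 0) so co refl refl refl) bl)
        where
        wd : Weighed m (τ₁ PT 0) (τ₁ PS 0) τ₂
        wd = wq m (τ₁ PT 0) (τ₁ PS 0) τ₁ inp₁ m≡₁ refl refl

  link-links : Links link
  link-links = links findPartner weigh edges refl refl _ findPartner-correct weigh-correct edges-correct

  record Finished (τ : Memory) : Set where
    constructor mkFinished
    field
      built : Built L τ
      cN    : τ CONST 3 ≡ nodes + L
      cA    : τ CONST 1 ≡ τ NA 0
      cR    : τ CONST 2 ≡ suc (τ NA 0 + τ NA 0)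
      cK    : τ CONST 0 ≡ 1
      pw    : τ PW 0 ≡ 1

  build-finished : Built 0 σ₀ → Finished (exec build σ₀)
  build-finished b₀ = finish (for-inv Built 43 1 1 link σ₀ refl (stable 0 σ₀ 0 b₀)
      (λ m τ _ → Links.extends link-links m τ) stable)
    where
    stable : ∀ m τ v → Built m τ → Built m (update τ 43 0 v)
    stable m τ v (mkBuilt inp es (mkArcsOf a b) bl) = mkBuilt (input-exec (43 ≔ lit v) _ inp) es (mkArcsOf a b) bl
    finish : ∀ {τ} → Built L τ → Finished (exec finishBuild τ)
    finish {τ} (mkBuilt inp es (mkArcsOf a b) bl) = mkFinished
      (mkBuilt (input-exec finishBuild _ inp) es (mkArcsOf a b) bl)
      (cong₂ _+_ (inp 1 tt 0) (inp 1 tt 1)) refl refl refl refl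

-- Cuts of edge lists and the gadget of a link

cutE : (ℕ → Bool) → List Edge → ℕ
cutE X []                 = 0
cutE X ((u , v , c) ∷ es) = cutE X es + c * crossing X u v

cutE-arcs : ∀ {src dst res rev} X n es → Arcs src dst res rev n es →
  sumTo n (λ k → res k * crossing X (src k) (dst k)) ≡ cutE X es
cutE-arcs X n [] refl = refl
cutE-arcs {src} {dst} {res} X n (_ ∷ es) (m , refl , (refl , refl , refl , _) , (_ , _ , r≡ , _) , rest) =
  trans (cong₂ (λ x y → x + res m * crossing X (src m) (dst m) + y * crossing X (src (suc m)) (dst (suc m))) (cutE-arcs X m es rest) r≡) (+-identityʳ _)

cutE≤totalE : ∀ X es → cutE X es ≤ totalE es
cutE≤totalE X [] = z≤n
cutE≤totalE X ((u , v , c) ∷ es) = +-mono-≤ (cutE≤totalE X es)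
  (≤-trans (*-monoʳ-≤ c (crossing-≤1 X u v)) (≤-reflexive (*-identityʳ c)))

data EdgesBelow (N : ℕ) : List Edge → Set where
  []  : EdgesBelow N []
  _∷_ : ∀ {u v c es} → u < N × v < N → EdgesBelow N es → EdgesBelow N ((u , v , c) ∷ es)

record GoodArc (src dst rev : ℕ → ℕ) (N n k : ℕ) : Set where
  constructor mkGoodArc
  field
    src<    : src k < N
    dst<    : dst k < N
    rev<    : rev k < n
    src-rev : src (rev k) ≡ dst k
    dst-rev : dst (rev k) ≡ src k

goodArc : ∀ {src dst res rev N} n es → Arcs src dst res rev n es → EdgesBelow N es →
  ∀ k → k < n → GoodArc src dst rev N n k
goodArc n [] refl _ k ()
goodArc {src} {dst} {res} {rev} {N} n (_ ∷ es) (m , refl , (s₁ , d₁ , _ , v₁) , (s₂ , d₂ , _ , v₂) , rest) ((u< , v<) ∷ below) k k<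
  with k ≟ suc m | k ≟ m
... | yes refl | _ = mkGoodArc (subst (_< N) (sym s₂) v<) (subst (_< N) (sym d₂) u<)
  (subst (_< n) (sym v₂) (n≤1+n (suc m)))
  (trans (cong src v₂) (trans s₁ (sym d₂))) (trans (cong dst v₂) (trans d₁ (sym s₂)))
... | no _ | yes refl = mkGoodArc (subst (_< N) (sym s₁) u<) (subst (_< N) (sym d₁) v<)
  (subst (_< n) (sym v₁) ≤-refl)
  (trans (cong src v₁) (trans s₂ (sym d₁))) (trans (cong dst v₁) (trans d₂ (sym s₁)))
... | no k≢1+m | no k≢m
  with goodArc m es rest below k (≤∧≢⇒< (s≤s⁻¹ (≤∧≢⇒< (s≤s⁻¹ k<) k≢1+m)) k≢m)
... | mkGoodArc a b c d e = mkGoodArc a b (≤-trans c (≤-trans (n≤1+n m) (n≤1+n (suc m)))) d e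

-- The cheapest cost of the gadget of a link over both sides for its auxiliary
-- node; k and k′ tell whether the link and its partner are cut.
linkCut : (W C : ℕ) → Bool → Bool → ℕ
linkCut W C k k′ = ((W ∸ C) + (W ∸ C)) * ind k + C * ind (k ∨ k′)

-- When `u` is on the source side and `v` or `h` is not, `a` either lies across from `u`, or shares
-- its side, and then an arc out of `a` is cut.
gadget : ∀ X a u v h →
  ind ((X u ∧ not (X v)) ∨ (X u ∧ not (X h))) ≤ crossing X u a + crossing X a v + crossing X a h
gadget X a u v h with X u | X v | X h | X a
... | false | _     | _     | _     = z≤n
... | true  | true  | true  | _     = z≤n
... | true  | true  | false | true  = ≤-refl
... | true  | true  | false | false = ≤-refl
... | true  | false | true  | true  = ≤-refl
... | true  | false | true  | false = ≤-refl
... | true  | false | false | true  = s≤s z≤n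
... | true  | false | false | false = ≤-refl

-- If `a` joins the source side only together with `u`, `v` and `h`, no arc out of `a` is ever cut,
-- and `u → a` is cut just when it has to be.
gadget-tight : ∀ X a u v h → X a ≡ X u ∧ (X v ∧ X h) →
  ind ((X u ∧ not (X v)) ∨ (X u ∧ not (X h))) ≡ crossing X u a + crossing X a v + crossing X a h
gadget-tight X a u v h eq with X u | X v | X h | X a
gadget-tight X a u v h refl | false | _     | _     | _ = refl
gadget-tight X a u v h refl | true  | true  | true  | _ = refl
gadget-tight X a u v h refl | true  | true  | false | _ = refl
gadget-tight X a u v h refl | true  | false | _     | _ = refl

module Lower (σ₀ : Memory) where

  open Build σ₀

  lowerE : (ℕ → Bool) → ∀ {m es} → Blocks m es → ℕ
  lowerE X none = 0
  lowerE X (block {m} {es} {W} {C} {h} g bl) = lowerE X bl +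
    linkCut W C (X (tl m) ∧ not (X (hd m))) (X (tl m) ∧ not (X h))

  blockCost : ∀ x d C k p q r → x + d * k + C * p + C * q + C * r ≡ x + (d * k + C * (p + q + r))
  blockCost = solve-∀

  lowerE≤cutE : ∀ X {m es} (bl : Blocks m es) → lowerE X bl ≤ cutE X es
  lowerE≤cutE X none = z≤n
  lowerE≤cutE X (block {m} {es} {W} {C} {h} g bl) = ≤-trans
    (+-mono-≤ (lowerE≤cutE X bl)
      (+-monoʳ-≤ (((W ∸ C) + (W ∸ C)) * crossing X (tl m) (hd m))
        (*-monoʳ-≤ C (gadget X (nodes + m) (tl m) (hd m) h))))
    (≤-reflexive (sym (blockCost (cutE X es) ((W ∸ C) + (W ∸ C)) C (crossing X (tl m) (hd m))
      (crossing X (tl m) (nodes + m)) (crossing X (nodes + m) (hd m)) (crossing X (nodes + m) h))))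

  Tight : (ℕ → Bool) → ∀ {m es} → Blocks m es → Set
  Tight X none = ⊤
  Tight X (block {m} {es} {W} {C} {h} g bl) =
    X (nodes + m) ≡ X (tl m) ∧ (X (hd m) ∧ X h) × Tight X bl

  lowerE-tight : ∀ X {m es} (bl : Blocks m es) → Tight X bl → lowerE X bl ≡ cutE X es
  lowerE-tight X none _ = refl
  lowerE-tight X (block {m} {es} {W} {C} {h} g bl) (eq , ts) = trans
    (cong₂ _+_ (lowerE-tight X bl ts)
      (cong (λ z → ((W ∸ C) + (W ∸ C)) * crossing X (tl m) (hd m) + C * z)
        (gadget-tight X (nodes + m) (tl m) (hd m) h eq)))
    (sym (blockCost (cutE X es) ((W ∸ C) + (W ∸ C)) C (crossing X (tl m) (hd m))
      (crossing X (tl m) (nodes + m)) (crossing X (nodes + m) (hd m)) (crossing X (nodes + m) h)))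

  -- Turns a cut of the network into a cut of the graph: the auxiliary nodes take the sides of
  -- `gadget-tight`, so that the lower bound on the cost is attained.
  extend : (ℕ → Bool) → ∀ {m es} → Blocks m es → ℕ → Bool
  extend Y none i = Y i
  extend Y (block {m} {h = h} g bl) i =
    if i ≡ᵇ nodes + m then Y (tl m) ∧ (Y (hd m) ∧ Y h) else extend Y bl i

  extend-old : ∀ Y {m es} (bl : Blocks m es) i → i < nodes → extend Y bl i ≡ Y i
  extend-old Y none i i< = refl
  extend-old Y (block {m} g bl) i i< =
    trans (if-≡ᵇ-no {nodes + m} {i} (<⇒≢ (≤-trans i< (m≤m+n nodes m)))) (extend-old Y bl i i<)

  Heads : ∀ {m es} → Blocks m es → Set
  Heads none = ⊤
  Heads (block {h = h} g bl) = h < nodes × Heads bl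

  -- Blocks of the first `m` links mention no node from `nodes + m` on, so placing the auxiliary
  -- nodes of further links leaves them tight.
  Tight-cong : ∀ {X X′} {m es} (bl : Blocks m es) → m ≤ L → (∀ l → l < L → tl l < nodes × hd l < nodes) →
    Heads bl → (∀ i → i < nodes + m → X′ i ≡ X i) → Tight X bl → Tight X′ bl
  Tight-cong none _ _ _ _ _ = tt
  Tight-cong (block {m} g bl) m< below (h< , hs) agree (eq , ts) =
    trans (agree (nodes + m) (+-monoʳ-< nodes ≤-refl)) (trans eq
      (sym (cong₂ _∧_ (agree _ (up (proj₁ (below m m<))))
        (cong₂ _∧_ (agree _ (up (proj₂ (below m m<)))) (agree _ (up h<)))))) ,
    Tight-cong bl (<⇒≤ m<) below hs (λ i i< → agree i (≤-trans i< (+-monoʳ-≤ nodes (n≤1+n m)))) ts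
    where
    up : ∀ {i} → i < nodes → i < nodes + suc m
    up i< = ≤-trans i< (m≤m+n nodes (suc m))

  extend-tight : ∀ Y {m es} (bl : Blocks m es) → m ≤ L → (∀ l → l < L → tl l < nodes × hd l < nodes) →
    Heads bl → Tight (extend Y bl) bl
  extend-tight Y none _ _ _ = tt
  extend-tight Y (block {m} {h = h} g bl) m< below (h< , hs) =
    trans (if-≡ᵇ-yes {nodes + m} refl) (sym (cong₂ _∧_ (old (proj₁ (below m m<)))
      (cong₂ _∧_ (old (proj₂ (below m m<))) (old h<)))) ,
    Tight-cong bl (<⇒≤ m<) below hs (λ i i< → if-≡ᵇ-no {nodes + m} (<⇒≢ i<))
      (extend-tight Y bl (<⇒≤ m<) below hs)
    where
    old : ∀ {i} → i < nodes → extend Y (block g bl) i ≡ Y i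
    old {i} = extend-old Y (block g bl) i

  heads : ∀ {m es} (bl : Blocks m es) → m ≤ L → (∀ l → l < L → tl l < nodes × hd l < nodes) → Heads bl
  heads none _ _ = tt
  heads (block {m} (mkGood pt ps so _ _ _ h≡) bl) m< below =
    subst (_< nodes) (sym h≡) (proj₂ (below pt (pt< so))) , heads bl (<⇒≤ m<) below
    where
    pt< : Sound m pt ps → pt < L
    pt< (inj₁ (_ , refl))            = m<
    pt< (inj₂ (_ , _ , _ , pt<L , _)) = pt<L

  blocks-below : ∀ {m es} (bl : Blocks m es) → m ≤ L → (∀ l → l < L → tl l < nodes × hd l < nodes) →
    EdgesBelow (nodes + L) es
  blocks-below none _ _ = []
  blocks-below bl₀@(block {m} g bl) m< below with heads bl₀ m< below
  ... | h< , _ = (aux , up h<) ∷ (aux , up (proj₂ (below m m<))) ∷ (up (proj₁ (below m m<)) , aux) ∷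
    (up (proj₁ (below m m<)) , up (proj₂ (below m m<))) ∷ blocks-below bl (<⇒≤ m<) below
    where
    aux : nodes + m < nodes + L
    aux = +-monoʳ-< nodes m<
    up : ∀ {i} → i < nodes → i < nodes + L
    up i< = ≤-trans i< (m≤m+n nodes L)

-- Cuts in which correlated links come in pairs

sum-zero : ∀ {n} (f : Fin n → ℚ) → (∀ i → f i ≡ 0ℚ) → sum f ≡ 0ℚ
sum-zero {zero}  f f≡0 = refl
sum-zero {suc n} f f≡0 =
  trans (cong₂ ℚ._+_ (f≡0 zero) (sum-zero (f ∘ suc) (f≡0 ∘ suc))) (ℚₚ.+-identityˡ 0ℚ)

sum-one : ∀ {n} (f : Fin n → ℚ) i → (∀ j → j ≢ i → f j ≡ 0ℚ) → sum f ≡ f i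
sum-one f zero    off = trans (cong (f zero ℚ.+_) (sum-zero (f ∘ suc) λ j → off (suc j) λ ()))
  (ℚₚ.+-identityʳ (f zero))
sum-one f (suc i) off = trans (cong₂ ℚ._+_ (off zero λ ())
  (sum-one (f ∘ suc) i λ j j≢i → off (suc j) (j≢i ∘ Finₚ.suc-injective))) (ℚₚ.+-identityˡ (f (suc i)))

sum-two : ∀ {n} (f : Fin n → ℚ) i j → i ≢ j → (∀ k → k ≢ i → k ≢ j → f k ≡ 0ℚ) →
  sum f ≡ f i ℚ.+ f j
sum-two f zero    zero    i≢j off = contradiction refl i≢j
sum-two f zero    (suc j) i≢j off = cong (f zero ℚ.+_)
  (sum-one (f ∘ suc) j λ k k≢j → off (suc k) (λ ()) (k≢j ∘ Finₚ.suc-injective))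
sum-two f (suc i) zero    i≢j off = trans (cong (f zero ℚ.+_)
  (sum-one (f ∘ suc) i λ k k≢i → off (suc k) (k≢i ∘ Finₚ.suc-injective) λ ())) (ℚₚ.+-comm (f zero) (f (suc i)))
sum-two f (suc i) (suc j) i≢j off = trans (cong₂ ℚ._+_ (off zero (λ ()) λ ())
  (sum-two (f ∘ suc) i j (i≢j ∘ cong suc)
    λ k k≢i k≢j → off (suc k) (k≢i ∘ Finₚ.suc-injective) (k≢j ∘ Finₚ.suc-injective)))
  (ℚₚ.+-identityˡ _)

∈⇒lookup : ∀ {n x} {p : Subset n} → x ∈ p → lookup p x ≡ true
∈⇒lookup = []=⇒lookup

lookup⇒∈ : ∀ {n x} {p : Subset n} → lookup p x ≡ true → x ∈ p
lookup⇒∈ {x = x} {p} = lookup⇒[]= x p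

∉⇒lookup : ∀ {n x} {p : Subset n} → x ∉ p → lookup p x ≡ false
∉⇒lookup {x = x} {p} x∉p with lookup p x in eq
... | true  = contradiction (lookup⇒∈ eq) x∉p
... | false = refl

lookup⇒∉ : ∀ {n x} {p : Subset n} → lookup p x ≡ false → x ∉ p
lookup⇒∉ eq x∈p with trans (sym eq) (∈⇒lookup x∈p)
... | ()

lookup-ext : ∀ {n} (p q : Subset n) → (∀ i → lookup p i ≡ lookup q i) → p ≡ q
lookup-ext p q eq = trans (sym (tabulate∘lookup p)) (trans (tabulate-cong eq) (tabulate∘lookup q))

-- Twice the contribution of a link of cost w to a cut, if c is saved when it is
-- cut together with its partner: k and k′ tell which of the two are cut.
contribution : ℚ → ℚ → Bool → Bool → ℚ
contribution w c k k′ =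
  (if k then (w ℚ.- c) ℚ.+ (w ℚ.- c) else 0ℚ) ℚ.+ (if k ∨ k′ then c else 0ℚ)

private
  if-0 : ∀ b → (if b then 0ℚ else 0ℚ) ≡ 0ℚ
  if-0 true  = refl
  if-0 false = refl

contribution-single : ∀ w k k′ → contribution w 0ℚ k k′ ≡ (if k then w ℚ.+ w else 0ℚ)
contribution-single w true  k′ = trans (ℚₚ.+-identityʳ _) (cong₂ ℚ._+_ (ℚₚ.+-identityʳ w) (ℚₚ.+-identityʳ w))
contribution-single w false k′ = trans (ℚₚ.+-identityˡ _) (if-0 k′)

-- The term for `c` is not additive: with a link in one part and its partner in the other it would
-- be counted twice. The disjunction rules this out: nothing is saved, or one part contains neither
-- of the two.
contribution-+ : ∀ w c k₁ k₁′ k₂ k₂′ → k₁ ∧ k₂ ≡ false →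
  c ≡ 0ℚ ⊎ (k₁ ≡ false × k₁′ ≡ false) ⊎ (k₂ ≡ false × k₂′ ≡ false) →
  contribution w c (k₁ ∨ k₂) (k₁′ ∨ k₂′) ≡ contribution w c k₁ k₁′ ℚ.+ contribution w c k₂ k₂′
contribution-+ w c k₁ k₁′ k₂ k₂′ disj (inj₁ refl) = trans (contribution-single w (k₁ ∨ k₂) (k₁′ ∨ k₂′))
  (trans (lemma k₁ k₂ disj) (sym (cong₂ ℚ._+_ (contribution-single w k₁ k₁′) (contribution-single w k₂ k₂′))))
  where
  lemma : ∀ k₁ k₂ → k₁ ∧ k₂ ≡ false → (if k₁ ∨ k₂ then w ℚ.+ w else 0ℚ) ≡
    (if k₁ then w ℚ.+ w else 0ℚ) ℚ.+ (if k₂ then w ℚ.+ w else 0ℚ)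
  lemma true  false _ = sym (ℚₚ.+-identityʳ (w ℚ.+ w))
  lemma false true  _ = sym (ℚₚ.+-identityˡ (w ℚ.+ w))
  lemma false false _ = refl
contribution-+ w c false false k₂ k₂′ _ (inj₂ (inj₁ (refl , refl))) = sym (ℚₚ.+-identityˡ _)
contribution-+ w c true  k₁′ false false _ (inj₂ (inj₂ (refl , refl))) = sym (ℚₚ.+-identityʳ _)
contribution-+ w c false true  false false _ (inj₂ (inj₂ (refl , refl))) = sym (ℚₚ.+-identityʳ _)
contribution-+ w c false false false false _ (inj₂ (inj₂ (refl , refl))) = refl

module Pairs (net : NodalSRLGNetwork) where

  open NodalSRLGNetwork net

  -- Loops are excluded since no cut contains them. Under `Condition₁` this leaves no pairs at all:
  -- consecutive links with a common tail include a loop.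
  Pair : Link → Link → Set
  Pair e f = e ≢ f × FollowSRLG e f × tail e ≡ tail f × head e ≢ tail e × head f ≢ tail f

  -- What the three conditions have in common.
  record Paired : Set where
    field
      unique : ∀ {e f g} → Pair e f → Pair e g → f ≡ g
      in-cut : ∀ {X e f} → e ∈ cutLinks X → f ∈ cutLinks X → FollowSRLG e f → Pair e f

  follow-sym : ∀ {e f} → FollowSRLG e f → FollowSRLG f e
  follow-sym (e≢f , G , G∈ , e∈ , f∈) = e≢f ∘ sym , G , G∈ , f∈ , e∈

  pair-sym : ∀ {e f} → Pair e f → Pair f e
  pair-sym (e≢f , fo , t , he , hf) = e≢f ∘ sym , follow-sym fo , sym t , hf , he

  lookup-cut : ∀ X l → lookup (cutLinks X) l ≡ lookup X (tail l) ∧ not (lookup X (head l))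
  lookup-cut X l = lookup∘tabulate (λ l → lookup X (tail l) ∧ not (lookup X (head l))) l

  cut-tail : ∀ {X l} → l ∈ cutLinks X → lookup X (tail l) ≡ true
  cut-tail {X} {l} l∈ with lookup X (tail l) | trans (sym (lookup-cut X l)) (∈⇒lookup l∈)
  ... | true | _ = refl

  cut-head : ∀ {X l} → l ∈ cutLinks X → lookup X (head l) ≡ false
  cut-head {X} {l} l∈ with lookup X (tail l) | lookup X (head l) | trans (sym (lookup-cut X l)) (∈⇒lookup l∈)
  ... | true | false | _ = refl

  cut-proper : ∀ {X l} → l ∈ cutLinks X → head l ≢ tail l
  cut-proper {X} l∈ eq with trans (sym (cut-head {X} l∈)) (trans (cong (lookup X) eq) (cut-tail {X} l∈))
  ... | ()

  cut-not-consecutive : ∀ {X e f} → e ∈ cutLinks X → f ∈ cutLinks X → ¬ Consecutive e f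
  cut-not-consecutive {X} e∈ f∈ (inj₁ eq)
    with trans (sym (cut-head {X} e∈)) (trans (cong (lookup X) eq) (cut-tail {X} f∈))
  ... | ()
  cut-not-consecutive {X} e∈ f∈ (inj₂ eq)
    with trans (sym (cut-head {X} f∈)) (trans (cong (lookup X) eq) (cut-tail {X} e∈))
  ... | ()

  cut-pair : ∀ {X e f} → e ∈ cutLinks X → f ∈ cutLinks X → FollowSRLG e f → SameTail e f → Pair e f
  cut-pair {X} e∈ f∈ fo t = proj₁ fo , fo , t , cut-proper {X} e∈ , cut-proper {X} f∈

  condition₁and₂-paired : Condition₁and₂ → Paired
  condition₁and₂-paired (only , two) = record
    { unique = λ { {e} {f} {g} pf@(e≢f , fo , t , _) (e≢g , go , t′ , _) → uniq (two (tail e) e f g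
        (refl , f , t , fo) (sym t , e , sym t , follow-sym fo) (sym t′ , e , sym t′ , follow-sym go)) e≢f e≢g }
    ; in-cut = λ {X} e∈ f∈ fo → case only _ _ fo of λ where
        (inj₁ co) → contradiction co (cut-not-consecutive {X} e∈ f∈)
        (inj₂ st) → cut-pair {X} e∈ f∈ fo st
    }
    where
    uniq : ∀ {e f g : Link} → e ≡ f ⊎ e ≡ g ⊎ f ≡ g → e ≢ f → e ≢ g → f ≡ g
    uniq (inj₁ e≡f)        e≢f e≢g = contradiction e≡f e≢f
    uniq (inj₂ (inj₁ e≡g)) e≢f e≢g = contradiction e≡g e≢g
    uniq (inj₂ (inj₂ f≡g)) e≢f e≢g = f≡g

  condition₂-paired : Condition₂ → Paired
  condition₂-paired (only , two) = condition₁and₂-paired ((λ e f fo → inj₂ (only e f fo)) , two)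

  condition₁-paired : Condition₁ → Paired
  condition₁-paired only = record
    { unique = λ { (_ , fo , t , he , hf) _ → case only _ _ fo of λ where
        (inj₁ eq) → contradiction (trans eq (sym t)) he
        (inj₂ eq) → contradiction (trans eq t) hf }
    ; in-cut = λ {X} e∈ f∈ fo → contradiction (only _ _ fo) (cut-not-consecutive {X} e∈ f∈)
    }

  follow? : ∀ e f → Dec (FollowSRLG e f)
  follow? e f = ¬? (e Finₚ.≟ f) ×-dec map′ find (λ (G , G∈ , p) → lose G∈ p) (any? (λ G → e ∈? G ×-dec f ∈? G) CGs)

  pair? : ∀ e f → Dec (Pair e f)
  pair? e f = ¬? (e Finₚ.≟ f) ×-dec follow? e f ×-dec tail e Finₚ.≟ tail f ×-dec
    ¬? (head e Finₚ.≟ tail e) ×-dec ¬? (head f Finₚ.≟ tail f)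

  partner? : ∀ e → Dec (∃ (Pair e))
  partner? e = Finₚ.any? (pair? e)

  total-one : ∀ e → total ⁅ e ⁆ ≡ w e
  total-one e = trans (sum-one _ e λ j j≢e → cong (λ b → if b then w j else 0ℚ)
    (∉⇒lookup (j≢e ∘ x∈⁅y⁆⇒x≡y e)))
    (cong (λ b → if b then w e else 0ℚ) (∈⇒lookup (x∈⁅x⁆ e)))

  joint-one : ∀ e → joint ⁅ e ⁆ ≡ w e
  joint-one e = trans (cong (λ n → if does (1 <? n) then ρ ⁅ e ⁆ ℚ.* total ⁅ e ⁆ else total ⁅ e ⁆) (∣⁅x⁆∣≡1 e)) (total-one e)

  both : Link → Link → Subset links
  both e f = ⁅ e ⁆ ∪ ⁅ f ⁆

  both⁻ : ∀ {e f x} → x ∈ both e f → x ≡ e ⊎ x ≡ f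
  both⁻ {e} {f} x∈ with x∈p∪q⁻ ⁅ e ⁆ ⁅ f ⁆ x∈
  ... | inj₁ x∈e = inj₁ (x∈⁅y⁆⇒x≡y e x∈e)
  ... | inj₂ x∈f = inj₂ (x∈⁅y⁆⇒x≡y f x∈f)

  e∈both : ∀ {e f} → e ∈ both e f
  e∈both {e} = x∈p∪q⁺ (inj₁ (x∈⁅x⁆ e))

  f∈both : ∀ {e f} → f ∈ both e f
  f∈both {e} {f} = x∈p∪q⁺ (inj₂ (x∈⁅x⁆ f))

  total-both : ∀ {e f} → e ≢ f → total (both e f) ≡ w e ℚ.+ w f
  total-both {e} {f} e≢f = trans
    (sum-two _ e f e≢f λ k k≢e k≢f → cong (λ b → if b then w k else 0ℚ)
      (∉⇒lookup λ k∈ → case both⁻ k∈ of λ where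
        (inj₁ k≡e) → k≢e k≡e
        (inj₂ k≡f) → k≢f k≡f))
    (cong₂ ℚ._+_ (cong (λ b → if b then w e else 0ℚ) (∈⇒lookup {x = e} {p = both e f} (e∈both {e} {f})))
      (cong (λ b → if b then w f else 0ℚ) (∈⇒lookup {x = f} {p = both e f} (f∈both {e} {f}))))

  one⊂both : ∀ {e f} → e ≢ f → ⁅ f ⁆ ⊂ both e f
  one⊂both {e} {f} e≢f = (λ x∈ → x∈p∪q⁺ (inj₂ x∈)) , e , e∈both , e≢f ∘ x∈⁅y⁆⇒x≡y f

  1<∣both∣ : ∀ {e f} → e ≢ f → 1 < ∣ both e f ∣
  1<∣both∣ {e} {f} e≢f = subst (_< ∣ both e f ∣) (∣⁅x⁆∣≡1 f) (p⊂q⇒∣p∣<∣q∣ (one⊂both e≢f))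

  module WithPaired (paired : Paired) where

    open Paired paired

    partner : Link → Link
    partner e with partner? e
    ... | yes (f , _) = f
    ... | no _        = e

    saved : Link → ℚ
    saved e with partner? e
    ... | yes (f , _) = w e ℚ.+ w f ℚ.- joint (both e f)
    ... | no _        = 0ℚ

    partner-pair : ∀ {e f} → Pair e f → partner e ≡ f
    partner-pair {e} pf with partner? e
    ... | yes (g , pg) = unique pg pf
    ... | no ¬p        = contradiction (_ , pf) ¬p

    saved-pair : ∀ {e f} → Pair e f → saved e ≡ w e ℚ.+ w f ℚ.- joint (both e f)
    saved-pair {e} pf with partner? e
    ... | yes (g , pg) = cong (λ f → w e ℚ.+ w f ℚ.- joint (both e f)) (unique pg pf)
    ... | no ¬p        = contradiction (_ , pf) ¬p

    partner-none : ∀ {e} → ¬ ∃ (Pair e) → partner e ≡ e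
    partner-none {e} ¬p with partner? e
    ... | yes p = contradiction p ¬p
    ... | no _  = refl

    saved-none : ∀ {e} → ¬ ∃ (Pair e) → saved e ≡ 0ℚ
    saved-none {e} ¬p with partner? e
    ... | yes p = contradiction p ¬p
    ... | no _  = refl

    saved-sym : ∀ {e f} → Pair e f → saved f ≡ saved e
    saved-sym {e} {f} pf = trans (saved-pair (pair-sym pf)) (trans
      (cong₂ ℚ._-_ (ℚₚ.+-comm (w f) (w e)) (cong joint (∪-comm ⁅ f ⁆ ⁅ e ⁆))) (sym (saved-pair pf)))

    -- The model for two links, compared with the choice of `f` alone. The lower bound keeps the
    -- saving below `w e`, the upper one makes it positive.
    srlg-bounds : ∀ {e f} → Pair e f → w f ℚ.< joint (both e f) × joint (both e f) ℚ.< w e ℚ.+ w f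
    srlg-bounds {e} {f} (e≢f , (_ , G , G∈ , e∈ , f∈) , _)
      with srlgLike G∈ (both e f) sub (1<∣both∣ e≢f)
      where
      sub : both e f ⊆ G
      sub x∈ with both⁻ x∈
      ... | inj₁ refl = e∈
      ... | inj₂ refl = f∈
    ... | above , below = subst (ℚ._< joint (both e f)) (total-one f) (above ⁅ f ⁆ (one⊂both e≢f)) ,
      subst (joint (both e f) ℚ.<_) (total-both e≢f) below

    φ : Subset links → Link → ℚ
    φ S l = contribution (w l) (saved l) (lookup S l) (lookup S (partner l))

    OnlyPairs : Subset links → Set
    OnlyPairs S = ∀ {e f} → e ∈ S → f ∈ S → FollowSRLG e f → Pair e f

    JointFormula : Subset links → Set
    JointFormula S = sum (φ S) ≡ joint S ℚ.+ joint S

    φ-outside : ∀ P l → l ∉ P → (∀ g → Pair l g → g ∉ P) → φ P l ≡ 0ℚ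
    φ-outside P l l∉ g∉ = cong₂ (contribution (w l) (saved l)) (∉⇒lookup l∉) (∉⇒lookup partner∉)
      where
      partner∉ : partner l ∉ P
      partner∉ with partner? l
      ... | yes (g , pg) = g∉ g pg
      ... | no _         = l∉

    private
      -- If one link of a pair is cut, its own term falls short of twice its cost by `c`, which the
      -- term of the uncut partner supplies. If both are cut, both terms fall short by `c`, as in
      -- `pairwise`, and the doubled saving is accounted for.
      twice : ∀ a c → (a ℚ.- c ℚ.+ (a ℚ.- c) ℚ.+ c) ℚ.+ (0ℚ ℚ.+ c) ≡ a ℚ.+ a
      twice = solve 2 (λ a c → (a :- c :+ (a :- c) :+ c) :+ (con 0ℚ :+ c) := a :+ a) refl
        where open +-*-Solver
      pairwise : ∀ a b j → let c = a ℚ.+ b ℚ.- j in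
        (a ℚ.- c ℚ.+ (a ℚ.- c) ℚ.+ c) ℚ.+ (b ℚ.- c ℚ.+ (b ℚ.- c) ℚ.+ c) ≡ j ℚ.+ j
      pairwise = solve 3 (λ a b j → let c = a :+ b :- j in
        (a :- c :+ (a :- c) :+ c) :+ (b :- c :+ (b :- c) :+ c) := j :+ j) refl
        where open +-*-Solver

    formula-alone : ∀ e → ¬ ∃ (Pair e) → JointFormula ⁅ e ⁆
    formula-alone e ¬p = trans
      (sum-one (φ ⁅ e ⁆) e λ l l≢e → φ-outside ⁅ e ⁆ l (l≢e ∘ x∈⁅y⁆⇒x≡y e)
        λ g pg g∈ → ¬p (l , subst (λ x → Pair x l) (x∈⁅y⁆⇒x≡y e g∈) (pair-sym pg)))
      (trans (cong₂ (λ c k → contribution (w e) c k (lookup ⁅ e ⁆ (partner e))) (saved-none ¬p) (∈⇒lookup (x∈⁅x⁆ e)))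
        (trans (contribution-single (w e) true (lookup ⁅ e ⁆ (partner e)))
          (sym (cong₂ ℚ._+_ (joint-one e) (joint-one e)))))

    formula-one : ∀ e f → Pair e f → JointFormula ⁅ e ⁆
    formula-one e f pf = trans
      (sum-two (φ ⁅ e ⁆) e f (proj₁ pf) λ l l≢e l≢f → φ-outside ⁅ e ⁆ l (l≢e ∘ x∈⁅y⁆⇒x≡y e)
        λ g pg g∈ → l≢f (sym (unique pf (subst (λ x → Pair x l) (x∈⁅y⁆⇒x≡y e g∈) (pair-sym pg)))))
      (trans (cong₂ ℚ._+_
          (cong₂ (contribution (w e) (saved e)) (∈⇒lookup (x∈⁅x⁆ e))
            refl)
          (trans (cong (λ c → contribution (w f) c (lookup ⁅ e ⁆ f) (lookup ⁅ e ⁆ (partner f))) (saved-sym pf))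
            (cong₂ (contribution (w f) (saved e)) (∉⇒lookup {p = ⁅ e ⁆} (proj₁ pf ∘ sym ∘ x∈⁅y⁆⇒x≡y e))
            (trans (cong (lookup ⁅ e ⁆) (partner-pair (pair-sym pf))) (∈⇒lookup (x∈⁅x⁆ e))))))
        (trans (twice (w e) (saved e)) (sym (cong₂ ℚ._+_ (joint-one e) (joint-one e)))))

    formula-both : ∀ e f → Pair e f → JointFormula (both e f)
    formula-both e f pf = trans
      (sum-two (φ (both e f)) e f (proj₁ pf) λ l l≢e l≢f → φ-outside (both e f) l
        (λ l∈ → case both⁻ l∈ of λ where
          (inj₁ l≡e) → l≢e l≡e
          (inj₂ l≡f) → l≢f l≡f)
        λ g pg g∈ → case both⁻ g∈ of λ where
          (inj₁ refl) → l≢f (sym (unique pf (pair-sym pg)))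
          (inj₂ refl) → l≢e (sym (unique (pair-sym pf) (pair-sym pg))))
      (trans (cong₂ ℚ._+_
          (cong₂ (λ c k → contribution (w e) c k (lookup (both e f) (partner e))) (saved-pair pf) (∈⇒lookup {x = e} {p = both e f} (e∈both {e} {f})))
          (cong₂ (λ c k → contribution (w f) c k (lookup (both e f) (partner f)))
            (trans (saved-sym pf) (saved-pair pf)) (∈⇒lookup {x = f} {p = both e f} (f∈both {e} {f}))))
        (pairwise (w e) (w f) (joint (both e f))))

    -- P is a block of S: it contains the partners in S of its links.
    formula-step : ∀ S P → OnlyPairs S → P ⊆ S → (∀ {x y} → x ∈ P → Pair x y → y ∈ S → y ∈ P) →
      JointFormula P → (∀ R → R ⊆ S → (∀ {x} → x ∈ P → x ∉ R) → OnlyPairs R → JointFormula R) → JointFormula S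
    formula-step S P good P⊆S closed formulaP formulaR = begin
      sum (φ S)                                     ≡⟨ sum-cong-≗ additive ⟩
      sum (λ l → φ P l ℚ.+ φ R l)                   ≡⟨ ∑-distrib-+ (φ P) (φ R) ⟩
      sum (φ P) ℚ.+ sum (φ R)                       ≡⟨ cong₂ ℚ._+_ formulaP (formulaR R R⊆S P∌R goodR) ⟩
      (joint P ℚ.+ joint P) ℚ.+ (joint R ℚ.+ joint R) ≡⟨ interchange (joint P) (joint R) ⟩
      (joint P ℚ.+ joint R) ℚ.+ (joint P ℚ.+ joint R) ≡⟨ cong₂ ℚ._+_ joint-S joint-S ⟨
      joint S ℚ.+ joint S                           ∎
      where
      open ≡-Reasoning
      R : Subset links
      R = tabulate λ l → lookup S l ∧ not (lookup P l)
      lookup-R : ∀ l → lookup R l ≡ lookup S l ∧ not (lookup P l)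
      lookup-R = lookup∘tabulate _
      R⊆S : R ⊆ S
      R⊆S {l} l∈ with lookup S l in eq | trans (sym (lookup-R l)) (∈⇒lookup l∈)
      ... | true | _ = lookup⇒∈ eq
      P∌R : ∀ {x} → x ∈ P → x ∉ R
      P∌R {x} x∈P x∈R with lookup S x | lookup P x | ∈⇒lookup x∈P | trans (sym (lookup-R x)) (∈⇒lookup x∈R)
      ... | true | true | _ | ()
      S∌P⇒R : ∀ {x} → x ∈ P → ∀ {y} → Pair x y → y ∉ R
      S∌P⇒R x∈P pxy y∈R = P∌R (closed x∈P pxy (R⊆S y∈R)) y∈R
      goodR : OnlyPairs R
      goodR e∈ f∈ = good (R⊆S e∈) (R⊆S f∈)
      P∪R : ∀ l → lookup S l ≡ lookup P l ∨ lookup R l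
      P∪R l rewrite lookup-R l with lookup P l in eqP
      ... | true = ∈⇒lookup (P⊆S (lookup⇒∈ eqP))
      ... | false with lookup S l
      ...   | true  = refl
      ...   | false = refl
      -- A link of `P` that followed one of `R` would form a pair with it, and `closed` would put
      -- the latter into `P`; so `uncorrelated` applies.
      joint-S : joint S ≡ joint P ℚ.+ joint R
      joint-S = trans (cong joint (lookup-ext S (P ∪ R) λ l → trans (P∪R l) (sym (lookup-zipWith _∨_ l P R))))
        (uncorrelated P R λ e∈ f∈ →
          (λ { refl → P∌R e∈ f∈ }) , λ fo → S∌P⇒R e∈ (good (P⊆S e∈) (R⊆S f∈) fo) f∈)
      disjoint : ∀ l → lookup P l ∧ lookup R l ≡ false
      disjoint l with lookup P l in eqP
      ... | true  = ∉⇒lookup (P∌R (lookup⇒∈ eqP))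
      ... | false = refl
      separate : ∀ l → saved l ≡ 0ℚ ⊎ (lookup P l ≡ false × lookup P (partner l) ≡ false) ⊎
        (lookup R l ≡ false × lookup R (partner l) ≡ false)
      separate l with partner? l
      ... | no _ = inj₁ refl
      ... | yes (f , pf) with l ∈? P | f ∈? P
      ...   | yes l∈ | _      = inj₂ (inj₂ (∉⇒lookup (P∌R l∈) , ∉⇒lookup (S∌P⇒R l∈ pf)))
      ...   | no _   | yes f∈ = inj₂ (inj₂ (∉⇒lookup (S∌P⇒R f∈ (pair-sym pf)) , ∉⇒lookup (P∌R f∈)))
      ...   | no l∉  | no f∉  = inj₂ (inj₁ (∉⇒lookup l∉ , ∉⇒lookup f∉))
      additive : ∀ l → φ S l ≡ φ P l ℚ.+ φ R l
      additive l = trans (cong₂ (contribution (w l) (saved l)) (P∪R l) (P∪R (partner l)))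
        (contribution-+ (w l) (saved l) (lookup P l) (lookup P (partner l)) (lookup R l) (lookup R (partner l))
          (disjoint l) (separate l))
      interchange : ∀ a b → (a ℚ.+ a) ℚ.+ (b ℚ.+ b) ≡ (a ℚ.+ b) ℚ.+ (a ℚ.+ b)
      interchange = solve 2 (λ a b → (a :+ a) :+ (b :+ b) := (a :+ b) :+ (a :+ b)) refl
        where open +-*-Solver

    -- Induction on the size, splitting off some link together with its partner if that is in the
    -- set too. Uniqueness of partners makes the part split off a block.
    joint-formula-≤ : ∀ n S → ∣ S ∣ ≤ n → OnlyPairs S → JointFormula S
    joint-formula-≤ n S ∣S∣≤n good with nonempty? S
    ... | no empty = trans (sum-zero (φ S) λ l → φ-outside S l (λ l∈ → empty (l , l∈)) λ g _ g∈ → empty (g , g∈))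
      (sym (cong₂ ℚ._+_ joint-0 joint-0))
      where
      total-0 : total S ≡ 0ℚ
      total-0 = sum-zero _ λ l → cong (λ b → if b then w l else 0ℚ) (∉⇒lookup λ l∈ → empty (l , l∈))
      joint-0 : joint S ≡ 0ℚ
      joint-0 with does (1 <? ∣ S ∣)
      ... | true  = trans (cong (ρ S ℚ.*_) total-0) (ℚₚ.*-zeroʳ (ρ S))
      ... | false = total-0
    joint-formula-≤ zero S ∣S∣≤0 good | yes (e , e∈) = contradiction
      (≤-trans (≤-reflexive (sym (∣⁅x⁆∣≡1 e))) (≤-trans (p⊆q⇒∣p∣≤∣q∣ (λ x∈ → subst (_∈ S) (sym (x∈⁅y⁆⇒x≡y e x∈)) e∈)) ∣S∣≤0))
      λ ()
    joint-formula-≤ (suc n) S ∣S∣≤n good | yes (e , e∈) = by-partner (partner? e)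
      where
      smaller : ∀ {P} → e ∈ P → ∀ R → R ⊆ S → (∀ {x} → x ∈ P → x ∉ R) → OnlyPairs R → JointFormula R
      smaller e∈P R R⊆S P∌R goodR = joint-formula-≤ n R
        (s≤s⁻¹ (≤-trans (p⊂q⇒∣p∣<∣q∣ (R⊆S , e , e∈ , P∌R e∈P)) ∣S∣≤n)) goodR
      one⊆ : ⁅ e ⁆ ⊆ S
      one⊆ x∈ = subst (_∈ S) (sym (x∈⁅y⁆⇒x≡y e x∈)) e∈
      by-partner : Dec (∃ (Pair e)) → JointFormula S
      by-partner (no ¬p) = formula-step S ⁅ e ⁆ good one⊆
        (λ {x} {y} x∈ pxy _ → contradiction (y , subst (λ z → Pair z y) (x∈⁅y⁆⇒x≡y e x∈) pxy) ¬p)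
        (formula-alone e ¬p) (smaller (x∈⁅x⁆ e))
      by-partner (yes (f , pf)) with f ∈? S
      ... | no f∉ = formula-step S ⁅ e ⁆ good one⊆
        (λ {x} {y} x∈ pxy y∈ → contradiction
          (subst (_∈ S) (sym (unique pf (subst (λ z → Pair z y) (x∈⁅y⁆⇒x≡y e x∈) pxy))) y∈) f∉)
        (formula-one e f pf) (smaller (x∈⁅x⁆ e))
      ... | yes f∈ = formula-step S (both e f) good
        (λ x∈ → case both⁻ x∈ of λ where
          (inj₁ refl) → e∈
          (inj₂ refl) → f∈)
        (λ x∈ pxy _ → case both⁻ x∈ of λ where
          (inj₁ refl) → subst (_∈ both e f) (unique pf pxy) f∈both
          (inj₂ refl) → subst (_∈ both e f) (unique (pair-sym pf) pxy) e∈both)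
        (formula-both e f pf) (smaller e∈both)

    joint-formula : ∀ X → JointFormula (cutLinks X)
    joint-formula X = joint-formula-≤ ∣ cutLinks X ∣ (cutLinks X) ≤-refl (in-cut {X})

-- The encoded instance

entry-tabulate : ∀ {n} {A B : Set} (d : B) (f : A → B) (g : Fin n → A) i →
  entry d (List.map f (List.tabulate g)) (toℕ i) ≡ f (g i)
entry-tabulate d f g zero    = refl
entry-tabulate d f g (suc i) = entry-tabulate d f (g ∘ suc) i

entry-map : ∀ {A B : Set} (d : B) (f : A → B) xs (i : Fin (length xs)) →
  entry d (List.map f xs) (toℕ i) ≡ f (List.lookup xs i)
entry-map d f (x ∷ xs) zero    = refl
entry-map d f (x ∷ xs) (suc i) = entry-map d f xs i

entry-++ˡ : ∀ {A : Set} (d : A) xs ys i → i < length xs → entry d (xs ++ ys) i ≡ entry d xs i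
entry-++ˡ d (x ∷ xs) ys zero    _  = refl
entry-++ˡ d (x ∷ xs) ys (suc i) i< = entry-++ˡ d xs ys i (s≤s⁻¹ i<)

entry-++ʳ : ∀ {A : Set} (d : A) xs ys i → entry d (xs ++ ys) (length xs + i) ≡ entry d ys i
entry-++ʳ d []       ys i = refl
entry-++ʳ d (x ∷ xs) ys i = entry-++ʳ d xs ys i

entry-concatMap : ∀ {A B : Set} (d : B) (f : A → List B) n → (∀ x → length (f x) ≡ n) →
  ∀ xs (j : Fin (length xs)) i → i < n →
  entry d (concatMap f xs) (toℕ j * n + i) ≡ entry d (f (List.lookup xs j)) i
entry-concatMap d f n len (x ∷ xs) zero    i i< =
  entry-++ˡ d (f x) (concatMap f xs) i (subst (i <_) (sym (len x)) i<)
entry-concatMap d f n len (x ∷ xs) (suc j) i i< = trans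
  (cong (entry d (concatMap f (x ∷ xs))) (trans (+-assoc n (toℕ j * n) i) (cong (_+ (toℕ j * n + i)) (sym (len x)))))
  (trans (entry-++ʳ d (f x) (concatMap f xs) (toℕ j * n + i)) (entry-concatMap d f n len xs j i i<))

sumTo-head : ∀ n f → sumTo (suc n) f ≡ f 0 + sumTo n (f ∘ suc)
sumTo-head zero    f = sym (+-identityʳ (f 0))
sumTo-head (suc n) f = trans (cong (_+ f (suc n)) (sumTo-head n f)) (+-assoc (f 0) _ _)

sumTo-card : ∀ {n} (S : Subset n) f → (∀ i → f (toℕ i) ≡ ind (lookup S i)) → sumTo n f ≡ ∣ S ∣
sumTo-card {zero}  Vec.[]          f eq = refl
sumTo-card {suc n} (true Vec.∷ S)  f eq =
  trans (sumTo-head n f) (cong₂ _+_ (eq zero) (sumTo-card S (f ∘ suc) (eq ∘ suc)))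
sumTo-card {suc n} (false Vec.∷ S) f eq =
  trans (sumTo-head n f) (cong₂ _+_ (eq zero) (sumTo-card S (f ∘ suc) (eq ∘ suc)))

∈subsetsOf⁺ : ∀ {m} {S G : Subset m} → S ⊆ G → S ∈ₗ subsetsOf G
∈subsetsOf⁺ {S = Vec.[]}           {Vec.[]}           S⊆G = here refl
∈subsetsOf⁺ {S = outside Vec.∷ S} {outside Vec.∷ G} S⊆G = ∈-map⁺ _ (∈subsetsOf⁺ (drop-∷-⊆ S⊆G))
∈subsetsOf⁺ {S = inside  Vec.∷ S} {outside Vec.∷ G} S⊆G with S⊆G Vec.here
... | ()
∈subsetsOf⁺ {S = outside Vec.∷ S} {inside  Vec.∷ G} S⊆G = ∈-++⁺ˡ (∈-map⁺ _ (∈subsetsOf⁺ (drop-∷-⊆ S⊆G)))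
∈subsetsOf⁺ {S = inside  Vec.∷ S} {inside  Vec.∷ G} S⊆G =
  ∈-++⁺ʳ (List.map (outside Vec.∷_) (subsetsOf G)) (∈-map⁺ _ (∈subsetsOf⁺ (drop-∷-⊆ S⊆G)))

∈subsetsOf⁻ : ∀ {m} (S G : Subset m) → S ∈ₗ subsetsOf G → S ⊆ G
∈subsetsOf⁻ Vec.[] Vec.[] _ ()
∈subsetsOf⁻ S (outside Vec.∷ G) S∈ with ∈-map⁻ (outside Vec.∷_) S∈
... | S′ , S′∈ , refl = out⊆ (∈subsetsOf⁻ S′ G S′∈)
∈subsetsOf⁻ S (inside Vec.∷ G) S∈ with ∈-++⁻ (List.map (outside Vec.∷_) (subsetsOf G)) S∈
... | inj₁ S∈ˡ with ∈-map⁻ (outside Vec.∷_) S∈ˡ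
...   | S′ , S′∈ , refl = out⊆ (∈subsetsOf⁻ S′ G S′∈)
∈subsetsOf⁻ S (inside Vec.∷ G) S∈ | inj₂ S∈ʳ with ∈-map⁻ (inside Vec.∷_) S∈ʳ
...   | S′ , S′∈ , refl = in⊆in (∈subsetsOf⁻ S′ G S′∈)

apart-0⁻ : ∀ {m n} → apart m n ≡ 0 → m ≡ n
apart-0⁻ = distance-0

not-apart : ∀ {m n} → 1 ∸ apart m n ≡ 0 → m ≢ n
not-apart {m} eq refl rewrite n∸n≡0 m with eq
... | ()

apart-≢ : ∀ {m n} → m ≢ n → 1 ∸ apart m n ≡ 0
apart-≢ {m} {n} m≢n with apart m n in eq
... | zero  = contradiction (distance-0 eq) m≢n
... | suc k = 0∸n≡0 k

ind-true : ∀ {b} → 1 ∸ ind b ≡ 0 → b ≡ true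
ind-true {true} _ = refl

module Encoded (I : MC-NSRLG-Instance) where

  open MC-NSRLG-Instance I
  open Encoding I
  open Pairs net

  σ₀ : Memory
  σ₀ = load encodeInstance

  open Build σ₀ using (tl; hd; num; den; rnum; rden; L; GS; member; card; Unpaired; unpaired-cong)

  tl≡ : ∀ l → tl (toℕ l) ≡ toℕ (tail l)
  tl≡ = entry-tabulate 0 _ _

  hd≡ : ∀ l → hd (toℕ l) ≡ toℕ (head l)
  hd≡ = entry-tabulate 0 _ _

  num≡ : ∀ l → num (toℕ l) ≡ abs (↥ w l)
  num≡ = entry-tabulate 0 _ _

  den≡ : ∀ l → den (toℕ l) ≡ ↧ₙ w l
  den≡ = entry-tabulate 0 _ _

  grouped : Fin GS → Subset links
  grouped = List.lookup groupedSets

  rnum≡ : ∀ j → rnum (toℕ j) ≡ abs (↥ ρ (grouped j))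
  rnum≡ = entry-map 0 _ groupedSets

  rden≡ : ∀ j → rden (toℕ j) ≡ ↧ₙ ρ (grouped j)
  rden≡ = entry-map 0 _ groupedSets

  length-toList : ∀ {m} (S : Subset m) → length (Vec.toList S) ≡ m
  length-toList Vec.[]      = refl
  length-toList (b Vec.∷ S) = cong suc (length-toList S)

  entry-indicator : ∀ {m} (S : Subset m) i → entry 0 (indicator S) (toℕ i) ≡ ind (lookup S i)
  entry-indicator (b Vec.∷ S) zero    = refl
  entry-indicator (b Vec.∷ S) (suc i) = entry-indicator S i

  member≡ : ∀ j l → member (toℕ j) (toℕ l) ≡ ind (lookup (grouped j) l)
  member≡ j l = trans
    (entry-concatMap 0 indicator links (λ S → trans (Listₚ.length-map _ (Vec.toList S)) (length-toList S))
      groupedSets j (toℕ l) (Finₚ.toℕ<n l))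
    (entry-indicator (grouped j) l)

  card≡ : ∀ j → card (toℕ j) ≡ ∣ grouped j ∣
  card≡ j = sumTo-card (grouped j) (member (toℕ j)) (member≡ j)

  ∈groupedSets⁻ : ∀ {S} → S ∈ₗ groupedSets → ∃ λ G → G ∈ₗ CGs × S ⊆ G
  ∈groupedSets⁻ {S} S∈ with find (∈-concatMap⁻ (λ G → List.filter (λ S → 1 <? ∣ S ∣) (subsetsOf G)) {xs = CGs} S∈)
  ... | G , G∈ , S∈G = G , G∈ , ∈subsetsOf⁻ S G (proj₁ (∈-filter⁻ (λ S → 1 <? ∣ S ∣) {xs = subsetsOf G} S∈G))

  ∈groupedSets⁺ : ∀ {S G} → G ∈ₗ CGs → S ⊆ G → 1 < ∣ S ∣ → S ∈ₗ groupedSets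
  ∈groupedSets⁺ G∈ S⊆G 1<S = ∈-concatMap⁺ (λ G → List.filter (λ S → 1 <? ∣ S ∣) (subsetsOf G))
    (lose G∈ (∈-filter⁺ (λ S → 1 <? ∣ S ∣) (∈subsetsOf⁺ S⊆G) 1<S))

  ∣both∣≡2 : ∀ {e f} → e ≢ f → ∣ both e f ∣ ≡ 2
  ∣both∣≡2 {e} {f} e≢f = ≤-antisym (upper e f) (1<∣both∣ e≢f)
    where
    upper : ∀ {n} (e f : Fin n) → ∣ ⁅ e ⁆ ∪ ⁅ f ⁆ ∣ ≤ 2
    upper e f = ≤-trans (∣∪∣≤ ⁅ e ⁆ ⁅ f ⁆) (≤-reflexive (cong₂ _+_ (∣⁅x⁆∣≡1 e) (∣⁅x⁆∣≡1 f)))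
      where
      ∣∪∣≤ : ∀ {n} (p q : Subset n) → ∣ p ∪ q ∣ ≤ ∣ p ∣ + ∣ q ∣
      ∣∪∣≤ Vec.[] Vec.[] = z≤n
      ∣∪∣≤ (true  Vec.∷ p) (true  Vec.∷ q) = s≤s (≤-trans (∣∪∣≤ p q) (+-monoʳ-≤ ∣ p ∣ (n≤1+n ∣ q ∣)))
      ∣∪∣≤ (true  Vec.∷ p) (false Vec.∷ q) = s≤s (∣∪∣≤ p q)
      ∣∪∣≤ (false Vec.∷ p) (true  Vec.∷ q) = ≤-trans (s≤s (∣∪∣≤ p q)) (≤-reflexive (sym (+-suc ∣ p ∣ ∣ q ∣)))
      ∣∪∣≤ (false Vec.∷ p) (false Vec.∷ q) = ∣∪∣≤ p q

  two-elements : ∀ {S e f} → e ≢ f → e ∈ S → f ∈ S → ∣ S ∣ ≡ 2 → S ≡ both e f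
  two-elements {S} {e} {f} e≢f e∈ f∈ ∣S∣≡2 = lookup-ext S (both e f) same
    where
    sub : both e f ⊆ S
    sub x∈ with both⁻ x∈
    ... | inj₁ refl = e∈
    ... | inj₂ refl = f∈
    same : ∀ i → lookup S i ≡ lookup (both e f) i
    same i with lookup (both e f) i in eqb | lookup S i in eqS
    ... | true  | true  = refl
    ... | false | false = refl
    ... | true  | false = contradiction (sub (lookup⇒∈ eqb)) (lookup⇒∉ eqS)
    ... | false | true  = contradiction
      (subst₂ _<_ (∣both∣≡2 e≢f) ∣S∣≡2 (p⊂q⇒∣p∣<∣q∣ (sub , i , lookup⇒∈ eqS , lookup⇒∉ eqb))) (<-irrefl refl)

  unpaired≡ : ∀ j e f → Unpaired (toℕ j) (toℕ e) (toℕ f) ≡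
    apart ∣ grouped j ∣ 2 + (1 ∸ apart (toℕ e) (toℕ f)) + (1 ∸ ind (lookup (grouped j) e)) +
    (1 ∸ ind (lookup (grouped j) f)) + apart (toℕ (tail e)) (toℕ (tail f)) +
    (1 ∸ apart (toℕ (head e)) (toℕ (tail e))) + (1 ∸ apart (toℕ (head f)) (toℕ (tail f)))
  unpaired≡ j e f = unpaired-cong {b = toℕ e} {toℕ e} {toℕ f} {toℕ f} (card≡ j) refl refl
    (member≡ j e) (member≡ j f) (tl≡ e) (tl≡ f) (hd≡ e) (hd≡ f)

  -- A sum of natural numbers vanishes only if each of its seven terms does. That the links follow
  -- the model comes from the listing: every listed set lies in a group.
  unpaired⇒pair : ∀ j e f → Unpaired (toℕ j) (toℕ e) (toℕ f) ≡ 0 → Pair e f × grouped j ≡ both e f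
  unpaired⇒pair j e f un with trans (sym (unpaired≡ j e f)) un
  ... | eq₆ with m+n≡0⇒m≡0 _ eq₆
  ... | eq₅ with m+n≡0⇒m≡0 _ eq₅
  ... | eq₄ with m+n≡0⇒m≡0 _ eq₄
  ... | eq₃ with m+n≡0⇒m≡0 _ eq₃
  ... | eq₂ with m+n≡0⇒m≡0 _ eq₂
  ... | eq₁ = result (∈groupedSets⁻ (∈-lookup j))
    where
    a b c d : ℕ
    a = apart ∣ grouped j ∣ 2
    e≢f : e ≢ f
    e≢f refl = not-apart {toℕ e} {toℕ e} (m+n≡0⇒n≡0 (apart ∣ grouped j ∣ 2) eq₁) refl
    b = a + (1 ∸ apart (toℕ e) (toℕ f))
    e∈ : e ∈ grouped j
    e∈ = lookup⇒∈ (ind-true (m+n≡0⇒n≡0 b eq₂))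
    c = b + (1 ∸ ind (lookup (grouped j) e))
    f∈ : f ∈ grouped j
    f∈ = lookup⇒∈ (ind-true (m+n≡0⇒n≡0 c eq₃))
    d = c + (1 ∸ ind (lookup (grouped j) f))
    tails : tail e ≡ tail f
    tails = Finₚ.toℕ-injective (apart-0⁻ (m+n≡0⇒n≡0 d eq₄))
    he : head e ≢ tail e
    he eq = not-apart (m+n≡0⇒n≡0 (d + apart (toℕ (tail e)) (toℕ (tail f))) eq₅) (cong toℕ eq)
    hf : head f ≢ tail f
    hf eq = not-apart (m+n≡0⇒n≡0 (d + apart (toℕ (tail e)) (toℕ (tail f)) + (1 ∸ apart (toℕ (head e)) (toℕ (tail e)))) eq₆) (cong toℕ eq)
    result : (∃ λ G → G ∈ₗ CGs × grouped j ⊆ G) → Pair e f × grouped j ≡ both e f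
    result (G , G∈ , sub) = (e≢f , (e≢f , G , G∈ , sub e∈ , sub f∈) , tails , he , hf) ,
      two-elements e≢f e∈ f∈ (apart-0⁻ (m+n≡0⇒m≡0 a eq₁))

  -- The input lists all subsets of at least two links of each group, so the two links of a pair
  -- occur as a set of their own, with their coefficient.
  pair⇒unpaired : ∀ e f → Pair e f → Σ (Fin GS) λ j → Unpaired (toℕ j) (toℕ e) (toℕ f) ≡ 0
  pair⇒unpaired e f (e≢f , (_ , G , G∈ , e∈ , f∈) , t , he , hf) = j , trans (unpaired≡ j e f)
    (zeros (distance-refl (trans (cong ∣_∣ S≡) (∣both∣≡2 e≢f))) (apart-≢ (e≢f ∘ Finₚ.toℕ-injective))
      (cong (λ b → 1 ∸ ind b) (trans (cong (λ S → lookup S e) S≡) (∈⇒lookup {x = e} {p = both e f} (e∈both {e} {f}))))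
      (cong (λ b → 1 ∸ ind b) (trans (cong (λ S → lookup S f) S≡) (∈⇒lookup {x = f} {p = both e f} (f∈both {e} {f}))))
      (distance-refl (cong toℕ t)) (apart-≢ (he ∘ Finₚ.toℕ-injective)) (apart-≢ (hf ∘ Finₚ.toℕ-injective)))
    where
    sub : both e f ⊆ G
    sub x∈ with both⁻ x∈
    ... | inj₁ refl = e∈
    ... | inj₂ refl = f∈
    S∈ : both e f ∈ₗ groupedSets
    S∈ = ∈groupedSets⁺ G∈ sub (1<∣both∣ e≢f)
    j : Fin GS
    j = Any.index S∈
    S≡ : grouped j ≡ both e f
    S≡ = sym (lookup-index S∈)
    zeros : ∀ {a b c d e f g} → a ≡ 0 → b ≡ 0 → c ≡ 0 → d ≡ 0 → e ≡ 0 → f ≡ 0 → g ≡ 0 →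
      a + b + c + d + e + f + g ≡ 0
    zeros refl refl refl refl refl refl refl = refl

-- Natural numbers as rationals

ι : ℕ → ℚ
ι zero    = 0ℚ
ι (suc n) = 1ℚ ℚ.+ ι n

ι-+ : ∀ m n → ι (m + n) ≡ ι m ℚ.+ ι n
ι-+ zero    n = sym (ℚₚ.+-identityˡ (ι n))
ι-+ (suc m) n = trans (cong (1ℚ ℚ.+_) (ι-+ m n)) (sym (ℚₚ.+-assoc 1ℚ (ι m) (ι n)))

ι-* : ∀ m n → ι (m * n) ≡ ι m ℚ.* ι n
ι-* zero    n = sym (ℚₚ.*-zeroˡ (ι n))
ι-* (suc m) n = trans (ι-+ n (m * n)) (trans
  (cong₂ ℚ._+_ (sym (ℚₚ.*-identityˡ (ι n))) (ι-* m n)) (sym (ℚₚ.*-distribʳ-+ (ι n) 1ℚ (ι m))))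

0≤ι : ∀ n → 0ℚ ℚ.≤ ι n
0≤ι zero    = ℚₚ.≤-refl
0≤ι (suc n) = ℚₚ.≤-trans (ℚₚ.≤-reflexive (sym (ℚₚ.+-identityˡ 0ℚ)))
  (ℚₚ.+-mono-≤ (ℚₚ.nonNegative⁻¹ 1ℚ) (0≤ι n))

ι-mono : ∀ {m n} → m ≤ n → ι m ℚ.≤ ι n
ι-mono {n = n} z≤n = 0≤ι n
ι-mono (s≤s m≤n)   = ℚₚ.+-monoʳ-≤ 1ℚ (ι-mono m≤n)

0<ι : ∀ {n} → 0 < n → 0ℚ ℚ.< ι n
0<ι 0<n = ℚₚ.<-≤-trans (ℚₚ.<-≤-trans (ℚₚ.positive⁻¹ 1ℚ) (ℚₚ.≤-reflexive (sym (ℚₚ.+-identityʳ 1ℚ)))) (ι-mono 0<n)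

ι-cancel-≤ : ∀ {m n} → ι m ℚ.≤ ι n → m ≤ n
ι-cancel-≤ {m} {n} le with m ≤? n
... | yes m≤n = m≤n
... | no m≰n  = contradiction (ℚₚ.<-≤-trans strict le) (ℚₚ.<-irrefl refl)
  where
  strict : ι n ℚ.< ι m
  strict = ℚₚ.<-≤-trans (ℚₚ.<-respˡ-≡ (ℚₚ.+-identityˡ (ι n)) (ℚₚ.+-monoˡ-< (ι n) (ℚₚ.positive⁻¹ 1ℚ))) (ι-mono (≰⇒> m≰n))

ι-∸ : ∀ {m n} → n ≤ m → ι (m ∸ n) ≡ ι m ℚ.- ι n
ι-∸ {m} {n} n≤m = trans (lemma (ι (m ∸ n)) (ι n))
  (cong (ℚ._- ι n) (trans (sym (ι-+ (m ∸ n) n)) (cong ι (m∸n+n≡m n≤m))))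
  where
  open +-*-Solver
  lemma : ∀ a b → a ≡ a ℚ.+ b ℚ.- b
  lemma = solve 2 (λ a b → a := a :+ b :- b) refl

toℚᵘ-ι : ∀ n → toℚᵘ (ι n) ℚᵘ.≃ ℚᵘ.mkℚᵘ (pos n) 0
toℚᵘ-ι zero    = ℚᵘₚ.≃-refl
toℚᵘ-ι (suc n) = ℚᵘₚ.≃-trans (ℚₚ.toℚᵘ-homo-+ 1ℚ (ι n))
  (ℚᵘₚ.≃-trans (ℚᵘₚ.+-congʳ (toℚᵘ 1ℚ) (toℚᵘ-ι n))
    (ℚᵘ.*≡* (trans (ℤₚ.*-identityʳ _) (trans (cong (λ z → pos 1 ℤ.+ z) (ℤₚ.*-identityʳ (pos n))) (sym (ℤₚ.*-identityʳ (pos (suc n))))))))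

-- Numerators are encoded by their absolute values; for nonnegative rationals no sign is lost.
numerator-ι : ∀ q → 0ℚ ℚ.≤ q → ι (abs (↥ q)) ≡ q ℚ.* ι (↧ₙ q)
numerator-ι q@(mkℚ (pos n) d-1 _) 0≤q = ℚₚ.toℚᵘ-injective (ℚᵘₚ.≃-trans (toℚᵘ-ι n)
  (ℚᵘₚ.≃-sym (ℚᵘₚ.≃-trans (ℚₚ.toℚᵘ-homo-* q (ι (suc d-1))) (ℚᵘₚ.≃-trans
    (ℚᵘₚ.*-congˡ {toℚᵘ q} (toℚᵘ-ι (suc d-1)))
    (ℚᵘ.*≡* (trans (ℤₚ.*-identityʳ _) (cong (λ z → pos n ℤ.* pos z) (sym (*-identityʳ (suc d-1))))))))))
numerator-ι (mkℚ ℤ.-[1+ n ] d-1 _) (ℚ.*≤* ())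

prodTo-agree : ∀ n {f h} → (∀ l → l < n → f l ≡ h l) → prodTo n f ≡ prodTo n h
prodTo-agree zero    eq = refl
prodTo-agree (suc n) eq = cong₂ _*_ (prodTo-agree n λ l l< → eq l (m<n⇒m<1+n l<)) (eq n ≤-refl)

prodTo-positive : ∀ n f → (∀ l → l < n → 0 < f l) → 0 < prodTo n f
prodTo-positive zero    f f> = s≤s z≤n
prodTo-positive (suc n) f f> =
  *-mono-≤ {1} {prodTo n f} {1} (prodTo-positive n f λ l l< → f> l (m<n⇒m<1+n l<)) (f> n ≤-refl)

prodTo-select : ∀ n f h e q → e < n → (∀ l → l ≢ e → h l ≡ f l) → ι (h e) ≡ q ℚ.* ι (f e) →
  ι (prodTo n h) ≡ q ℚ.* ι (prodTo n f)
prodTo-select (suc n) f h e q e< off at with e ≟ n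
... | yes refl = trans (ι-* (prodTo n h) (h n)) (trans
  (cong₂ ℚ._*_ (cong ι (prodTo-agree n λ l l< → off l (<⇒≢ l<))) at)
  (trans (lemma (ι (prodTo n f)) q (ι (f n))) (cong (q ℚ.*_) (sym (ι-* (prodTo n f) (f n))))))
  where
  open +-*-Solver
  lemma : ∀ a q b → a ℚ.* (q ℚ.* b) ≡ q ℚ.* (a ℚ.* b)
  lemma = solve 3 (λ a q b → a :* (q :* b) := q :* (a :* b)) refl
... | no e≢n = trans (ι-* (prodTo n h) (h n)) (trans
  (cong₂ ℚ._*_ (prodTo-select n f h e q (≤∧≢⇒< (s≤s⁻¹ e<) e≢n) off at) (cong ι (off n (e≢n ∘ sym))))
  (trans (ℚₚ.*-assoc q _ _) (cong (q ℚ.*_) (sym (ι-* (prodTo n f) (f n))))))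

apart-pos : ∀ {m n} → m ≢ n → apart m n ≢ 0
apart-pos m≢n eq = m≢n (distance-0 eq)

-- The scaled capacities as costs of the network

module Values (I : MC-NSRLG-Instance) (paired : Pairs.Paired (MC-NSRLG-Instance.net I)) where

  open MC-NSRLG-Instance I
  open Encoding I
  open Pairs net
  open WithPaired paired
  open Encoded I
  open Build σ₀ hiding (nodes)
  open Lower σ₀

  M : ℕ
  M = prodTo L den * prodTo GS rden

  M-positive : 0 < M
  M-positive = *-mono-≤ {1} {prodTo L den} {1}
    (prodTo-positive L den λ l l< → subst (λ k → 0 < den k) (Finₚ.toℕ-fromℕ< l<)
      (subst (0 <_) (sym (den≡ (fromℕ< l<))) (s≤s z≤n)))
    (prodTo-positive GS rden λ j j< → subst (λ k → 0 < rden k) (Finₚ.toℕ-fromℕ< j<)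
      (subst (0 <_) (sym (rden≡ (fromℕ< j<))) (s≤s z≤n)))

  ιD ιR : ℚ
  ιD = ι (prodTo L den)
  ιR = ι (prodTo GS rden)

  select-w : ∀ l → ι (prodTo L (selected (toℕ l))) ≡ w l ℚ.* ιD
  select-w l = prodTo-select L den (selected (toℕ l)) (toℕ l) (w l) (Finₚ.toℕ<n l)
    (λ k k≢ → branch-≢0 (apart-pos k≢))
    (trans (cong ι (branch-≡0 (distance-refl {toℕ l} refl)))
      (trans (cong ι (num≡ l)) (trans (numerator-ι (w l) (w-nonneg l)) (cong (λ d → w l ℚ.* ι d) (sym (den≡ l))))))

  weight≡ : ∀ l → ι (weight (toℕ l)) ≡ w l ℚ.* ι M
  weight≡ l = trans (ι-* (prodTo L (selected (toℕ l))) (prodTo GS rden)) (trans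
    (cong (ℚ._* ιR) (select-w l)) (trans (ℚₚ.*-assoc (w l) ιD ιR)
      (cong (w l ℚ.*_) (sym (ι-* (prodTo L den) (prodTo GS rden))))))

  joint-both : ∀ {e f} → e ≢ f → joint (both e f) ≡ ρ (both e f) ℚ.* (w e ℚ.+ w f)
  joint-both {e} {f} e≢f = trans
    (cong (λ n → if does (1 <? n) then ρ (both e f) ℚ.* total (both e f) else total (both e f)) (∣both∣≡2 e≢f))
    (cong (ρ (both e f) ℚ.*_) (total-both e≢f))

  select-ρ : ∀ j → 1 < ∣ grouped j ∣ → ι (prodTo GS (selectedρ (suc (toℕ j)))) ≡ ρ (grouped j) ℚ.* ιR
  select-ρ j 1< = prodTo-select GS rden (selectedρ (suc (toℕ j))) (toℕ j) (ρ (grouped j)) (Finₚ.toℕ<n j)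
    (λ k k≢ → branch-≢0 (apart-pos λ eq → k≢ (suc-injective (trans (+-comm 1 k) eq))))
    (trans (cong ι (branch-≡0 (distance-refl (+-comm (toℕ j) 1))))
      (trans (cong ι (rnum≡ j)) (trans (numerator-ι (ρ (grouped j)) (ℚₚ.<⇒≤ (ρ-pos (grouped j) 1<)))
        (cong (λ d → ρ (grouped j) ℚ.* ι d) (sym (rden≡ j))))))

  pairWeight≡ : ∀ e f j → e ≢ f → grouped j ≡ both e f →
    ι (pairWeight (toℕ e) (toℕ f) (suc (toℕ j))) ≡ joint (both e f) ℚ.* ι M
  pairWeight≡ e f j e≢f gj = begin
    ι ((pe + pf) * pρ)                                   ≡⟨ ι-* (pe + pf) pρ ⟩
    ι (pe + pf) ℚ.* ι pρ                                 ≡⟨ cong₂ ℚ._*_ (trans (ι-+ pe pf) (cong₂ ℚ._+_ (select-w e) (select-w f)))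
                                                              (trans (select-ρ j (subst (λ S → 1 < ∣ S ∣) (sym gj) (1<∣both∣ e≢f)))
                                                                (cong (λ S → ρ S ℚ.* ιR) gj)) ⟩
    (w e ℚ.* ιD ℚ.+ w f ℚ.* ιD) ℚ.* (ρ (both e f) ℚ.* ιR) ≡⟨ lemma (w e) (w f) (ρ (both e f)) ιD ιR ⟩
    (ρ (both e f) ℚ.* (w e ℚ.+ w f)) ℚ.* (ιD ℚ.* ιR)     ≡⟨ cong₂ ℚ._*_ (joint-both e≢f) (ι-* (prodTo L den) (prodTo GS rden)) ⟨
    joint (both e f) ℚ.* ι M                             ∎
    where
    open ≡-Reasoning
    pe pf pρ : ℕ
    pe = prodTo L (selected (toℕ e))
    pf = prodTo L (selected (toℕ f))
    pρ = prodTo GS (selectedρ (suc (toℕ j)))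
    lemma : ∀ a b r d s → (a ℚ.* d ℚ.+ b ℚ.* d) ℚ.* (r ℚ.* s) ≡ (r ℚ.* (a ℚ.+ b)) ℚ.* (d ℚ.* s)
    lemma = solve 5 (λ a b r d s → (a :* d :+ b :* d) :* (r :* s) := (r :* (a :+ b)) :* (d :* s)) refl
      where open +-*-Solver

  instance
    M-nonNegative : ℚ.NonNegative (ι M)
    M-nonNegative = ℚ.nonNegative (0≤ι M)
    M-pos : ℚ.Positive (ι M)
    M-pos = ℚ.positive (0<ι M-positive)

  saving-pair : ∀ {e f} j → Pair e f → grouped j ≡ both e f →
    ι (saving (toℕ e) (toℕ f) (suc (toℕ j))) ≡ saved e ℚ.* ι M
  saving-pair {e} {f} j pf gj = begin
    ι (saving (toℕ e) (toℕ f) (suc (toℕ j)))               ≡⟨ ι-∸ {weight (toℕ e) + weight (toℕ f)} {pw} (ι-cancel-≤ {pw} {weight (toℕ e) + weight (toℕ f)} le) ⟩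
    ι (weight (toℕ e) + weight (toℕ f)) ℚ.- ι pw           ≡⟨ cong₂ ℚ._-_ sum≡ (pairWeight≡ e f j (proj₁ pf) gj) ⟩
    (w e ℚ.+ w f) ℚ.* ι M ℚ.- joint (both e f) ℚ.* ι M     ≡⟨ lemma (w e ℚ.+ w f) (joint (both e f)) (ι M) ⟩
    (w e ℚ.+ w f ℚ.- joint (both e f)) ℚ.* ι M             ≡⟨ cong (ℚ._* ι M) (saved-pair pf) ⟨
    saved e ℚ.* ι M                                        ∎
    where
    open ≡-Reasoning
    pw : ℕ
    pw = pairWeight (toℕ e) (toℕ f) (suc (toℕ j))
    sum≡ : ι (weight (toℕ e) + weight (toℕ f)) ≡ (w e ℚ.+ w f) ℚ.* ι M
    sum≡ = trans (ι-+ (weight (toℕ e)) (weight (toℕ f))) (trans (cong₂ ℚ._+_ (weight≡ e) (weight≡ f))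
      (sym (ℚₚ.*-distribʳ-+ (ι M) (w e) (w f))))
    le : ι pw ℚ.≤ ι (weight (toℕ e) + weight (toℕ f))
    le = subst₂ ℚ._≤_ (sym (pairWeight≡ e f j (proj₁ pf) gj)) (sym sum≡)
      (ℚₚ.*-monoʳ-≤-nonNeg (ι M) (ℚₚ.<⇒≤ (proj₂ (srlg-bounds pf))))
    lemma : ∀ a b c → a ℚ.* c ℚ.- b ℚ.* c ≡ (a ℚ.- b) ℚ.* c
    lemma = solve 3 (λ a b c → a :* c :- b :* c := (a :- b) :* c) refl
      where open +-*-Solver

  saving-none : ∀ e → saving e e 0 ≡ 0
  saving-none e = trans (cong ((weight e + weight e) ∸_) (trans
    (cong (λ p → (prodTo L (selected e) + prodTo L (selected e)) * p)
      (prodTo-agree GS λ j _ → branch-≢0 {x = rden j} {rnum j} (apart-pos (subst (_≢ 0) (+-comm 1 j) λ ()))))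
    (*-distribʳ-+ (prodTo GS rden) (prodTo L (selected e)) (prodTo L (selected e)))))
    (n∸n≡0 (weight e + weight e))

  record Link-values (l : Link) (W C h : ℕ) : Set where
    constructor mkLink-values
    field
      W≡ : ι W ≡ w l ℚ.* ι M
      C≡ : ι C ≡ saved l ℚ.* ι M
      h≡ : h ≡ toℕ (head (partner l))

  -- The set of a link and its partner may be listed several times, once for each group containing
  -- both. Whichever entry was found, the partner is the same by uniqueness and the set is
  -- `both l f`, so the coefficient is the same as well.
  good-values : ∀ l {W C h} → Good (toℕ l) W C h → Link-values l W C h
  good-values l (mkGood pt .0 (inj₁ (refl , refl)) co refl refl refl) =
    mkLink-values (weight≡ l)
      (trans (cong ι (saving-none (toℕ l))) (sym (trans (cong (ℚ._* ι M) (saved-none none′)) (ℚₚ.*-zeroˡ (ι M)))))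
      (trans (hd≡ l) (cong (toℕ ∘ head) (sym (partner-none none′))))
    where
    none′ : ¬ ∃ (Pair l)
    none′ (f , pf) with pair⇒unpaired l f pf
    ... | j , un = co (toℕ j) (toℕ f) (Finₚ.toℕ<n j) (Finₚ.toℕ<n f) un refl
  good-values l (mkGood pt .(suc j) (inj₂ (j , refl , j< , pt< , un)) co refl refl refl) =
    subst₂ (λ pt j → Link-values l (weight (toℕ l)) (saving (toℕ l) pt (suc j)) (hd pt))
      (Finₚ.toℕ-fromℕ< pt<) (Finₚ.toℕ-fromℕ< j<)
      (by-pair (unpaired⇒pair j′ l f (subst₂ (λ j p → Unpaired j (toℕ l) p ≡ 0)
        (sym (Finₚ.toℕ-fromℕ< j<)) (sym (Finₚ.toℕ-fromℕ< pt<)) un)))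
    where
    f : Link
    f = fromℕ< pt<
    j′ : Fin GS
    j′ = fromℕ< j<
    by-pair : Pair l f × grouped j′ ≡ both l f →
      Link-values l (weight (toℕ l)) (saving (toℕ l) (toℕ f) (suc (toℕ j′))) (hd (toℕ f))
    by-pair (pf , gj) = mkLink-values (weight≡ l) (saving-pair j′ pf gj)
      (trans (hd≡ f) (cong (toℕ ∘ head) (sym (partner-pair pf))))

  -- Makes the truncated difference `W ∸ C` in the capacities a true one.
  saved≤w : ∀ l → saved l ℚ.≤ w l
  saved≤w l with partner? l
  ... | no _ = w-nonneg l
  ... | yes (f , pf) = subst (w l ℚ.+ w f ℚ.- joint (both l f) ℚ.≤_) (lemma (w l) (w f))
    (ℚₚ.+-monoʳ-≤ (w l ℚ.+ w f) (ℚₚ.neg-antimono-≤ (ℚₚ.<⇒≤ (proj₁ (srlg-bounds pf)))))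
    where
    lemma : ∀ a b → a ℚ.+ b ℚ.- b ≡ a
    lemma = solve 2 (λ a b → a :+ b :- b := a) refl
      where open +-*-Solver

  partner-tail : ∀ l → tail (partner l) ≡ tail l
  partner-tail l with partner? l
  ... | no _ = refl
  ... | yes (f , _ , _ , t≡ , _) = sym t≡

  linkCut≡ : ∀ l {W C h} → Link-values l W C h → ∀ k k′ →
    ι (linkCut W C k k′) ≡ contribution (w l) (saved l) k k′ ℚ.* ι M
  linkCut≡ l {W} {C} (mkLink-values W≡ C≡ _) k k′ = trans (ι-+ (((W ∸ C) + (W ∸ C)) * ind k) (C * ind (k ∨ k′)))
    (trans (cong₂ ℚ._+_ (first k) (second (k ∨ k′))) (sym (ℚₚ.*-distribʳ-+ (ι M)
      (if k then (w l ℚ.- saved l) ℚ.+ (w l ℚ.- saved l) else 0ℚ) (if k ∨ k′ then saved l else 0ℚ))))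
    where
    C≤W : C ≤ W
    C≤W = ι-cancel-≤ (subst₂ ℚ._≤_ (sym C≡) (sym W≡) (ℚₚ.*-monoʳ-≤-nonNeg (ι M) (saved≤w l)))
    rest : ι (W ∸ C) ≡ (w l ℚ.- saved l) ℚ.* ι M
    rest = trans (ι-∸ C≤W) (trans (cong₂ ℚ._-_ W≡ C≡) (lemma (w l) (saved l) (ι M)))
      where
      lemma : ∀ a b c → a ℚ.* c ℚ.- b ℚ.* c ≡ (a ℚ.- b) ℚ.* c
      lemma = solve 3 (λ a b c → a :* c :- b :* c := (a :- b) :* c) refl
        where open +-*-Solver
    first : ∀ k → ι (((W ∸ C) + (W ∸ C)) * ind k) ≡
      (if k then (w l ℚ.- saved l) ℚ.+ (w l ℚ.- saved l) else 0ℚ) ℚ.* ι M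
    first true  = trans (cong ι (*-identityʳ ((W ∸ C) + (W ∸ C)))) (trans (ι-+ (W ∸ C) (W ∸ C))
      (trans (cong₂ ℚ._+_ rest rest) (sym (ℚₚ.*-distribʳ-+ (ι M) (w l ℚ.- saved l) (w l ℚ.- saved l)))))
    first false = trans (cong ι (*-zeroʳ ((W ∸ C) + (W ∸ C)))) (sym (ℚₚ.*-zeroˡ (ι M)))
    second : ∀ b → ι (C * ind b) ≡ (if b then saved l else 0ℚ) ℚ.* ι M
    second true  = trans (cong ι (*-identityʳ C)) C≡
    second false = trans (cong ι (*-zeroʳ C)) (sym (ℚₚ.*-zeroˡ (ι M)))

  -- Partial sums over the first `m` links, to match the induction over `Blocks`.
  upTo : ℕ → (Link → ℚ) → Link → ℚ
  upTo m F l = if toℕ l <ᵇ m then F l else 0ℚ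

  sum-upTo-suc : ∀ F (l : Link) → sum (upTo (suc (toℕ l)) F) ≡ sum (upTo (toℕ l) F) ℚ.+ F l
  sum-upTo-suc F l = begin
    sum (upTo (suc (toℕ l)) F)                     ≡⟨ sum-cong-≗ split ⟩
    sum (λ i → upTo (toℕ l) F i ℚ.+ δ i)           ≡⟨ ∑-distrib-+ (upTo (toℕ l) F) δ ⟩
    sum (upTo (toℕ l) F) ℚ.+ sum δ                 ≡⟨ cong (sum (upTo (toℕ l) F) ℚ.+_) (sum-one δ l λ i i≢l → if-≡ᵇ-no (i≢l ∘ Finₚ.toℕ-injective)) ⟩
    sum (upTo (toℕ l) F) ℚ.+ δ l                   ≡⟨ cong (sum (upTo (toℕ l) F) ℚ.+_) (if-≡ᵇ-yes {toℕ l} refl) ⟩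
    sum (upTo (toℕ l) F) ℚ.+ F l                   ∎
    where
    open ≡-Reasoning
    δ : Link → ℚ
    δ i = if toℕ i ≡ᵇ toℕ l then F i else 0ℚ
    lemma : ∀ a b x → (if a <ᵇ suc b then x else 0ℚ) ≡
      (if a <ᵇ b then x else 0ℚ) ℚ.+ (if a ≡ᵇ b then x else 0ℚ)
    lemma zero    zero    x = sym (ℚₚ.+-identityˡ x)
    lemma zero    (suc b) x = sym (ℚₚ.+-identityʳ x)
    lemma (suc a) zero    x = sym (ℚₚ.+-identityˡ 0ℚ)
    lemma (suc a) (suc b) x = lemma a b x
    split : ∀ i → upTo (suc (toℕ l)) F i ≡ upTo (toℕ l) F i ℚ.+ δ i
    split i = lemma (toℕ i) (toℕ l) (F i)

  sum-upTo-all : ∀ F → sum (upTo L F) ≡ sum F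
  sum-upTo-all F = sum-cong-≗ λ i → all i
    where
    all : ∀ (i : Link) → upTo L F i ≡ F i
    all i with toℕ i <ᵇ L in eq
    ... | true  = refl
    ... | false = contradiction (<⇒<ᵇ (Finₚ.toℕ<n i)) (subst (¬_ ∘ T) (sym eq) λ ())

  side : (ℕ → Bool) → Subset nodes
  side X = tabulate (X ∘ toℕ)

  lowerE-φ : ∀ X {m es} (bl : Blocks m es) → m ≤ L →
    ι (lowerE X bl) ≡ sum (upTo m (φ (cutLinks (side X)))) ℚ.* ι M
  lowerE-φ X none _ = sym (trans (cong (ℚ._* ι M) (sum-zero (upTo 0 F) λ _ → refl)) (ℚₚ.*-zeroˡ (ι M)))
    where F = φ (cutLinks (side X))
  lowerE-φ X (block {m} {es} {W} {C} {h} g bl) m< = trans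
    (ι-+ (lowerE X bl) (linkCut W C (X (tl m) ∧ not (X (hd m))) (X (tl m) ∧ not (X h))))
    (trans (cong₂ ℚ._+_ (lowerE-φ X bl (<⇒≤ m<)) here′)
      (trans (sym (ℚₚ.*-distribʳ-+ (ι M) (sum (upTo m F)) (F l))) (cong (ℚ._* ι M) (sym next))))
    where
    F : Link → ℚ
    F = φ (cutLinks (side X))
    l : Link
    l = fromℕ< m<
    l≡ : toℕ l ≡ m
    l≡ = Finₚ.toℕ-fromℕ< m<
    values : Link-values l W C h
    values = good-values l (subst (λ k → Good k W C h) (sym l≡) g)
    next : sum (upTo (suc m) F) ≡ sum (upTo m F) ℚ.+ F l
    next = subst (λ k → sum (upTo (suc k) F) ≡ sum (upTo k F) ℚ.+ F l) l≡ (sum-upTo-suc F l)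
    at : ∀ v → lookup (side X) v ≡ X (toℕ v)
    at = lookup∘tabulate _
    k≡ : X (tl m) ∧ not (X (hd m)) ≡ lookup (cutLinks (side X)) l
    k≡ = trans (cong₂ (λ u v → X u ∧ not (X v)) (trans (cong tl (sym l≡)) (tl≡ l)) (trans (cong hd (sym l≡)) (hd≡ l)))
      (sym (trans (lookup-cut (side X) l) (cong₂ (λ a b → a ∧ not b) (at (tail l)) (at (head l)))))
    -- The gadget knows only the head of the partner; its tail is that of `l`, also when `l` serves
    -- as its own partner.
    k′≡ : X (tl m) ∧ not (X h) ≡ lookup (cutLinks (side X)) (partner l)
    k′≡ = trans (cong₂ (λ u v → X u ∧ not (X v)) (trans (cong tl (sym l≡)) (trans (tl≡ l) (cong toℕ (sym (partner-tail l)))))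
        (Link-values.h≡ values))
      (sym (trans (lookup-cut (side X) (partner l)) (cong₂ (λ a b → a ∧ not b) (at (tail (partner l))) (at (head (partner l))))))
    here′ : ι (linkCut W C (X (tl m) ∧ not (X (hd m))) (X (tl m) ∧ not (X h))) ≡ F l ℚ.* ι M
    here′ = trans (linkCut≡ l values _ _) (cong₂ (λ k k′ → contribution (w l) (saved l) k k′ ℚ.* ι M) k≡ k′≡)

  lowerE-joint : ∀ X {es} (bl : Blocks L es) → let S = cutLinks (side X) in
    ι (lowerE X bl) ≡ (joint S ℚ.+ joint S) ℚ.* ι M
  lowerE-joint X bl = trans (lowerE-φ X bl ≤-refl)
    (cong (ℚ._* ι M) (trans (sum-upTo-all _) (joint-formula (side X))))

-- Programs of the form p₁ ⨾ while e loop p₂ ⨾ p₃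

-- The middle loop has no stored bound: its number of rounds is limited by the bit length of the
-- numbers that `p₁` leaves. The loop bounds of `p₃` may be computed by the earlier stages and need
-- be read-only only from then on, hence the two notions of admissibility.
module Stages (ro₁ : ℕ → Bool) (bound₁ : ℕ → ℕ → Bool) (ro₃ : ℕ → Bool) (bound₃ : ℕ → ℕ → Bool)
  (p₁ p₂ p₃ : Cmd) (e : Expr) (S : ℕ) where

  module A₁ = Admissible ro₁ bound₁
  module A₃ = Admissible ro₃ bound₃

  -- On inputs of size N: numbers of steps s, bounds b on the bit lengths of
  -- the numbers in memory, bounds Z on loop bounds, costs u of one step.
  s₁ b₁ s₂ b₂ u₁ Z₃ s₃ b₃ u₃ total-time : ℕ → ℕ
  s₁ N = steps N p₁
  b₁ N = N + s₁ N * (S * N)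
  s₂ N = 1 + b₁ N * suc (steps N p₂)
  b₂ N = b₁ N + s₂ N * (S * N)
  u₁ N = 3 * S * suc (b₂ N + S * N)
  Z₃ N = 1 + b₁ N + 20 * N
  s₃ N = steps (Z₃ N) p₃
  b₃ N = b₂ N + s₃ N * (S * b₂ N)
  u₃ N = 3 * S * suc (b₃ N + S * b₂ N)
  total-time N = s₁ N * u₁ N + (s₂ N * u₁ N + s₃ N * u₃ N)

  total-poly : PolyBounded total-time
  total-poly = poly-+ (poly-* ps₁ pu₁) (poly-+ (poly-* ps₂ pu₁) (poly-* ps₃ pu₃))
    where
    pN : PolyBounded (λ N → N)
    pN = poly-id
    pSN : PolyBounded (λ N → S * N)
    pSN = poly-* (poly-const S) pN
    ps₁ : PolyBounded s₁
    ps₁ = poly-steps p₁ pN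
    pb₁ : PolyBounded b₁
    pb₁ = poly-+ pN (poly-* ps₁ pSN)
    ps₂ : PolyBounded s₂
    ps₂ = poly-+ (poly-const 1) (poly-* pb₁ (poly-+ (poly-const 1) (poly-steps p₂ pN)))
    pb₂ : PolyBounded b₂
    pb₂ = poly-+ pb₁ (poly-* ps₂ pSN)
    pu₁ : PolyBounded u₁
    pu₁ = poly-* (poly-const (3 * S)) (poly-+ (poly-const 1) (poly-+ pb₂ pSN))
    pZ₃ : PolyBounded Z₃
    pZ₃ = poly-+ (poly-+ (poly-const 1) pb₁) (poly-* (poly-const 20) pN)
    ps₃ : PolyBounded s₃
    ps₃ = poly-steps p₃ pZ₃
    pSb₂ : PolyBounded (λ N → S * b₂ N)
    pSb₂ = poly-* (poly-const S) pb₂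
    pb₃ : PolyBounded b₃
    pb₃ = poly-+ pb₂ (poly-* ps₃ pSb₂)
    pu₃ : PolyBounded u₃
    pu₃ = poly-* (poly-const (3 * S)) (poly-+ (poly-const 1) (poly-+ pb₃ pSb₂))

  program : Program
  program = compile p₁ ⨾ while e loop compile p₂ ⨾ compile p₃

  module _
    (br₁ : ∀ a i → T (bound₁ a i) → T (ro₁ a)) (br₃ : ∀ a i → T (bound₃ a i) → T (ro₃ a))
    (ok₁ : A₁.ok p₁) (ok₂ : A₁.ok p₂) (okᵉ : A₁.okE e) (ok₃ : A₃.ok p₃)
    (size₁ : csize p₁ ≤ S) (size₂ : csize p₂ ≤ S) (sizeᵉ : suc (esize e) ≤ S) (size₃ : csize p₃ ≤ S)
    (N : ℕ) (1≤N : 1 ≤ N) (σ : Memory) (small : ∀ a i → σ a i < 2 ^ N)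
    (loops₁ : ∀ a i → T (bound₁ a i) → σ a i ≤ N)
    (n : ℕ) (n≤ : ∀ b → (∀ a i → exec p₁ σ a i < 2 ^ b) → n ≤ b)
    (nonzero : ∀ m → m < n → ⟦ e ⟧ (iter m (exec p₂) (exec p₁ σ)) ≢ 0)
    (zero! : ⟦ e ⟧ (iter n (exec p₂) (exec p₁ σ)) ≡ 0)
    (loops₃ : ∀ a i → T (bound₃ a i) → iter n (exec p₂) (exec p₁ σ) a i ≤ suc n + 20 * N)
    where

    module T₁ = A₁.Time N N S (b₂ N)
    -- The read-only cells of the third stage may hold computed numbers, so their bit length is
    -- bounded by `b₂ N` and not by the input size.
    module T₃ = A₃.Time (b₂ N) (Z₃ N) S (b₃ N)

    σ₁ σ₂ σ₃ : Memory
    σ₁ = exec p₁ σ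
    σ₂ = iter n (exec p₂) σ₁
    σ₃ = exec p₃ σ₂

    stage₁ : Runs (compile p₁) σ σ₁ (s₁ N) (u₁ N) × T₁.State (b₁ N) σ₁
    stage₁ = T₁.run br₁ p₁ ok₁ size₁ (T₁.state small (λ a _ i → small a i) loops₁ 1≤N) (m≤m+n (b₁ N) _)

    n≤b₁ : n ≤ b₁ N
    n≤b₁ = n≤ (b₁ N) (T₁.State.small (proj₂ stage₁))

    rounds≤ : 1 + n * suc (steps N p₂) ≤ s₂ N
    rounds≤ = s≤s (*-monoˡ-≤ (suc (steps N p₂)) n≤b₁)

    fits : b₁ N + (1 + n * suc (steps N p₂)) * (S * N) ≤ b₂ N
    fits = +-monoʳ-≤ (b₁ N) (*-monoˡ-≤ (S * N) rounds≤)

    stage₂ : Runs (while e loop compile p₂) σ₁ σ₂ (1 + n * suc (steps N p₂)) (u₁ N) ×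
      T₁.State (b₁ N + (1 + n * suc (steps N p₂)) * (S * N)) σ₂
    stage₂ = T₁.while-runs e (compile p₂) (exec p₂) (steps N p₂) okᵉ sizeᵉ (T₁.run br₁ p₂ ok₂ size₂) n σ₁
      (proj₂ stage₁) fits nonzero zero!

    small₂ : ∀ a i → σ₂ a i < 2 ^ b₂ N
    small₂ a i = <-≤-trans (T₁.State.small (proj₂ stage₂) a i) (2^-mono fits)

    1≤b₂ : 1 ≤ b₂ N
    1≤b₂ = ≤-trans 1≤N (≤-trans (m≤m+n N _) (m≤m+n (b₁ N) _))

    stage₃ : Runs (compile p₃) σ₂ σ₃ (s₃ N) (u₃ N) × T₃.State (b₃ N) σ₃
    stage₃ = T₃.run br₃ p₃ ok₃ size₃ (T₃.state small₂ (λ a _ i → small₂ a i)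
      (λ a i b → ≤-trans (loops₃ a i b) (+-monoˡ-≤ (20 * N) (s≤s n≤b₁))) 1≤b₂) ≤-refl

    runs : Σ ℕ λ t → ⟨ program , σ ⟩⇓[ t ] σ₃ × t ≤ total-time N
    runs = combine (proj₁ stage₁) (proj₁ stage₂) (proj₁ stage₃)
      where
      combine : Runs (compile p₁) σ σ₁ (s₁ N) (u₁ N) →
        Runs (while e loop compile p₂) σ₁ σ₂ (1 + n * suc (steps N p₂)) (u₁ N) →
        Runs (compile p₃) σ₂ σ₃ (s₃ N) (u₃ N) → Σ ℕ λ t → ⟨ program , σ ⟩⇓[ t ] σ₃ × t ≤ total-time N
      combine (t₁ , ⇓₁ , t₁≤) (t₂ , ⇓₂ , t₂≤) (t₃ , ⇓₃ , t₃≤) =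
        t₁ + (t₂ + t₃) , seq ⇓₁ (seq ⇓₂ ⇓₃) ,
        +-mono-≤ t₁≤ (+-mono-≤ (≤-trans t₂≤ (*-monoˡ-≤ (u₁ N) rounds≤)) t₃≤)

-- Powers of two up to the total capacity

guard : Expr
guard = var TT ⊖ arr PW (arr CONST (lit 0) ⊖ lit 1)

topPower : Expr
topPower = arr PW (arr CONST (lit 0) ⊖ lit 1)

grow : Cmd
grow = set PW (arr CONST (lit 0)) (topPower ⊕ topPower) ▸ set CONST (lit 0) (arr CONST (lit 0) ⊕ lit 1)

Least : ℕ → ℕ → Set
Least T n = T ≤ 2 ^ n × (∀ m → m < n → 2 ^ m < T)

least-power : ∀ T b → T ≤ 2 ^ b → Σ ℕ (Least T)
least-power T zero    T≤ = 0 , T≤ , λ _ ()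
least-power T (suc b) T≤ with T ≤? 2 ^ b
... | yes T≤′ = least-power T b T≤′
... | no T≰   = suc b , T≤ , λ m m≤b → ≤-<-trans (2^-mono (s≤s⁻¹ m≤b)) (≰⇒> T≰)

-- The total capacity is itself a number in memory, so the bit lengths reached by the construction
-- bound the number of powers of two that are needed.
least-bound : ∀ {T n} b → Least T n → T < 2 ^ b → n ≤ b
least-bound {T} {n} b (_ , below) T< with n ≤? b
... | yes n≤b = n≤b
... | no n≰b  = contradiction (<-trans T< (below b (≰⇒> n≰b))) (<-irrefl refl)

-- Sizes of encoded instances

arraySize : List ℕ → ℕ
arraySize xs = sumℕ (List.map bits xs)

entry-< : ∀ xs i → entry 0 xs i < 2 ^ arraySize xs
entry-< []       i       = s≤s z≤n
entry-< (x ∷ xs) zero    = <-≤-trans (<-2^bits x) (2^-mono (m≤m+n (bits x) (arraySize xs)))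
entry-< (x ∷ xs) (suc i) = <-≤-trans (entry-< xs i) (2^-mono (m≤n+m (arraySize xs) (bits x)))

length-≤ : ∀ xs → length xs ≤ arraySize xs
length-≤ []       = z≤n
length-≤ (x ∷ xs) = +-mono-≤ {1} {bits x} (s≤s z≤n) (length-≤ xs)

array-≤ : ∀ x a → arraySize (entry [] x a) ≤ size x
array-≤ []       a       = z≤n
array-≤ (xs ∷ x) zero    = m≤m+n (arraySize xs) (size x)
array-≤ (xs ∷ x) (suc a) = ≤-trans (array-≤ x a) (m≤n+m (size x) (arraySize xs))

load-< : ∀ x a i → load x a i < 2 ^ size x
load-< x zero    i = m^n>0 2 (size x)
load-< x (suc a) i = <-≤-trans (entry-< (entry [] x a) i) (2^-mono (array-≤ x a))

array-length-≤ : ∀ x a → length (entry [] x a) ≤ size x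
array-length-≤ x a = ≤-trans (length-≤ (entry [] x a)) (array-≤ x a)

scalingArray : ℕ → Bool
scalingArray a = inputArray a ∨ (a ≡ᵇ CONST)

scalingBound : ℕ → ℕ → Bool
scalingBound a i = (a ≡ᵇ CONST) ∧ (i <ᵇ 4)

T-∧ˡ : ∀ {x y} → T (x ∧ y) → T x
T-∧ˡ {true} _ = tt

inputBound-array : ∀ a i → T (inputBound a i) → T (inputArray a)
inputBound-array a i p with ≡ᵇ⇒≡ a 1 (T-∧ˡ p)
... | refl = tt

scalingBound-array : ∀ a i → T (scalingBound a i) → T (scalingArray a)
scalingBound-array a i p with ≡ᵇ⇒≡ a CONST (T-∧ˡ p)
... | refl = tt

arcs-length : ∀ {src dst res rev} n es → Arcs src dst res rev n es → n ≡ 2 * length es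
arcs-length n []       n≡0 = n≡0
arcs-length n (_ ∷ es) (m , refl , _ , _ , arcs) = trans (cong (λ k → suc (suc k)) (arcs-length m es arcs)) (lemma (length es))
  where
  lemma : ∀ k → suc (suc (2 * k)) ≡ 2 * suc k
  lemma = solve-∀

p+p≤q+q⇒p≤q : ∀ {p q} → p ℚ.+ p ℚ.≤ q ℚ.+ q → p ℚ.≤ q
p+p≤q+q⇒p≤q {p} {q} le = ℚₚ.≮⇒≥ λ q<p → ℚₚ.<-irrefl refl (ℚₚ.<-≤-trans (ℚₚ.+-mono-< q<p q<p) le)

positive-does : ∀ x → not (does (x ≟ 0)) ≡ positive x
positive-does zero    = refl
positive-does (suc x) = refl

-- The solver, its correctness and its running time

module Solver (S : ℕ) = Stages inputArray inputBound scalingArray scalingBound build grow scaling guard S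

module Solution (I : MC-NSRLG-Instance) (paired : Pairs.Paired (MC-NSRLG-Instance.net I)) where

  open MC-NSRLG-Instance I
  open Encoding I
  open Encoded I
  open Values I paired
  open Build σ₀ hiding (nodes)
  open Lower σ₀

  N : ℕ
  N = size encodeInstance

  below : ∀ l → l < L → tl l < nodes × hd l < nodes
  below l l< = subst (λ k → tl k < nodes × hd k < nodes) (Finₚ.toℕ-fromℕ< l<)
    (subst (_< nodes) (sym (tl≡ (fromℕ< l<))) (Finₚ.toℕ<n _) ,
     subst (_< nodes) (sym (hd≡ (fromℕ< l<))) (Finₚ.toℕ<n _))

  Separated : (ℕ → Bool) → Set
  Separated X = X (toℕ s) ≡ true × X (toℕ t) ≡ false

  characteristic : Subset nodes → ℕ → Bool
  characteristic Y v with v <? nodes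
  ... | yes v< = lookup Y (fromℕ< v<)
  ... | no _   = false

  characteristic-toℕ : ∀ Y v → characteristic Y (toℕ v) ≡ lookup Y v
  characteristic-toℕ Y v with toℕ v <? nodes
  ... | yes v< = cong (lookup Y) (Finₚ.fromℕ<-toℕ v v<)
  ... | no v≮  = contradiction (Finₚ.toℕ<n v) v≮

  -- `X` need not place the auxiliary nodes well: twice the scaled cost of its network cut is at
  -- most its capacity. A competing cut `Y` is extended with the best sides, where the two are
  -- equal, so minimality among the cuts of the graph carries over.
  cutE-minimal : ∀ {es} (bl : Blocks L es) X → Separated X →
    (∀ Y → Separated Y → cutE X es ≤ cutE Y es) → IsMinCut s t (side X)
  cutE-minimal {es} bl X (Xs , Xt) minimal =
    (lookup⇒∈ (trans (lookup∘tabulate _ s) Xs) , lookup⇒∉ (trans (lookup∘tabulate _ t) Xt)) , least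
    where
    hs : Heads bl
    hs = heads bl ≤-refl below
    least : ∀ Y → Separates s t Y → joint (cutLinks (side X)) ℚ.≤ joint (cutLinks Y)
    least Y (s∈ , t∉) = p+p≤q+q⇒p≤q (ℚₚ.*-cancelʳ-≤-pos (ι M) (subst₂ ℚ._≤_ (lowerE-joint X bl)
      (trans (lowerE-joint Y′ bl) (cong (λ Z → (joint (cutLinks Z) ℚ.+ joint (cutLinks Z)) ℚ.* ι M) side-Y′))
      (ι-mono (≤-trans (lowerE≤cutE X bl) (≤-trans (minimal Y′ Y′-sep)
        (≤-reflexive (sym (lowerE-tight Y′ bl (extend-tight (characteristic Y) bl ≤-refl below hs)))))))))
      where
      Y′ : ℕ → Bool
      Y′ = extend (characteristic Y) bl
      at : ∀ v → Y′ (toℕ v) ≡ lookup Y v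
      at v = trans (extend-old (characteristic Y) bl (toℕ v) (Finₚ.toℕ<n v)) (characteristic-toℕ Y v)
      side-Y′ : side Y′ ≡ Y
      side-Y′ = lookup-ext (side Y′) Y λ v → trans (lookup∘tabulate _ v) (at v)
      Y′-sep : Separated Y′
      Y′-sep = trans (at s) (∈⇒lookup s∈) , trans (at t) (∉⇒lookup t∉)

  record Ready (K : ℕ) (τ : Memory) : Set where
    constructor mkReady
    field
      built : Built L τ
      cK    : τ CONST 0 ≡ suc K
      cA    : τ CONST 1 ≡ τ NA 0
      cR    : τ CONST 2 ≡ suc (τ NA 0 + τ NA 0)
      cN    : τ CONST 3 ≡ nodes + L
      pw    : ∀ i → i ≤ K → τ PW i ≡ 2 ^ i

  ready-min-cut : ∀ K τ → Ready K τ → τ TT 0 ≤ 2 ^ K →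
    IsMinCut s t (side (positive ∘ exec scaling τ MARK))
  ready-min-cut K τ (mkReady (mkBuilt inp es (mkArcsOf arcs total) bl) cK cA cR cN pw) TT≤ =
    cutE-minimal bl (positive ∘ exec scaling τ MARK) (proj₁ correct)
      λ Y sep → subst₂ _≤_ (cutE-arcs _ _ es arcs) (cutE-arcs Y _ es arcs) (proj₂ correct Y sep)
    where
    A : ℕ
    A = τ NA 0
    ga : ∀ k → k < A → GoodArc (τ SRC) (τ DST) (τ REV) (nodes + L) A k
    ga = goodArc A es arcs (blocks-below bl ≤-refl below)
    graph : Graph
    graph = record
      { N = nodes + L ; A = A ; src = τ SRC ; dst = τ DST ; rev = τ REV ; s = toℕ s ; t = toℕ t
      ; src<N = λ k k< → GoodArc.src< (ga k k<) ; dst<N = λ k k< → GoodArc.dst< (ga k k<)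
      ; rev<A = λ k k< → GoodArc.rev< (ga k k<)
      ; src-rev = λ k k< → GoodArc.src-rev (ga k k<) ; dst-rev = λ k k< → GoodArc.dst-rev (ga k k<)
      ; s<N = ≤-trans (Finₚ.toℕ<n s) (m≤m+n nodes L) ; t<N = ≤-trans (Finₚ.toℕ<n t) (m≤m+n nodes L)
      ; s≢t = s≢t ∘ Finₚ.toℕ-injective
      }
    module Sc = Scaling graph K
    X₀ : ℕ → Bool
    X₀ v = v ≡ᵇ toℕ s
    low : Sc.cut X₀ (τ RES) ≤ A * 2 ^ suc K
    low = by-size A refl
      where
      -- The cut around s alone is at most the total capacity, hence at most `2 ^ K`. The factor `A`
      -- is harmless unless it is 0, and then the cut is an empty sum.
      by-size : ∀ a → A ≡ a → Sc.cut X₀ (τ RES) ≤ A * 2 ^ suc K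
      by-size zero    eq = ≤-trans (≤-reflexive
        (cong (λ a → sumTo a (λ k → τ RES k * crossing X₀ (τ SRC k) (τ DST k))) eq)) z≤n
      by-size (suc a) eq = ≤-trans (≤-reflexive (cutE-arcs X₀ A es arcs))
        (≤-trans (cutE≤totalE X₀ es) (≤-trans (≤-reflexive (sym total)) (≤-trans TT≤
          (≤-trans (2^-mono (n≤1+n K)) (≤-trans (≤-reflexive (sym (+-identityʳ (2 ^ suc K))))
            (*-monoˡ-≤ (2 ^ suc K) {1} {A} (subst (1 ≤_) (sym eq) (s≤s z≤n))))))))
    correct : Sc.Sep (positive ∘ exec scaling τ MARK) ×
      (∀ Y → Sc.Sep Y → Sc.cut (positive ∘ exec scaling τ MARK) (τ RES) ≤ Sc.cut Y (τ RES))
    correct = Sc.scaling-correct τ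
      (Sc.mkFixed (λ _ → refl) (λ _ → refl) (λ _ → refl) (inp 1 tt 4) (inp 1 tt 5) cK cA cR cN pw)
      (X₀ , (≡ᵇ-yes {toℕ s} refl , ≡ᵇ-no (s≢t ∘ sym ∘ Finₚ.toℕ-injective)) , low)

  built₀ : Built 0 σ₀
  built₀ = mkBuilt (λ _ _ _ → refl) [] (mkArcsOf refl refl) none

  record Grown (c m : ℕ) (τ : Memory) : Set where
    constructor mkGrown
    field
      ready : Ready m τ
      TT≡   : τ TT 0 ≡ c

  grow-grown : ∀ c m τ → Grown c m τ → Grown c (suc m) (exec grow τ)
  grow-grown c m τ (mkGrown (mkReady (mkBuilt inp es arcs bl) cK cA cR cN pw) TT≡) = mkGrown
    (mkReady (mkBuilt (input-exec grow _ inp) es (arcs-exec grow refl arcs) bl)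
      (trans (cong (_+ 1) cK) (+-comm (suc m) 1)) cA cR cN powers) TT≡
    where
    top : τ PW (τ CONST 0 ∸ 1) ≡ 2 ^ m
    top = trans (cong (λ z → τ PW (z ∸ 1)) cK) (pw m ≤-refl)
    powers : ∀ i → i ≤ suc m → exec grow τ PW i ≡ 2 ^ i
    powers i i≤ with i ≟ suc m
    ... | yes refl = trans (if-≡ᵇ-yes (sym cK)) (trans (cong₂ _+_ top top)
      (cong (2 ^ m +_) (sym (+-identityʳ (2 ^ m)))))
    ... | no i≢    = trans (if-≡ᵇ-no λ i≡ → i≢ (trans i≡ cK)) (pw i (s≤s⁻¹ (≤∧≢⇒< i≤ i≢)))

  τ₁ : Memory
  τ₁ = exec build σ₀

  grown₀ : Finished τ₁ → Grown (τ₁ TT 0) 0 τ₁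
  grown₀ (mkFinished b cN cA cR cK pw) = mkGrown (mkReady b cK cA cR cN λ { zero _ → pw }) refl

  grown : ∀ m → Grown (τ₁ TT 0) m (iter m (exec grow) τ₁)
  grown m = iter-inv (Grown (τ₁ TT 0)) m (grown₀ (build-finished built₀)) λ k τ _ → grow-grown (τ₁ TT 0) k τ

  guard-value : ∀ c m τ → Grown c m τ → ⟦ guard ⟧ τ ≡ c ∸ 2 ^ m
  guard-value c m τ (mkGrown (mkReady _ cK _ _ _ pw) TT≡) =
    cong₂ _∸_ TT≡ (trans (cong (λ z → τ PW (z ∸ 1)) cK) (pw m ≤-refl))

  power : Σ ℕ (Least (τ₁ TT 0))
  power = least-power (τ₁ TT 0) (τ₁ TT 0) (<⇒≤ (k<2^k (τ₁ TT 0)))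

  n : ℕ
  n = proj₁ power

  τ₂ : Memory
  τ₂ = iter n (exec grow) τ₁

  min-cut : IsMinCut s t (decodeCut nodes (exec scaling τ₂ 0))
  min-cut = subst (IsMinCut s t) (tabulate-cong λ v → sym (positive-does (exec scaling τ₂ MARK (toℕ v))))
    (ready-min-cut n τ₂ (Grown.ready (grown n)) (subst (_≤ 2 ^ n) (sym (Grown.TT≡ (grown n))) (proj₁ (proj₂ power))))

  length-allFin : ∀ {B : Set} {m} (f : Fin m → B) → length (List.map f (allFin m)) ≡ m
  length-allFin {m = m} f = trans (Listₚ.length-map f (allFin m)) (Listₚ.length-tabulate (λ i → i))

  nodes≤N : nodes ≤ N
  nodes≤N = ≤-trans (≤-reflexive (sym (length-allFin toℕ))) (array-length-≤ encodeInstance 1)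

  L≤N : L ≤ N
  L≤N = ≤-trans (≤-reflexive (sym (length-allFin (λ l → toℕ (tail l))))) (array-length-≤ encodeInstance 2)

  GS≤N : GS ≤ N
  GS≤N = ≤-trans (≤-reflexive (sym (Listₚ.length-map (λ S → abs (↥ ρ S)) groupedSets))) (array-length-≤ encodeInstance 8)

  1≤N : 1 ≤ N
  1≤N = ≤-trans (s≤s z≤n) (array-length-≤ encodeInstance 0)

  input-loops : ∀ a i → T (inputBound a i) → σ₀ a i ≤ N
  input-loops a i b = at a (≡ᵇ⇒≡ a 1 (T-∧ˡ b)) i b
    where
    at : ∀ a → a ≡ 1 → ∀ i → T (inputBound a i) → σ₀ a i ≤ N
    at .1 refl 1 _ = L≤N
    at .1 refl 3 _ = GS≤N

  blocks-length : ∀ {m es} → Blocks m es → length es ≡ 4 * m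
  blocks-length none = refl
  blocks-length (block {m} g bl) = trans (cong (4 +_) (blocks-length bl)) (sym (*-suc 4 m))

  scaling-loops : ∀ k τ → Ready k τ → ∀ a i → T (scalingBound a i) → τ a i ≤ suc k + 20 * N
  scaling-loops k τ rd a i b = at a (≡ᵇ⇒≡ a CONST (T-∧ˡ b)) i b
    where
    NA≡ : Built L τ → τ NA 0 ≡ 8 * L
    NA≡ (mkBuilt _ es (mkArcsOf arcs _) bl) = trans (arcs-length _ es arcs)
      (trans (cong (2 *_) (blocks-length bl)) (sym (*-assoc 2 4 L)))
    A≡ : τ NA 0 ≡ 8 * L
    A≡ = NA≡ (Ready.built rd)
    -- Four edges per link and two arcs per edge make `8 * L` arcs and one more than `16 * L` rounds
    -- per phase; the constant 20 covers both and the number of nodes.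
    within : ∀ c → c ≤ 20 → c * L ≤ 20 * N
    within c c≤ = *-mono-≤ c≤ L≤N
    at : ∀ a → a ≡ CONST → ∀ i → T (scalingBound a i) → τ a i ≤ suc k + 20 * N
    at .CONST refl 0 _ = ≤-trans (≤-reflexive (Ready.cK rd)) (m≤m+n (suc k) (20 * N))
    at .CONST refl 1 _ = ≤-trans (≤-reflexive (trans (Ready.cA rd) A≡))
      (≤-trans (within 8 (m≤m+n 8 12)) (m≤n+m (20 * N) (suc k)))
    at .CONST refl 2 _ = ≤-trans (≤-reflexive (trans (Ready.cR rd)
        (cong suc (trans (cong₂ _+_ A≡ A≡) (sym (*-distribʳ-+ L 8 8))))))
      (s≤s (≤-trans (within 16 (m≤m+n 16 4)) (m≤n+m (20 * N) k)))
    at .CONST refl 3 _ = ≤-trans (≤-reflexive (Ready.cN rd)) (≤-trans (+-mono-≤ nodes≤N L≤N)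
      (≤-trans (≤-trans (≤-reflexive (cong (N +_) (sym (+-identityʳ N)))) (*-monoˡ-≤ N (m≤m+n 2 18)))
        (m≤n+m (20 * N) (suc k))))
    at .CONST refl (suc (suc (suc (suc i)))) ()

  module _ (S : ℕ) (size₁ : csize build ≤ S) (size₂ : csize grow ≤ S) (sizeᵉ : suc (esize guard) ≤ S)
    (size₃ : csize scaling ≤ S) where

    runs-in-time : Σ ℕ λ time → ⟨ Solver.program S , σ₀ ⟩⇓[ time ] exec scaling τ₂ × time ≤ Solver.total-time S N
    runs-in-time = Solver.runs S inputBound-array scalingBound-array _ _ _ _ size₁ size₂ sizeᵉ size₃ N 1≤N σ₀
      (load-< encodeInstance) input-loops n
      (λ b small → least-bound b (proj₂ power) (small TT 0))
      (λ m m<n eq → m<n⇒n≢0 (m<n⇒0<n∸m (proj₂ (proj₂ power) m m<n))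
        (trans (sym (guard-value _ m _ (grown m))) eq))
      (trans (guard-value _ n _ (grown n)) (m≤n⇒m∸n≡0 (proj₁ (proj₂ power))))
      (scaling-loops n τ₂ (Grown.ready (grown n)))

    solution : ∀ c k → (∀ n → 1 ≤ n → Solver.total-time S n ≤ c * n ^ k) →
      Σ ℕ λ time → Σ Memory λ σ → ⟨ Solver.program S , load encodeInstance ⟩⇓[ time ] σ ×
      time ≤ c * size encodeInstance ^ k × IsMinCut s t (decodeCut nodes (σ 0))
    solution c k poly = proj₁ runs-in-time , exec scaling τ₂ , proj₁ (proj₂ runs-in-time) ,
      ≤-trans (proj₂ (proj₂ runs-in-time)) (poly N 1≤N) , min-cut

paired-solvable : ∀ S → csize build ≤ S → csize grow ≤ S → suc (esize guard) ≤ S → csize scaling ≤ S →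
  PolyBounded (Solver.total-time S) →
  (P : MC-NSRLG-Instance → Set) → (∀ I → P I → Pairs.Paired (MC-NSRLG-Instance.net I)) →
  SolvableInPolyTime MC-NSRLG P
paired-solvable S size₁ size₂ sizeᵉ size₃ (c , k , poly) P paired = Solver.program S , c , k ,
  λ I p → Solution.solution I (paired I p) S size₁ size₂ sizeᵉ size₃ c k poly

solvable : (P : MC-NSRLG-Instance → Set) → (∀ I → P I → Pairs.Paired (MC-NSRLG-Instance.net I)) →
  SolvableInPolyTime MC-NSRLG P
solvable = paired-solvable S
  (m≤m+n (csize build) _)
  (≤-trans (m≤m+n (csize grow) _) (m≤n+m _ (csize build)))
  (≤-trans (m≤m+n (suc (esize guard)) (csize scaling)) (≤-trans (m≤n+m _ (csize grow)) (m≤n+m _ (csize build))))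
  (≤-trans (m≤n+m (csize scaling) (suc (esize guard))) (≤-trans (m≤n+m _ (csize grow)) (m≤n+m _ (csize build))))
  (Solver.total-poly S)
  where
  S : ℕ
  S = csize build + (csize grow + (suc (esize guard) + csize scaling))

mainTheorem8 : SolvableInPolyTime MC-NSRLG MC-NSRLG-Instance.Condition₁ ×
    SolvableInPolyTime MC-NSRLG MC-NSRLG-Instance.Condition₂ ×
    SolvableInPolyTime MC-NSRLG MC-NSRLG-Instance.Condition₁and₂
mainTheorem8 =
  solvable _ (λ I → Pairs.condition₁-paired (MC-NSRLG-Instance.net I)) ,
  solvable _ (λ I → Pairs.condition₂-paired (MC-NSRLG-Instance.net I)) ,
  solvable _ (λ I → Pairs.condition₁and₂-paired (MC-NSRLG-Instance.net I))
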